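{- The Young Schubert polynomial $\hat{\mathfrak S}_w$ is equal to $\sum_{r\in \mathrm{RFYC}({\rm rev}(w))}x^{{\rm wt}(r)}$. Moreover, $\mathrm{RFYC}(w)$ is a union of Demazure crystals, under the convention that we begin with the lowest weight rather than the highest and use the $f_i$ operators.
   Context: Let $w\in S_n$ and $\mathrm{rev}(w)$ its one-line notation read right to left. The Schubert polynomial $\mathfrak S_w=\partial_{w^{ -1}w_0}(x_1^{n-1}\cdots x_{n-1})$ (divided differences $\partial_i f=(f-s_if)/(x_i-x_{i+1})$, $w_0$ longest permutation), and the Young Schubert polynomial is $\hat{\mathfrak S}_w(x_1,\ldots,x_n)=\mathfrak S_{\mathrm{rev}(w)}(x_n,\ldots,x_1)$. Following Morse–Schilling, a reduced factorization of $w$ with $\ell$ blocks is a reduced word for $w$ split into $\ell$ (possibly empty) consecutive blocks $r^1r^2\cdots r^\ell$ (from left) with entries strictly decreasing within each block; these form $\mathrm{RF}^\ell(w)$, which carries the Morse–Schilling crystal structure (operators $e_i,f_i$). Here the weight of $r$ is the length-$n$ weak composition $\mathrm{wt}(r)=(0,\ldots,0,|r^\ell|,|r^{\ell-1}|,\ldots,|r^1|)$ with $n-\ell$ leading zeros. Let $\ell$ be the position of the rightmost descent of $w$; $\mathrm{RFYC}(w)$ (reduced factorizations with Young cutoff) is the set of elements of $\mathrm{RF}^\ell(w)$ whose $i$th block from the left has smallest entry at least $i$ (for nonempty blocks). Demazure truncation from the lowest weight means taking sets $\hat{\mathfrak D}_{i_1}\cdots\hat{\mathfrak D}_{i_k}\{\hat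 u\}$ with $\hat{\mathfrak D}_iX=\{b: f_i^r(b)\in X \text{ for some } r\ge0\}$ starting from the lowest weight element $\hat u$ of a component. -}

module Defs where

open import Data.Nat using (ℕ; zero; suc; _+_; _∸_; _≤_; _<_; _≟_; _<?_; _⊔_)
open import Data.Nat.Properties using () renaming (_≟_ to _≟ℕ_)
open import Data.Bool using (Bool; true; false; if_then_else_)
open import Data.Fin using (Fin; toℕ; fromℕ<; opposite)
open import Data.Fin.Permutation using (Permutation′; _⟨$⟩ʳ_; _⟨$⟩ˡ_; _∘ₚ_; reverse)
open import Data.Integer as ℤ using (ℤ)
open import Data.List using (List; []; _∷_; _++_; map; concat; concatMap; length; filter; foldr; upTo) renaming (sum to sumℕ)
open import Data.List.Relation.Unary.All using (All)
open import Data.List.Relation.Unary.Any using (Any)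
open import Data.List.Relation.Unary.Linked using (Linked)
open import Data.Maybe using (Maybe; just; nothing; _>>=_)
open import Data.Product using (Σ; _×_; _,_; ∃; proj₁; proj₂)
open import Data.Unit using (⊤)
open import Data.Vec as Vec using (Vec; tabulate; lookup; zipWith)
open import Data.Vec.Properties using (≡-dec)
open import Relation.Binary.PropositionalEquality using (_≡_)
open import Relation.Nullary using (yes; no; does)
open import Relation.Nullary.Decidable using (⌊_⌋)

-- Permutations of S_n.  We use the library's Permutation′ n; positions
-- and values are Fin n (0-based), i.e. Fin value k stands for k+1.
-- One-line notation: w(k) = w ⟨$⟩ʳ k.  Products of permutations are
-- composition of functions: (uv)(k) = u(v(k)).

-- w0 (longest element) is the library's `reverse` (k ↦ opposite k).
-- rev(w): one-line notation read right to left, rev(w)(k) = w(w0(k)).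
revP : ∀ {n} → Permutation′ n → Permutation′ n
revP w = reverse ∘ₚ w

val : ∀ {n} → (Fin n → Fin n) → ℕ → ℕ
val {n} w m with m <? n
... | yes p = toℕ (w (fromℕ< p))
... | no _  = 0

-- number of inversions = Coxeter length
inv : ∀ {n} → (Fin n → Fin n) → ℕ
inv {n} w = length (concatMap (λ i → filter (λ j → val w j <? val w i)
                                      (map (λ d → i + suc d) (upTo (n ∸ suc i))))
                              (upTo n))

-- position (1-based) of the rightmost descent w(k) > w(k+1); 0 if none
rightmostDescent : ∀ {n} → (Fin n → Fin n) → ℕ
rightmostDescent {n} w =
  foldr _⊔_ 0 (map suc (filter (λ m → val w (suc m) <? val w m) (upTo (n ∸ 1))))

-- simple transposition s_a (a ∈ {1,…,n-1}) swapping 1-based positions a, a+1,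
-- i.e. 0-based a-1 and a.
swapℕ : ℕ → ℕ → ℕ
swapℕ a m = if does (suc m ≟ a) then a else (if does (m ≟ a) then a ∸ 1 else m)

sw : ∀ {n} → ℕ → Fin n → Fin n
sw {n} a k with swapℕ a (toℕ k) <? n
... | yes p = fromℕ< p
... | no _  = k

wordFun : ∀ {n} → List ℕ → Fin n → Fin n
wordFun []       k = k
wordFun (a ∷ as) k = sw a (wordFun as k)

IsReducedWord : ∀ n → (Fin n → Fin n) → List ℕ → Set
IsReducedWord n u a =
  All (λ x → 1 ≤ x × suc x ≤ n) a × length a ≡ inv u × (∀ k → wordFun a k ≡ u k)

-- Polynomials in x₁,…,xₙ with integer coefficients, as finite lists of
-- terms (coefficient, exponent vector); equality is equality of all
-- coefficients.

Mono : ℕ → Set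
Mono n = Vec ℕ n

Poly : ℕ → Set
Poly n = List (ℤ × Mono n)

coeff : ∀ {n} → Poly n → Mono n → ℤ
coeff []            e = ℤ.0ℤ
coeff ((c , f) ∷ p) e = (if ⌊ ≡-dec _≟ℕ_ f e ⌋ then c else ℤ.0ℤ) ℤ.+ coeff p e

_≈P_ : ∀ {n} → Poly n → Poly n → Set
p ≈P q = ∀ e → coeff p e ≡ coeff q e

_*P_ : ∀ {n} → Poly n → Poly n → Poly n
p *P q = concatMap (λ t → map (λ s → (proj₁ t ℤ.* proj₁ s , zipWith _+_ (proj₂ t) (proj₂ s))) q) p

_-P_ : ∀ {n} → Poly n → Poly n → Poly n
p -P q = p ++ map (λ t → (ℤ.- proj₁ t , proj₂ t)) q

swapVars : ∀ {n} → ℕ → Poly n → Poly n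
swapVars i = map (λ t → (proj₁ t , tabulate (λ k → lookup (proj₂ t) (sw i k))))

var : ∀ {n} → ℕ → Poly n
var i = (ℤ.1ℤ , tabulate (λ k → if does (suc (toℕ k) ≟ i) then 1 else 0)) ∷ []

IsDivDiff : ∀ {n} → ℕ → Poly n → Poly n → Set
IsDivDiff i f g = ((var i -P var (suc i)) *P g) ≈P (f -P swapVars i f)

IsDivDiffWord : ∀ {n} → List ℕ → Poly n → Poly n → Set
IsDivDiffWord []       f g = f ≈P g
IsDivDiffWord (a ∷ as) f g = Σ _ λ h → IsDivDiffWord as f h × IsDivDiff a h g

staircase : ∀ n → Poly n
staircase n = (ℤ.1ℤ , tabulate (λ k → n ∸ suc (toℕ k))) ∷ []

-- the Schubert polynomial 𝔖_v equals P: P = ∂_{v⁻¹w₀}(x^δ), computed along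
-- any reduced word of v⁻¹w₀ (the result is independent of the choice).
SchubertIs : ∀ n → Permutation′ n → Poly n → Set
SchubertIs n v P = ∀ a → IsReducedWord n (λ k → v ⟨$⟩ˡ opposite k) a →
                   ∀ g → IsDivDiffWord a (staircase n) g → g ≈P P

reverseVars : ∀ {n} → Poly n → Poly n
reverseVars = map (λ t → (proj₁ t , Vec.reverse (proj₂ t)))

-- Young Schubert polynomial: Ŝ_w(x₁..xₙ) = 𝔖_{rev w}(xₙ,…,x₁) equals P
YoungSchubertIs : ∀ n → Permutation′ n → Poly n → Set
YoungSchubertIs n w P = SchubertIs n (revP w) (reverseVars P)

-- Reduced factorizations.  A factorization is the list of its blocks
-- r¹ r² ⋯ r^ℓ read from the left.

Fact : Set
Fact = List (List ℕ)

IsRF : ∀ n → Permutation′ n → ℕ → Fact → Set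
IsRF n w ℓ r = length r ≡ ℓ × All (Linked (λ x y → y < x)) r
             × IsReducedWord n (w ⟨$⟩ʳ_) (concat r)

YoungCutoff : ℕ → Fact → Set
YoungCutoff i []       = ⊤
YoungCutoff i (b ∷ bs) = All (i ≤_) b × YoungCutoff (suc i) bs

ℓOf : ∀ {n} → Permutation′ n → ℕ
ℓOf w = rightmostDescent (w ⟨$⟩ʳ_)

IsRFYC : ∀ n → Permutation′ n → Fact → Set
IsRFYC n w r = IsRF n w (ℓOf w) r × YoungCutoff 1 r

block : Fact → ℕ → List ℕ
block []       _       = []
block (b ∷ bs) zero    = b
block (b ∷ bs) (suc m) = block bs m

-- wt(r) = (0,…,0,|r^ℓ|,…,|r¹|) with n-ℓ leading zeros
wt : ∀ n → ℕ → Fact → Mono n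
wt n ℓ r = tabulate λ k → if does (toℕ k <? n ∸ ℓ) then 0
                           else length (block r (ℓ ∸ suc (toℕ k ∸ (n ∸ ℓ))))

sumWt : ∀ n → ℕ → List Fact → Poly n
sumWt n ℓ L = map (λ r → (ℤ.1ℤ , wt n ℓ r)) L

-- Morse–Schilling crystal operator f_j on a pair of adjacent blocks
-- w^{j+1} w^j (MS indexing, w^{j+1} to the left).  Pairing: letters b of
-- the left block in decreasing order are paired with the smallest
-- still-unpaired a > b of the right block.  f_j removes a = max of the
-- unpaired letters of the right block and inserts a+s into the left
-- block, s = min{t ≥ 0 : a+t+1 ∉ right block}; f_j = 0 if no unpaired.

elem : ℕ → List ℕ → Bool
elem x []       = false
elem x (y ∷ ys) = if does (x ≟ y) then true else elem x ys

minAbove : ℕ → List ℕ → Maybe ℕ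
minAbove b []       = nothing
minAbove b (a ∷ as) with minAbove b as | b <? a
... | m        | no _  = m
... | nothing  | yes _ = just a
... | just m   | yes _ = if does (a <? m) then just a else just m

removeOne : ℕ → List ℕ → List ℕ
removeOne x []       = []
removeOne x (y ∷ ys) = if does (x ≟ y) then ys else y ∷ removeOne x ys

-- unpaired letters of the right block R after pairing with left block L
-- (L is listed in decreasing order)
unpaired : List ℕ → List ℕ → List ℕ
unpaired []      R = R
unpaired (b ∷ L) R with minAbove b R
... | nothing = unpaired L R
... | just a  = unpaired L (removeOne a R)

maxOf : List ℕ → Maybe ℕ
maxOf []       = nothing
maxOf (a ∷ as) with maxOf as
... | nothing = just a
... | just m  = just (a ⊔ m)

-- smallest t ≥ 0 with a+t+1 ∉ R (fuel = length R + 1 suffices)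
shiftS : ℕ → List ℕ → ℕ → ℕ → ℕ
shiftS a R zero       t = t
shiftS a R (suc fuel) t = if elem (a + t + 1) R then shiftS a R fuel (suc t) else t

insertDec : ℕ → List ℕ → List ℕ
insertDec x []       = x ∷ []
insertDec x (y ∷ ys) = if does (y <? x) then x ∷ y ∷ ys else y ∷ insertDec x ys

fPair : List ℕ → List ℕ → Maybe (List ℕ × List ℕ)
fPair L R with maxOf (unpaired L R)
... | nothing = nothing
... | just a  = just (insertDec (a + shiftS a R (suc (length R)) 0) L , removeOne a R)

fAt : ℕ → Fact → Maybe Fact
fAt zero    (L ∷ R ∷ rs) with fPair L R
... | nothing        = nothing
... | just (L' , R') = just (L' ∷ R' ∷ rs)
fAt zero    _            = nothing
fAt (suc p) []           = nothing
fAt (suc p) (b ∷ rs)     with fAt p rs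
... | nothing  = nothing
... | just rs' = just (b ∷ rs')

-- The crystal operator f_i (i ∈ {1,…,n-1}, weight coordinates i, i+1 of
-- wt) on RF^ℓ: for i = (n-ℓ)+j with 1 ≤ j ≤ ℓ-1 it is the MS operator f_j,
-- acting on the blocks w^{j+1} = r^{ℓ-j} and w^j = r^{ℓ-j+1}; for other i
-- it is 0 (the weight coordinates ≤ n-ℓ are identically zero).
fOp : ℕ → ℕ → ℕ → Fact → Maybe Fact
fOp n ℓ i r = if does (n ∸ ℓ <? i) then
                (if does (suc i <? suc n) then fAt (ℓ ∸ suc (i ∸ (n ∸ ℓ))) r else nothing)
              else nothing

fIter : ℕ → ℕ → ℕ → ℕ → Fact → Maybe Fact
fIter n ℓ i zero    r = just r
fIter n ℓ i (suc k) r = fIter n ℓ i k r >>= fOp n ℓ i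

IsLowest : ℕ → ℕ → Fact → Set
IsLowest n ℓ u = ∀ i → fOp n ℓ i u ≡ nothing

-- r ∈ 𝔇̂_{i₁} ⋯ 𝔇̂_{i_k} {u} inside the crystal RF^ℓ(w),
-- where 𝔇̂_i X = { b : f_i^m b ∈ X for some m ≥ 0 }
InDemazure : ∀ n → Permutation′ n → ℕ → List ℕ → Fact → Fact → Set
InDemazure n w ℓ []       u r = r ≡ u
InDemazure n w ℓ (i ∷ is) u r =
  IsRF n w ℓ r × ∃ λ m → ∃ λ b → fIter n ℓ i m r ≡ just b × InDemazure n w ℓ is u b

{-# OPTIONS --safe #-}

-- Schubert part. In the nilCoxeter algebra the generating function of reduced factorizations with
-- cutoff is the product A₁(x₁)A₂(x₂)⋯ with A_i(x) = (1 + x u_{n-1})⋯(1 + x u_i). Since A_i(x) and A_i(y)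
-- commute (Fomin–Stanley), the divided difference ∂_i acts on it as right multiplication by u_i; for
-- w₀ only the staircase monomial survives.
--
-- Demazure part. Fix a state (B_i, φ_i) for every block and consider the factorizations whose block i is
-- a sequence of letters ≥ φ_i followed by exactly the letters B_i < φ_i. The set of factorizations with
-- cutoff has B_i = ∅ and φ_i = i. Thresholds are raised one at a time, keeping φ weakly increasing and
-- the B_i the columns of a column-strict tableau. If B_{i-1} is longer than B_i (or i = 1), the set splits
-- according to whether φ_i belongs to block i. If B_{i-1} and B_i have equal length and φ_{i-1} = φ_i, then
-- the letters B_i are always paired, a copy of φ_i in block i is never paired, and raising φ_i is undone
-- by one Demazure operator; if they have equal length but φ_{i-1} < φ_i, one raises φ_{i-1} first.
-- When all thresholds exceed the letters, at most the single factorization (B_i) is left, and it is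
-- of lowest weight.
module Submission where

open import Defs
open import Data.Bool using (Bool; true; false; if_then_else_; T)
open import Data.Empty using (⊥; ⊥-elim)
import Data.Fin as Fin
open import Data.Fin using (Fin; zero; suc; toℕ; fromℕ<; opposite)
open import Data.Fin.Permutation using (Permutation′; _⟨$⟩ʳ_; _⟨$⟩ˡ_; inverseˡ; inverseʳ)
import Data.Fin.Properties as Fin
open import Data.Fin.Properties using (toℕ<n; toℕ-fromℕ<; fromℕ<-toℕ; toℕ-injective; opposite-prop)
open import Data.Integer as ℤ using (ℤ; 0ℤ; 1ℤ)
import Data.Integer.Properties as ℤ
import Data.Integer.Tactic.RingSolver as ℤ-Solver
open import Algebra.Properties.AbelianGroup ℤ.+-0-abelianGroup using (∙-cancelʳ)
open import Data.List hiding (sum; find; lookup; zipWith; tabulate)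
open import Data.List.Membership.Propositional using (_∈_; _∉_; find; lose)
open import Data.List.Membership.Propositional.Properties
open import Data.List.Membership.Propositional.Properties.WithK using (unique∧set⇒bag)
open import Data.List.Properties hiding (≡-dec; sum-++)
import Data.List.Properties as List
open import Data.List.Relation.Binary.BagAndSetEquality using (∼bag⇒↭)
open import Data.List.Relation.Binary.Permutation.Propositional using (↭-sym)
open import Data.List.Relation.Binary.Permutation.Propositional.Properties using (All-resp-↭; ↭-reverse; ↭-length)
open import Data.List.Relation.Binary.Pointwise as Pointwise using (Pointwise; []; _∷_)
open import Data.List.Relation.Unary.All as All using (All; []; _∷_)
import Data.List.Relation.Unary.All.Properties as All
open import Data.List.Relation.Unary.AllPairs using (AllPairs; []; _∷_)
import Data.List.Relation.Unary.AllPairs.Properties as AllPairs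
open import Data.List.Relation.Unary.Any as Any using (Any; here; there)
import Data.List.Relation.Unary.Any.Properties as Any
open import Data.List.Relation.Unary.Linked as Linked using (Linked; []; [-]; _∷_)
open import Data.List.Relation.Unary.Linked.Properties using (AllPairs⇒Linked; Linked⇒AllPairs)
open import Data.List.Relation.Unary.Unique.Propositional using (Unique)
import Data.List.Relation.Unary.Unique.Propositional.Properties as Unique
open import Data.List.Reverse using (Reverse; reverseView; []; _∶_∶ʳ_)
open import Data.Maybe as Maybe using (Maybe; just; nothing; maybe′; _>>=_)
open import Data.Nat
open import Data.Nat.ListAction using (sum)
open import Data.Nat.ListAction.Properties using (sum-++)
open import Data.Nat.Properties
import Data.Nat.Tactic.RingSolver as ℕ-Solver
open import Data.Product using (Σ; _×_; _,_; ∃; ∃₂; proj₁; proj₂)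
open import Data.Sum using (_⊎_; inj₁; inj₂)
open import Data.Vec as Vec using (Vec; []; _∷_)
import Data.Vec.Properties as Vec
open import Function using (_∘_; id; _⇔_; mk⇔; Equivalence)
open import Level using (0ℓ)
open import Relation.Binary.PropositionalEquality
open import Relation.Nullary
open import Relation.Nullary.Decidable using (dec-true; dec-false; _×-dec_; ⌊_⌋)
open import Relation.Unary using (Pred; Decidable)

-- Words and the action on positions

-- `SchubertIs` speaks of every reduced word of v⁻¹w₀ and every chain of quotients along it. So
-- nothing has to be constructed: it suffices that division by x_i - x_{i+1} is unique and that the
-- numbers of factorizations satisfy the same recursion. These numbers are natural, so relations
-- between them are stated with negative terms moved across. The recursion passes from v to v s_k
-- and on to w₀, hence permutations are replaced by one-line notations, on which generators swap
-- places. Factorizations have ℓ blocks, the nilCoxeter product has n; the extra blocks are empty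
-- because a reduced word cannot end in a letter beyond the last descent. In the Demazure part
-- membership is tested inside RF^ℓ(w), so an operator must be shown to preserve both the product
-- and reducedness; this is a braid computation with runs of consecutive letters. The delicate
-- direction for a raised threshold leads from f_i(r) back to r: no letter below the threshold may
-- have been moved.

act : List ℕ → ℕ → ℕ
act []       m = m
act (a ∷ as) m = swapℕ a (act as m)

act-++ : ∀ u v m → act (u ++ v) m ≡ act u (act v m)
act-++ []      v m = refl
act-++ (a ∷ u) v m = cong (swapℕ a) (act-++ u v m)

infix 4 _≋_
-- A record instead of a function type, so that the two words can be inferred.
record _≋_ (u v : List ℕ) : Set where
  constructor pointwise
  field _at_ : ∀ m → act u m ≡ act v m
open _≋_ public

≋-refl : ∀ {u} → u ≋ u
≋-refl = pointwise λ _ → refl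

≋-trans : ∀ {u v w} → u ≋ v → v ≋ w → u ≋ w
≋-trans p q = pointwise λ m → trans (p at m) (q at m)

≋-sym : ∀ {u v} → u ≋ v → v ≋ u
≋-sym p = pointwise λ m → sym (p at m)

≡⇒≋ : ∀ {u v} → u ≡ v → u ≋ v
≡⇒≋ refl = ≋-refl

++-cong≋ : ∀ {u u′ v v′} → u ≋ u′ → v ≋ v′ → u ++ v ≋ u′ ++ v′
++-cong≋ {u} {u′} {v} {v′} p q = pointwise λ m → begin
  act (u ++ v) m     ≡⟨ act-++ u v m ⟩
  act u (act v m)    ≡⟨ cong (act u) (q at m) ⟩
  act u (act v′ m)   ≡⟨ p at act v′ m ⟩
  act u′ (act v′ m)  ≡⟨ act-++ u′ v′ m ⟨
  act (u′ ++ v′) m   ∎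
  where open ≡-Reasoning

++-congˡ≋ : ∀ u {v v′} → v ≋ v′ → u ++ v ≋ u ++ v′
++-congˡ≋ u = ++-cong≋ (≋-refl {u})

++-congʳ≋ : ∀ {u u′} v → u ≋ u′ → u ++ v ≋ u′ ++ v
++-congʳ≋ v p = ++-cong≋ p (≋-refl {v})

-- Lowering letters and positions together reduces the Coxeter relations for `swapℕ` to the case
-- where the smallest letter is 1.
swapℕ-suc : ∀ k m → swapℕ (suc (suc k)) (suc m) ≡ suc (swapℕ (suc k) m)
swapℕ-suc k m with suc m ≡ᵇ suc k
... | true = refl
... | false with m ≡ᵇ suc k
...   | true  = refl
...   | false = refl

swapℕ-far : ∀ k → swapℕ (suc (suc k)) 0 ≡ 0
swapℕ-far k = refl

swapℕ-invol : ∀ k m → swapℕ (suc k) (swapℕ (suc k) m) ≡ m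
swapℕ-invol zero zero          = refl
swapℕ-invol zero (suc zero)    = refl
swapℕ-invol zero (suc (suc m)) = refl
swapℕ-invol (suc k) zero       = refl
swapℕ-invol (suc k) (suc m)    = begin
  swapℕ (2 + k) (swapℕ (2 + k) (suc m))  ≡⟨ cong (swapℕ (2 + k)) (swapℕ-suc k m) ⟩
  swapℕ (2 + k) (suc (swapℕ (suc k) m))  ≡⟨ swapℕ-suc k (swapℕ (suc k) m) ⟩
  suc (swapℕ (suc k) (swapℕ (suc k) m))  ≡⟨ cong suc (swapℕ-invol k m) ⟩
  suc m                                  ∎
  where open ≡-Reasoning

swapℕ-comm : ∀ j k m → swapℕ (suc j) (swapℕ (3 + (j + k)) m) ≡ swapℕ (3 + (j + k)) (swapℕ (suc j) m)
swapℕ-comm zero k zero          = refl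
swapℕ-comm zero k (suc zero)    = trans (cong (swapℕ 1) (swapℕ-suc (suc k) 0)) (sym (swapℕ-far (suc k)))
swapℕ-comm zero k (suc (suc m)) = begin
  swapℕ 1 (swapℕ (3 + k) (2 + m))       ≡⟨ cong (swapℕ 1) (trans (swapℕ-suc (suc k) (suc m)) (cong suc (swapℕ-suc k m))) ⟩
  2 + swapℕ (suc k) m                   ≡⟨ trans (swapℕ-suc (suc k) (suc m)) (cong suc (swapℕ-suc k m)) ⟨
  swapℕ (3 + k) (2 + m)                 ∎
  where open ≡-Reasoning
swapℕ-comm (suc j) k zero    = refl
swapℕ-comm (suc j) k (suc m) = begin
  swapℕ (2 + j) (swapℕ (4 + (j + k)) (suc m))  ≡⟨ cong (swapℕ (2 + j)) (swapℕ-suc (2 + (j + k)) m) ⟩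
  swapℕ (2 + j) (suc (swapℕ (3 + (j + k)) m))  ≡⟨ swapℕ-suc j (swapℕ (3 + (j + k)) m) ⟩
  suc (swapℕ (suc j) (swapℕ (3 + (j + k)) m))  ≡⟨ cong suc (swapℕ-comm j k m) ⟩
  suc (swapℕ (3 + (j + k)) (swapℕ (suc j) m))  ≡⟨ swapℕ-suc (2 + (j + k)) (swapℕ (suc j) m) ⟨
  swapℕ (4 + (j + k)) (suc (swapℕ (suc j) m))  ≡⟨ cong (swapℕ (4 + (j + k))) (swapℕ-suc j m) ⟨
  swapℕ (4 + (j + k)) (swapℕ (2 + j) (suc m))  ∎
  where open ≡-Reasoning

Far : ℕ → ℕ → Set
Far a b = 1 ≤ a × 2 + a ≤ b

far-comm : ∀ {a b} → Far a b → a ∷ b ∷ [] ≋ b ∷ a ∷ []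
far-comm {suc j} {b} (_ , p) with k , refl ← m≤n⇒∃[o]m+o≡n p = pointwise (swapℕ-comm j k)

swapℕ-braid : ∀ k m → swapℕ (suc k) (swapℕ (2 + k) (swapℕ (suc k) m))
                    ≡ swapℕ (2 + k) (swapℕ (suc k) (swapℕ (2 + k) m))
swapℕ-braid zero zero                = refl
swapℕ-braid zero (suc zero)          = refl
swapℕ-braid zero (suc (suc zero))    = refl
swapℕ-braid zero (suc (suc (suc m))) = refl
swapℕ-braid (suc k) zero             = refl
swapℕ-braid (suc k) (suc m)
  rewrite swapℕ-suc k m | swapℕ-suc (suc k) m | swapℕ-suc (suc k) (swapℕ (suc k) m)
        | swapℕ-suc k (swapℕ (2 + k) m) | swapℕ-suc k (swapℕ (2 + k) (swapℕ (suc k) m))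
        | swapℕ-suc (suc k) (swapℕ (suc k) (swapℕ (2 + k) m))
  = cong suc (swapℕ-braid k m)

far-comm-list : ∀ {u v} → All (λ a → All (Far a) v) u → u ++ v ≋ v ++ u
far-comm-list {[]}    {v} []       = ≡⇒≋ (sym (++-identityʳ v))
far-comm-list {a ∷ u} {v} (p ∷ ps) = ≋-trans (++-congˡ≋ (a ∷ []) (far-comm-list ps)) (slide v p u)
  where
  slide : ∀ v → All (Far a) v → ∀ u → a ∷ v ++ u ≋ v ++ a ∷ u
  slide []      []       u = ≋-refl
  slide (b ∷ v) (q ∷ qs) u = ≋-trans (++-congʳ≋ (v ++ u) (far-comm q)) (++-congˡ≋ (b ∷ []) (slide v qs u))

-- down a s is the decreasing run a+s-1, …, a+1, a.
down : ℕ → ℕ → List ℕ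
down a zero    = []
down a (suc s) = a + s ∷ down a s

down-snoc : ∀ a s → down a (suc s) ≡ down (suc a) s ++ a ∷ []
down-snoc a zero    = cong (_∷ []) (+-identityʳ a)
down-snoc a (suc s) = cong₂ _∷_ (+-suc a s) (down-snoc a s)

down-< : ∀ a s → All (_< a + s) (down a s)
down-< a zero    = []
down-< a (suc s) rewrite +-suc a s = ≤-refl ∷ All.map m≤n⇒m≤1+n (down-< a s)

down-≥ : ∀ a s → All (a ≤_) (down a s)
down-≥ a zero    = []
down-≥ a (suc s) = m≤m+n a s ∷ down-≥ a s

length-down : ∀ a s → length (down a s) ≡ s
length-down a zero    = refl
length-down a (suc s) = cong suc (length-down a s)

down-comm : ∀ {a s} → 1 ≤ a → down a s ++ a + suc s ∷ [] ≋ a + suc s ∷ down a s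
down-comm {a} {s} 1≤a = far-comm-list
  (All.zipWith (λ {x} (p , q) → (≤-trans 1≤a q , subst (suc (suc x) ≤_) (sym (+-suc a s)) (s≤s p)) ∷ [])
    (down-< a s , down-≥ a s))

braid : ∀ {b} → 1 ≤ b → b ∷ suc b ∷ b ∷ [] ≋ suc b ∷ b ∷ suc b ∷ []
braid {suc k} _ = pointwise (swapℕ-braid k)

-- The relation behind a crystal move: the left run gains the letter a+s at its top while the right
-- run loses a at its bottom. In the induction the larger top letter slides past the lower run, and
-- one braid relation acts on the tops.
run-exchange : ∀ {a} s → 1 ≤ a → down a s ++ down a (suc s) ≋ down a (suc s) ++ down (suc a) s
run-exchange zero 1≤a = ≋-refl
run-exchange {a} (suc s) 1≤a =
  ≋-trans (++-congˡ≋ (a + s ∷ []) (slide (down a (suc s))))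
  (≋-trans (++-congˡ≋ (a + s ∷ a + suc s ∷ []) (run-exchange s 1≤a))
  (≋-trans (++-congʳ≋ (down a s ++ down (suc a) s) braid′)
  (≋-trans (++-congˡ≋ (a + suc s ∷ a + s ∷ []) (≋-sym (slide (down (suc a) s))))
  (≡⇒≋ (cong (λ z → a + suc s ∷ a + s ∷ down a s ++ z ∷ down (suc a) s) (+-suc a s))))))
  where
  slide : ∀ v → down a s ++ a + suc s ∷ v ≋ a + suc s ∷ down a s ++ v
  slide v = ≋-trans (≡⇒≋ (sym (++-assoc (down a s) (a + suc s ∷ []) v))) (++-congʳ≋ v (down-comm {s = s} 1≤a))
  braid′ : a + s ∷ a + suc s ∷ a + s ∷ [] ≋ a + suc s ∷ a + s ∷ a + suc s ∷ []
  braid′ = subst (λ z → a + s ∷ z ∷ a + s ∷ [] ≋ z ∷ a + s ∷ z ∷ []) (sym (+-suc a s)) (braid (≤-trans 1≤a (m≤m+n a s)))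

-- After `run-exchange` on the lower letters, the two top letters a+s meet and cancel. This shows
-- that a word containing such a square is not reduced.
run-square : ∀ {a} s → 1 ≤ a → down a (suc s) ++ down a (suc s) ≋ down a s ++ down (suc a) s
run-square {a} s 1≤a = ≋-trans (++-congˡ≋ (a + s ∷ []) (run-exchange s 1≤a))
  (++-congʳ≋ (down a s ++ down (suc a) s) (square (≤-trans 1≤a (m≤m+n a s))))
  where
  square : ∀ {b} → 1 ≤ b → b ∷ b ∷ [] ≋ []
  square {suc k} _ = pointwise (swapℕ-invol k)

-- Inversions and reduced words

line : ∀ {n} → (Fin n → Fin n) → List ℕ
line {n} u = applyUpTo (val u) n

below : ℕ → List ℕ → ℕ
below x = length ∘ filter (_<? x)

invL : List ℕ → ℕ
invL []       = 0
invL (x ∷ xs) = below x xs + invL xs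

-- The positions k and k+1 are 0-based here, so this is the letter k+1.
swapL : ℕ → List ℕ → List ℕ
swapL zero    (x ∷ y ∷ v) = y ∷ x ∷ v
swapL zero    v           = v
swapL (suc k) []          = []
swapL (suc k) (x ∷ v)     = x ∷ swapL k v

isDesc : ℕ → List ℕ → Bool
isDesc zero    (x ∷ y ∷ v) = does (y <? x)
isDesc zero    _           = false
isDesc (suc k) []          = false
isDesc (suc k) (x ∷ v)     = isDesc k v

swapL-invol : ∀ k v → swapL k (swapL k v) ≡ v
swapL-invol zero    []          = refl
swapL-invol zero    (x ∷ [])    = refl
swapL-invol zero    (x ∷ y ∷ v) = refl
swapL-invol (suc k) []          = refl
swapL-invol (suc k) (x ∷ v)     = cong (x ∷_) (swapL-invol k v)

+-swap : ∀ a b c → a + (b + c) ≡ b + (a + c)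
+-swap a b c = trans (sym (+-assoc a b c)) (trans (cong (_+ c) (+-comm a b)) (+-assoc b a c))

below-∷ : ∀ z x v → below z (x ∷ v) ≡ (if does (x <? z) then 1 else 0) + below z v
below-∷ z x v with does (x <? z)
... | true  = refl
... | false = refl

below-swapL : ∀ z k v → below z (swapL k v) ≡ below z v
below-swapL z zero [] = refl
below-swapL z zero (x ∷ []) = refl
below-swapL z zero (x ∷ y ∷ v)
  rewrite below-∷ z x (y ∷ v) | below-∷ z y (x ∷ v) | below-∷ z x v | below-∷ z y v
  = +-swap (if does (y <? z) then 1 else 0) (if does (x <? z) then 1 else 0) (below z v)
below-swapL z (suc k) [] = refl
below-swapL z (suc k) (x ∷ v) with does (x <? z)
... | true  = cong suc (below-swapL z k v)
... | false = below-swapL z k v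

invL-desc : ∀ k v → isDesc k v ≡ true → invL v ≡ suc (invL (swapL k v))
invL-desc zero (x ∷ y ∷ v) d
  rewrite below-∷ x y v | below-∷ y x v | d | dec-false (x <? y) (<-asym (<ᵇ⇒< y x (subst T (sym d) _)))
  = cong suc (+-swap (below x v) (below y v) (invL v))
invL-desc (suc k) (x ∷ v) d = begin
  below x v + invL v                       ≡⟨ cong (below x v +_) (invL-desc k v d) ⟩
  below x v + suc (invL (swapL k v))       ≡⟨ +-suc _ _ ⟩
  suc (below x v + invL (swapL k v))       ≡⟨ cong (λ z → suc (z + invL (swapL k v))) (below-swapL x k v) ⟨
  suc (below x (swapL k v) + invL (swapL k v)) ∎
  where open ≡-Reasoning

invL-nodesc : ∀ k v → isDesc k v ≡ false → invL v ≤ invL (swapL k v)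
invL-nodesc zero [] d = ≤-refl
invL-nodesc zero (x ∷ []) d = ≤-refl
invL-nodesc zero (x ∷ y ∷ v) d
  rewrite below-∷ x y v | below-∷ y x v | d
  = ≤-trans (≤-reflexive (+-swap (below x v) (below y v) (invL v)))
      (+-monoˡ-≤ (below x v + invL v) (m≤n+m (below y v) (if does (x <? y) then 1 else 0)))
invL-nodesc (suc k) [] d = ≤-refl
invL-nodesc (suc k) (x ∷ v) d rewrite below-swapL x k v = +-monoʳ-≤ (below x v) (invL-nodesc k v d)

invL-swapL : ∀ k v → invL (swapL k v) ≤ suc (invL v)
invL-swapL k v with isDesc k v in d
... | true  = subst (invL (swapL k v) ≤_) (cong suc (sym (invL-desc k v d))) (m≤n⇒m≤1+n (n≤1+n _))
... | false with isDesc k (swapL k v) in d′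
...   | true  = ≤-reflexive (trans (invL-desc k (swapL k v) d′) (cong (suc ∘ invL) (swapL-invol k v)))
...   | false = m≤n⇒m≤1+n (subst (invL (swapL k v) ≤_) (cong invL (swapL-invol k v)) (invL-nodesc k (swapL k v) d′))

applyUpTo-cong : ∀ {f g : ℕ → ℕ} n → (∀ m → m < n → f m ≡ g m) → applyUpTo f n ≡ applyUpTo g n
applyUpTo-cong zero    p = refl
applyUpTo-cong (suc n) p = cong₂ _∷_ (p 0 z<s) (applyUpTo-cong n (λ m m<n → p (suc m) (s<s m<n)))

applyUpTo-inj : ∀ {f g : ℕ → ℕ} n → applyUpTo f n ≡ applyUpTo g n → ∀ m → m < n → f m ≡ g m
applyUpTo-inj (suc n) p zero    _         = ∷-injectiveˡ p
applyUpTo-inj (suc n) p (suc m) (s≤s m<n) = applyUpTo-inj n (∷-injectiveʳ p) m m<n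

swapL-applyUpTo : ∀ f k n → suc k < n → applyUpTo (f ∘ swapℕ (suc k)) n ≡ swapL k (applyUpTo f n)
swapL-applyUpTo f zero    (suc (suc n)) _ = refl
swapL-applyUpTo f zero    (suc zero) (s≤s ())
swapL-applyUpTo f (suc k) (suc n) (s≤s lt) = cong (f 0 ∷_)
  (trans (applyUpTo-cong n (λ m _ → cong f (swapℕ-suc k m))) (swapL-applyUpTo (f ∘ suc) k n lt))

InRange : ℕ → ℕ → Set
InRange n x = 1 ≤ x × suc x ≤ n

-- The free `f` makes the induction work: the first letter of the word is absorbed into `f` as one
-- swap of entries.
invL-act : ∀ {n} f W → All (InRange n) W → invL (applyUpTo (f ∘ act W) n) ≤ length W + invL (applyUpTo f n)
invL-act f [] [] = ≤-refl
invL-act {n} f (suc k ∷ W) ((_ , lt) ∷ r) = begin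
  invL (applyUpTo (f ∘ swapℕ (suc k) ∘ act W) n)          ≤⟨ invL-act (f ∘ swapℕ (suc k)) W r ⟩
  length W + invL (applyUpTo (f ∘ swapℕ (suc k)) n)       ≡⟨ cong (λ z → length W + invL z) (swapL-applyUpTo f k n lt) ⟩
  length W + invL (swapL k (applyUpTo f n))               ≤⟨ +-monoʳ-≤ (length W) (invL-swapL k (applyUpTo f n)) ⟩
  length W + suc (invL (applyUpTo f n))                   ≡⟨ +-suc (length W) _ ⟩
  suc (length W) + invL (applyUpTo f n)                   ∎
  where open ≤-Reasoning

invL-increasing : ∀ (f : ℕ → ℕ) n → (∀ i j → i < j → f i < f j) → invL (applyUpTo f n) ≡ 0
invL-increasing f zero    p = refl
invL-increasing f (suc n) p = cong₂ _+_ (none n (f ∘ suc) (λ m lt → <-asym lt (p 0 (suc m) z<s)))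
                                       (invL-increasing (f ∘ suc) n (λ i j lt → p (suc i) (suc j) (s<s lt)))
  where
  none : ∀ n (g : ℕ → ℕ) → (∀ m → ¬ (g m < f 0)) → below (f 0) (applyUpTo g n) ≡ 0
  none zero    g q = refl
  none (suc n) g q rewrite dec-false (g 0 <? f 0) (q 0) = none n (g ∘ suc) (q ∘ suc)

invL-upTo : ∀ n → invL (upTo n) ≡ 0
invL-upTo n = invL-increasing id n (λ _ _ lt → lt)

invL-word : ∀ {n} W → All (InRange n) W → invL (applyUpTo (act W) n) ≤ length W
invL-word {n} W r = subst (invL (applyUpTo (act W) n) ≤_)
  (trans (cong (length W +_) (invL-upTo n)) (+-identityʳ _)) (invL-act id W r)

length-filter-map : ∀ {A B : Set} {P : Pred B 0ℓ} (P? : Decidable P) (h : A → B) xs →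
                    length (filter P? (map h xs)) ≡ length (filter (P? ∘ h) xs)
length-filter-map P? h []       = refl
length-filter-map P? h (x ∷ xs) with does (P? (h x))
... | true  = cong suc (length-filter-map P? h xs)
... | false = length-filter-map P? h xs

-- `inv` runs over pairs of positions, `invL` over the list; dropping position 0 and shifting `f`
-- matches the two.
inversions-invL : ∀ (f : ℕ → ℕ) n →
  length (concatMap (λ i → filter (λ j → f j <? f i) (map (λ d → i + suc d) (upTo (n ∸ suc i)))) (upTo n))
  ≡ invL (applyUpTo f n)
inversions-invL f n = trans (count f n) (lemma f n)
  where
  after : (ℕ → ℕ) → ℕ → ℕ → ℕ
  after f n i = length (filter (λ d → f (i + suc d) <? f i) (upTo (n ∸ suc i)))
  length-concatMap : ∀ {A B : Set} (g : A → List B) (h : A → ℕ) → (∀ i → length (g i) ≡ h i) →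
                     ∀ xs → length (concatMap g xs) ≡ sum (map h xs)
  length-concatMap g h e [] = refl
  length-concatMap g h e (x ∷ xs) = trans (length-++ (g x)) (cong₂ _+_ (e x) (length-concatMap g h e xs))
  count : ∀ f n → length (concatMap (λ i → filter (λ j → f j <? f i) (map (λ d → i + suc d) (upTo (n ∸ suc i)))) (upTo n))
                  ≡ sum (map (after f n) (upTo n))
  count f n = length-concatMap _ (after f n) (λ i → length-filter-map (λ j → f j <? f i) (λ d → i + suc d) (upTo (n ∸ suc i))) (upTo n)
  lemma : ∀ f n → sum (map (after f n) (upTo n)) ≡ invL (applyUpTo f n)
  lemma f zero    = refl
  lemma f (suc n) = cong₂ _+_
    (trans (sym (length-filter-map (_<? f 0) (f ∘ suc) (upTo n))) (cong (below (f 0)) (map-upTo (f ∘ suc) n)))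
    (trans (cong sum (trans (map-applyUpTo suc (after f (suc n)) n) (sym (map-upTo (after (f ∘ suc) n) n)))) (lemma (f ∘ suc) n))

inv-line : ∀ {n} (u : Fin n → Fin n) → inv u ≡ invL (line u)
inv-line {n} u = inversions-invL (val u) n

val-toℕ : ∀ {n} (u : Fin n → Fin n) k → val u (toℕ k) ≡ toℕ (u k)
val-toℕ {n} u k with toℕ k <? n
... | yes p = cong (toℕ ∘ u) (fromℕ<-toℕ k p)
... | no ¬p = ⊥-elim (¬p (toℕ<n k))

swapℕ-< : ∀ {n} k m → suc k < n → m < n → swapℕ (suc k) m < n
swapℕ-< zero zero          p q = p
swapℕ-< zero (suc zero)    p q = <-trans z<s p
swapℕ-< zero (suc (suc m)) p q = q
swapℕ-< (suc k) zero       p q = q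
swapℕ-< {suc n} (suc k) (suc m) (s≤s p) (s≤s q) rewrite swapℕ-suc k m = s<s (swapℕ-< k m p q)

toℕ-sw : ∀ {n} a (k : Fin n) → InRange n a → toℕ (sw a k) ≡ swapℕ a (toℕ k)
toℕ-sw {n} (suc a) k (_ , lt) with swapℕ (suc a) (toℕ k) <? n
... | yes p = toℕ-fromℕ< p
... | no ¬p = ⊥-elim (¬p (swapℕ-< a (toℕ k) lt (toℕ<n k)))

toℕ-wordFun : ∀ {n} W (k : Fin n) → All (InRange n) W → toℕ (wordFun W k) ≡ act W (toℕ k)
toℕ-wordFun []      k []       = refl
toℕ-wordFun (a ∷ W) k (p ∷ ps) = trans (toℕ-sw a (wordFun W k) p) (cong (swapℕ a) (toℕ-wordFun W k ps))

-- Refers to a list V instead of a permutation, so that stripping the last letter only replaces V by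
-- a swapped list and no permutation has to be built.
Reduced : ℕ → List ℕ → List ℕ → Set
Reduced n V W = All (InRange n) W × length W ≡ invL V × applyUpTo (act W) n ≡ V

reduced⇒ : ∀ {n} {u : Fin n → Fin n} {W} → IsReducedWord n u W → Reduced n (line u) W
reduced⇒ {n} {u} {W} (r , l , e) = r , trans l (inv-line u) , applyUpTo-cong n λ m m<n → begin
  act W m                          ≡⟨ cong (act W) (toℕ-fromℕ< m<n) ⟨
  act W (toℕ (fromℕ< m<n))         ≡⟨ toℕ-wordFun W (fromℕ< m<n) r ⟨
  toℕ (wordFun W (fromℕ< m<n))     ≡⟨ cong toℕ (e (fromℕ< m<n)) ⟩
  toℕ (u (fromℕ< m<n))             ≡⟨ val-toℕ u (fromℕ< m<n) ⟨
  val u (toℕ (fromℕ< m<n))         ≡⟨ cong (val u) (toℕ-fromℕ< m<n) ⟩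
  val u m                          ∎
  where open ≡-Reasoning

reduced⇐ : ∀ {n} {u : Fin n → Fin n} {W} → Reduced n (line u) W → IsReducedWord n u W
reduced⇐ {n} {u} {W} (r , l , e) = r , trans l (sym (inv-line u)) , λ k → toℕ-injective
  (trans (toℕ-wordFun W k r) (trans (applyUpTo-inj n e (toℕ k) (toℕ<n k)) (val-toℕ u k)))

reduced-≋ : ∀ {n V W W′} → Reduced n V W → All (InRange n) W′ → W ≋ W′ → length W′ ≡ length W → Reduced n V W′
reduced-≋ {n} (_ , l , e) r′ p q = r′ , trans q l , trans (applyUpTo-cong n (λ m _ → sym (p at m))) e

reduced-shortest : ∀ {n V W W′} → Reduced n V W → All (InRange n) W′ → W ≋ W′ → length W ≤ length W′
reduced-shortest {n} {V} {W} {W′} (_ , l , e) r′ p = begin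
  length W                        ≡⟨ l ⟩
  invL V                          ≡⟨ cong invL e ⟨
  invL (applyUpTo (act W) n)      ≡⟨ cong invL (applyUpTo-cong n (λ m _ → p at m)) ⟩
  invL (applyUpTo (act W′) n)     ≤⟨ invL-word W′ r′ ⟩
  length W′                       ∎
  where open ≤-Reasoning

-- The pairing of two neighbouring blocks

Desc : List ℕ → Set
Desc = AllPairs _>_

desc-last : ∀ {x xs} → Desc (x ∷ xs) → All (_≤ x) (x ∷ xs)
desc-last (p ∷ _) = ≤-refl ∷ All.map <⇒≤ p

-- The empty list is set apart because it says nothing about how a compares with b.
desc-length : ∀ {a b xs} → Desc xs → All (a ≤_) xs → All (_< b) xs → length xs + a ≤ b ⊎ xs ≡ []
desc-length [] [] [] = inj₂ refl
desc-length {a} {b} {x ∷ xs} (p ∷ d) (a≤x ∷ l) (x<b ∷ _) with desc-length d l p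
... | inj₁ q    = inj₁ (≤-trans (s≤s q) x<b)
... | inj₂ refl = inj₁ (≤-trans (s≤s a≤x) x<b)

desc-full : ∀ {a} t {xs} → Desc xs → All (a ≤_) xs → All (_< a + t) xs → t ≤ length xs → xs ≡ down a t
desc-full zero    [] _ _ _ = refl
desc-full {a} zero (_ ∷ _) (a≤x ∷ _) (x<a ∷ _) _ rewrite +-identityʳ a = ⊥-elim (<-irrefl refl (≤-<-trans a≤x x<a))
desc-full {a} (suc t) {x ∷ xs} (p ∷ d) (a≤x ∷ l) (x<b ∷ _) (s≤s len) = cong₂ _∷_ x≡ xs≡
  where
  x≤ : x ≤ a + t
  x≤ = s≤s⁻¹ (subst (suc x ≤_) (+-suc a t) x<b)
  xs≡ : xs ≡ down a t
  xs≡ = desc-full t d l (All.map (λ q → <-≤-trans q x≤) p) len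
  a+t≤x : ∀ {ys} → t ≤ length ys → length ys + a ≤ x ⊎ ys ≡ [] → a + t ≤ x
  a+t≤x {ys} len (inj₁ q) = ≤-trans (subst (_≤ length ys + a) (+-comm t a) (+-monoˡ-≤ a len)) q
  a+t≤x z≤n (inj₂ refl)   = subst (_≤ x) (sym (+-identityʳ a)) a≤x
  x≡ : x ≡ a + t
  x≡ = ≤-antisym x≤ (a+t≤x len (desc-length d l p))

elem-true : ∀ x R → elem x R ≡ true → x ∈ R
elem-true x (y ∷ R) e with x ≟ y
... | yes p = here p
... | no ¬p rewrite dec-false (x ≟ y) ¬p = there (elem-true x R e)

elem-false : ∀ x R → elem x R ≡ false → x ∉ R
elem-false x (.x ∷ R) e (here refl) with () ← trans (sym e) (cong (λ b → if b then true else elem x R) (dec-true (x ≟ x) refl))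
elem-false x (y ∷ R) e (there q) with does (x ≟ y)
... | false = elem-false x R e q

-- The last alternative is exhausted fuel. It is excluded in `fPair-just`, since R would contain
-- more letters than its length allows.
shiftS-spec : ∀ a R fuel t → let s = shiftS a R fuel t in
  t ≤ s × (∀ j → t ≤ j → j < s → a + j + 1 ∈ R) × (a + s + 1 ∉ R ⊎ s ≡ t + fuel)
shiftS-spec a R zero    t = ≤-refl , (λ j p q → ⊥-elim (<-irrefl refl (≤-<-trans p q))) , inj₂ (sym (+-identityʳ t))
shiftS-spec a R (suc f) t with elem (a + t + 1) R in eq
... | false = ≤-refl , (λ j p q → ⊥-elim (<-irrefl refl (≤-<-trans p q))) , inj₁ (elem-false (a + t + 1) R eq)
... | true with p , q , r ← shiftS-spec a R f (suc t) = <⇒≤ p , run , subst (λ z → a + shiftS a R f (suc t) + 1 ∉ R ⊎ shiftS a R f (suc t) ≡ z) (sym (+-suc t f)) r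
  where
  run : ∀ j → t ≤ j → j < shiftS a R f (suc t) → a + j + 1 ∈ R
  run j t≤j j<s with t ≟ j
  ... | yes refl = elem-true (a + t + 1) R eq
  ... | no t≢j   = q j (≤∧≢⇒< t≤j t≢j) j<s

maxOf-nothing : ∀ xs → maxOf xs ≡ nothing → xs ≡ []
maxOf-nothing []       e = refl
maxOf-nothing (x ∷ xs) e with maxOf xs
maxOf-nothing (x ∷ xs) () | nothing
maxOf-nothing (x ∷ xs) () | just _

maxOf-just : ∀ xs {m} → maxOf xs ≡ just m → m ∈ xs × All (_≤ m) xs
maxOf-just (x ∷ xs) e with maxOf xs in eq
maxOf-just (x ∷ xs) refl | nothing with refl ← maxOf-nothing xs eq = here refl , ≤-refl ∷ []
maxOf-just (x ∷ xs) refl | just m with p , q ← maxOf-just xs eq | ≤-total x m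
... | inj₁ x≤m rewrite m≤n⇒m⊔n≡n x≤m = there p , x≤m ∷ q
... | inj₂ m≤x rewrite m≥n⇒m⊔n≡m m≤x = here refl , ≤-refl ∷ All.map (λ z → ≤-trans z m≤x) q

data MinAbove (b : ℕ) (R : List ℕ) : Maybe ℕ → Set where
  none  : All (_≤ b) R → MinAbove b R nothing
  least : ∀ {c} → c ∈ R → b < c → All (λ x → b < x → c ≤ x) R → MinAbove b R (just c)

minAbove-spec : ∀ b R → MinAbove b R (minAbove b R)
minAbove-spec b []       = none []
minAbove-spec b (a ∷ as) with minAbove b as | minAbove-spec b as | b <? a
... | nothing | none p      | no b≮a  = none (≮⇒≥ b≮a ∷ p)
... | just m  | least q r s | no b≮a  = least (there q) r ((λ b<a → ⊥-elim (b≮a b<a)) ∷ s)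
... | nothing | none p      | yes b<a = least (here refl) b<a ((λ _ → ≤-refl) ∷ All.map (λ x≤b b<x → ⊥-elim (<⇒≱ b<x x≤b)) p)
... | just m  | least q r s | yes b<a with a <? m
...   | yes a<m rewrite dec-true (a <? m) a<m =
        least (here refl) b<a ((λ _ → ≤-refl) ∷ All.map (λ h b<x → ≤-trans (<⇒≤ a<m) (h b<x)) s)
...   | no a≮m rewrite dec-false (a <? m) a≮m =
        least (there q) r ((λ _ → ≮⇒≥ a≮m) ∷ s)

-- Lets `unpaired` be evaluated from any proof of the specification, without recomputing `minAbove`.
minAbove-unique : ∀ {b R m m′} → MinAbove b R m → MinAbove b R m′ → m ≡ m′
minAbove-unique (none _) (none _) = refl
minAbove-unique (none p) (least q r _) = ⊥-elim (<⇒≱ r (All.lookup p q))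
minAbove-unique (least q r _) (none p) = ⊥-elim (<⇒≱ r (All.lookup p q))
minAbove-unique (least q r s) (least q′ r′ s′) = cong just (≤-antisym (All.lookup s q′ r′) (All.lookup s′ q r))

removeOne-here : ∀ x ys → removeOne x (x ∷ ys) ≡ ys
removeOne-here x ys rewrite dec-true (x ≟ x) refl = refl

removeOne-there : ∀ {x y} ys → x ≢ y → removeOne x (y ∷ ys) ≡ y ∷ removeOne x ys
removeOne-there {x} {y} ys x≢y rewrite dec-false (x ≟ y) x≢y = refl

removeOne-All : ∀ {P : Pred ℕ 0ℓ} x {ys} → All P ys → All P (removeOne x ys)
removeOne-All x []       = []
removeOne-All x {y ∷ _} (p ∷ ps) with does (x ≟ y)
... | true  = ps
... | false = p ∷ removeOne-All x ps

removeOne-Desc : ∀ x {ys} → Desc ys → Desc (removeOne x ys)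
removeOne-Desc x []       = []
removeOne-Desc x {y ∷ _} (p ∷ ps) with does (x ≟ y)
... | true  = ps
... | false = removeOne-All x p ∷ removeOne-Desc x ps

removeOne-∈ : ∀ {x y ys} → y ∈ ys → x ≢ y → y ∈ removeOne x ys
removeOne-∈ {x} {y} {z ∷ zs} (here refl) x≢y rewrite dec-false (x ≟ y) x≢y = here refl
removeOne-∈ {x} {y} {z ∷ zs} (there q)   x≢y with does (x ≟ z)
... | true  = q
... | false = there (removeOne-∈ q x≢y)

removeOne-++ˡ : ∀ {x xs} ys → x ∈ xs → removeOne x (xs ++ ys) ≡ removeOne x xs ++ ys
removeOne-++ˡ {x} ys (here refl) rewrite dec-true (x ≟ x) refl = refl
removeOne-++ˡ {x} {z ∷ xs} ys (there q) with does (x ≟ z)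
... | true  = refl
... | false = cong (z ∷_) (removeOne-++ˡ ys q)

removeOne-++ʳ : ∀ {x} xs ys → x ∉ xs → removeOne x (xs ++ ys) ≡ xs ++ removeOne x ys
removeOne-++ʳ []       ys x∉ = refl
removeOne-++ʳ (z ∷ xs) ys x∉ = trans (removeOne-there (xs ++ ys) (x∉ ∘ here)) (cong (z ∷_) (removeOne-++ʳ xs ys (x∉ ∘ there)))

hit : ∀ {P : Pred ℕ 0ℓ} → Decidable P → ℕ → ℕ
hit P? x = if does (P? x) then 1 else 0

hit-yes : ∀ {P : Pred ℕ 0ℓ} (P? : Decidable P) {x} → P x → hit P? x ≡ 1
hit-yes P? {x} p = cong (if_then 1 else 0) (dec-true (P? x) p)

hit-no : ∀ {P : Pred ℕ 0ℓ} (P? : Decidable P) {x} → ¬ P x → hit P? x ≡ 0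
hit-no P? {x} p = cong (if_then 1 else 0) (dec-false (P? x) p)

length-filter-∷ : ∀ {P : Pred ℕ 0ℓ} (P? : Decidable P) x xs → length (filter P? (x ∷ xs)) ≡ hit P? x + length (filter P? xs)
length-filter-∷ P? x xs with does (P? x)
... | true  = refl
... | false = refl

length-filter-removeOne : ∀ {P : Pred ℕ 0ℓ} (P? : Decidable P) {x xs} → x ∈ xs →
  length (filter P? xs) ≡ hit P? x + length (filter P? (removeOne x xs))
length-filter-removeOne P? {x} (here {xs = xs} refl) rewrite dec-true (x ≟ x) refl = length-filter-∷ P? x xs
length-filter-removeOne P? {x} {z ∷ xs} (there q) with x ≟ z
... | yes refl rewrite dec-true (x ≟ x) refl = length-filter-∷ P? x xs
... | no x≢z rewrite dec-false (x ≟ z) x≢z | length-filter-∷ P? z xs | length-filter-∷ P? z (removeOne x xs)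
                   | length-filter-removeOne P? q =
      trans (sym (+-assoc (hit P? z) (hit P? x) _)) (trans (cong (_+ length (filter P? (removeOne x xs))) (+-comm (hit P? z) (hit P? x))) (+-assoc (hit P? x) (hit P? z) _))

length-filter-insertDec : ∀ {P : Pred ℕ 0ℓ} (P? : Decidable P) x xs →
  length (filter P? (insertDec x xs)) ≡ hit P? x + length (filter P? xs)
length-filter-insertDec P? x [] = length-filter-∷ P? x []
length-filter-insertDec P? x (y ∷ xs) with does (y <? x)
... | true  = length-filter-∷ P? x (y ∷ xs)
... | false rewrite length-filter-∷ P? y (insertDec x xs) | length-filter-∷ P? y xs | length-filter-insertDec P? x xs =
      trans (sym (+-assoc (hit P? y) (hit P? x) _)) (trans (cong (_+ length (filter P? xs)) (+-comm (hit P? y) (hit P? x))) (+-assoc (hit P? x) (hit P? y) _))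

insertDec-++ʳ : ∀ {x} xs ys → All (x <_) xs → insertDec x (xs ++ ys) ≡ xs ++ insertDec x ys
insertDec-++ʳ []       ys []       = refl
insertDec-++ʳ {x} (z ∷ xs) ys (p ∷ ps) rewrite dec-false (z <? x) (<-asym p) = cong (z ∷_) (insertDec-++ʳ xs ys ps)

insertDec-top : ∀ {x} ys → All (_< x) ys → insertDec x ys ≡ x ∷ ys
insertDec-top []       []      = refl
insertDec-top {x} (y ∷ ys) (p ∷ _) rewrite dec-true (y <? x) p = refl

insertDec-++ˡ : ∀ {x} xs ys → All (_< x) ys → insertDec x (xs ++ ys) ≡ insertDec x xs ++ ys
insertDec-++ˡ []       ys p = insertDec-top ys p
insertDec-++ˡ {x} (z ∷ xs) ys p with does (z <? x)
... | true  = refl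
... | false = cong (z ∷_) (insertDec-++ˡ xs ys p)

insertDec-All : ∀ {P : Pred ℕ 0ℓ} {x xs} → P x → All P xs → All P (insertDec x xs)
insertDec-All px [] = px ∷ []
insertDec-All {x = x} {y ∷ xs} px (p ∷ ps) with does (y <? x)
... | true  = px ∷ p ∷ ps
... | false = p ∷ insertDec-All px ps

∈-insertDec : ∀ x {y} xs → y ∈ x ∷ xs → y ∈ insertDec x xs
∈-insertDec x [] q = q
∈-insertDec x (z ∷ xs) q with does (z <? x)
... | true = q
∈-insertDec x (z ∷ xs) (here p)         | false = there (∈-insertDec x xs (here p))
∈-insertDec x (z ∷ xs) (there (here p)) | false = here p
∈-insertDec x (z ∷ xs) (there (there q)) | false = there (∈-insertDec x xs (there q))

length-filter-pointwise : ∀ {P Q : Pred ℕ 0ℓ} (P? : Decidable P) (Q? : Decidable Q) {xs ys} →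
  Pointwise (λ x y → P x → Q y) xs ys → length (filter P? xs) ≤ length (filter Q? ys)
length-filter-pointwise P? Q? [] = z≤n
length-filter-pointwise P? Q? {x ∷ xs} {y ∷ ys} (p ∷ ps)
  rewrite length-filter-∷ P? x xs | length-filter-∷ Q? y ys = +-mono-≤ one (length-filter-pointwise P? Q? ps)
  where
  one : hit P? x ≤ hit Q? y
  one with P? x
  ... | no _   = z≤n
  ... | yes px = ≤-reflexive (sym (hit-yes Q? (p px)))

unpaired-step : ∀ {b c L R} → MinAbove b R (just c) → unpaired (b ∷ L) R ≡ unpaired L (removeOne c R)
unpaired-step {b} {c} {L} {R} m rewrite minAbove-unique (minAbove-spec b R) m = refl

unpaired-skip : ∀ {b L R} → MinAbove b R nothing → unpaired (b ∷ L) R ≡ unpaired L R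
unpaired-skip {b} {L} {R} m rewrite minAbove-unique (minAbove-spec b R) m = refl

unpaired-++ : ∀ L M R → unpaired (L ++ M) R ≡ unpaired M (unpaired L R)
unpaired-++ []      M R = refl
unpaired-++ (b ∷ L) M R with minAbove b R
... | nothing = unpaired-++ L M R
... | just c  = unpaired-++ L M (removeOne c R)

unpaired-All : ∀ {P : Pred ℕ 0ℓ} L {R} → All P R → All P (unpaired L R)
unpaired-All []      p = p
unpaired-All (b ∷ L) {R} p with minAbove b R
... | nothing = unpaired-All L p
... | just c  = unpaired-All L (removeOne-All c p)

unpaired-⊆ : ∀ L R {x} → x ∈ unpaired L R → x ∈ R
unpaired-⊆ L R q = All.lookup (unpaired-All {_∈ R} L (All.tabulate id)) q

unpaired-stays : ∀ {x L R} → All (x ≤_) L → x ∈ R → x ∈ unpaired L R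
unpaired-stays [] q = q
unpaired-stays {x} {b ∷ L} {R} (p ∷ ps) q with minAbove b R | minAbove-spec b R
... | nothing | _           = unpaired-stays ps q
... | just c  | least _ r _ = unpaired-stays ps (removeOne-∈ q λ c≡x → <⇒≱ r (subst (_≤ b) (sym c≡x) p))

-- A partner lies above its letter, so letters that are at least a ignore whatever the right block
-- has below a.
unpaired-high : ∀ {a L R S} → All (a ≤_) L → All (_< a) S → unpaired L (R ++ S) ≡ unpaired L R ++ S
unpaired-high [] _ = refl
unpaired-high {a} {b ∷ L} {R} {S} (p ∷ ps) low with minAbove b R | minAbove-spec b R
... | nothing | none h = trans
      (unpaired-skip (none (All.++⁺ h (All.map (λ z → ≤-trans (<⇒≤ z) p) low))))
      (unpaired-high ps low)
... | just c | least q r h = trans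
      (unpaired-step (least (∈-++⁺ˡ q) r (All.++⁺ h (All.map (λ z b<x → ⊥-elim (<⇒≱ b<x (≤-trans (<⇒≤ z) p))) low))))
      (trans (cong (unpaired L) (removeOne-++ˡ S q)) (unpaired-high ps low))

-- Up to the place of x each b now faces the preceding entry of the decreasing list, which is even
-- larger; beyond x nothing changes.
pointwise-removeOne : ∀ {bs c cs x} → Pointwise _<_ bs cs → Desc (c ∷ cs) → x ∈ cs → Pointwise _<_ bs (c ∷ removeOne x cs)
pointwise-removeOne {cs = d ∷ cs} {x} (p ∷ pw) ((d<c ∷ _) ∷ desc) q with x ≟ d
... | yes refl rewrite dec-true (d ≟ d) refl = <-trans p d<c ∷ pw
pointwise-removeOne (p ∷ pw) _ (here e) | no x≢d = ⊥-elim (x≢d e)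
pointwise-removeOne {cs = d ∷ cs} {x} (p ∷ pw) ((d<c ∷ _) ∷ desc) (there q) | no x≢d
  rewrite dec-false (x ≟ d) x≢d = <-trans p d<c ∷ pointwise-removeOne pw desc q

-- Whichever partner the first letter takes, the remaining letters still have larger counterparts.
pointwise-tail : ∀ {b bs c cs x} → Pointwise _<_ (b ∷ bs) (c ∷ cs) → Desc (c ∷ cs) → x ∈ c ∷ cs →
                 Pointwise _<_ bs (removeOne x (c ∷ cs))
pointwise-tail {c = c} {cs} {x} (p ∷ pw) desc q with x ≟ c
... | yes refl rewrite dec-true (c ≟ c) refl = pw
pointwise-tail (p ∷ pw) desc (here e) | no x≢c = ⊥-elim (x≢c e)
pointwise-tail {c = c} {cs} {x} (p ∷ pw) desc (there q) | no x≢c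
  rewrite dec-false (x ≟ c) x≢c = pointwise-removeOne pw desc q

-- Two columns (listed from the bottom up, i.e. decreasingly) that may stand next to each other in a
-- column-strict tableau; they are aligned at their smallest entries.
data Adjacent : List ℕ → List ℕ → Set where
  level : ∀ {B C} → Pointwise _<_ B C → Adjacent B C
  taller : ∀ {x B C} → Adjacent B C → Adjacent (x ∷ B) C

adjacent-removeOne : ∀ {B C x} → Adjacent B C → Desc C → x ∈ C → Adjacent B (removeOne x C)
adjacent-removeOne (level pw@(_ ∷ _)) desc q = taller (level (pointwise-tail pw desc q))
adjacent-removeOne (taller a) desc q = taller (adjacent-removeOne a desc q)

adjacent-∷ : ∀ {x B C a} → Adjacent B C → All (_< a) (x ∷ B) → Adjacent (x ∷ B) (a ∷ C)
adjacent-∷ (level pw) (p ∷ _)  = level (p ∷ pw)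
adjacent-∷ (taller a) (_ ∷ ps) = taller (adjacent-∷ a ps)

-- An overhanging entry of B may take a partner too, but this only shortens C and leaves it adjacent
-- to the rest of B. In the level part every entry finds a partner, which uses up C.
adjacent-paired : ∀ {B C} → Adjacent B C → Desc C → unpaired B C ≡ []
adjacent-paired (level []) _ = refl
adjacent-paired {b ∷ bs} {c ∷ cs} (level pw@(p ∷ _)) desc with minAbove b (c ∷ cs) | minAbove-spec b (c ∷ cs)
... | nothing | none (h ∷ _)  = ⊥-elim (<⇒≱ p h)
... | just x  | least q r _   = adjacent-paired (level (pointwise-tail pw desc q)) (removeOne-Desc x desc)
adjacent-paired {b ∷ bs} {C} (taller a) desc with minAbove b C | minAbove-spec b C
... | nothing | _           = adjacent-paired a desc
... | just x  | least q _ _ = adjacent-paired (adjacent-removeOne a desc q) (removeOne-Desc x desc)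

-- Each entry of B has a larger counterpart in C, below a, and therefore never reaches for R. As B
-- and C are equally long, C is used up.
unpaired-low : ∀ {a R B C} → All (a ≤_) R → All (_< a) C → Pointwise _<_ B C → Desc C → unpaired B (R ++ C) ≡ R
unpaired-low {R = R} _ _ [] _ = ++-identityʳ R
unpaired-low {a} {R} {b ∷ bs} {c ∷ cs} high low pw@(p ∷ _) desc with minAbove b (R ++ c ∷ cs) | minAbove-spec b (R ++ c ∷ cs)
... | nothing | none h = ⊥-elim (<⇒≱ p (All.head (All.++⁻ʳ R h)))
... | just x | least q r h with ∈-++⁻ R q
...   | inj₁ x∈R = ⊥-elim (<⇒≱ (All.head low) (≤-trans (All.lookup high x∈R) (All.head (All.++⁻ʳ R h) p)))
...   | inj₂ x∈C = trans (cong (unpaired bs) (removeOne-++ʳ R (c ∷ cs) λ x∈R → <⇒≱ (All.lookup low x∈C) (All.lookup high x∈R)))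
      (unpaired-low high (removeOne-All x low) (pointwise-tail pw desc x∈C) (removeOne-Desc x desc))

-- The fixed columns B and C pair off among themselves, so the crystal operator sees only the free
-- letters.
unpaired-split : ∀ {a L R B C} → All (a ≤_) L → All (a ≤_) R → All (_< a) C → Pointwise _<_ B C → Desc C →
                 unpaired (L ++ B) (R ++ C) ≡ unpaired L R
unpaired-split {L = L} {R} {B} {C} hL hR low pw desc = trans (unpaired-++ L B (R ++ C))
  (trans (cong (unpaired B) (unpaired-high hL low)) (unpaired-low (unpaired-All L hR) low pw desc))

openClosed? : ∀ a y → Decidable (λ x → a < x × x ≤ y)
openClosed? a y x = (a <? x) ×-dec (x ≤? y)

closedOpen? : ∀ a y → Decidable (λ x → a ≤ x × x < y)
closedOpen? a y x = (a ≤? x) ×-dec (x <? y)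

-- Letters above the unpaired a have partners ≥ a, since a partner b < a would have preferred a.
unpaired-count : ∀ {a} L R → a ∈ unpaired L R → All (_≤ a) (unpaired L R) → ∀ y →
                 length (filter (openClosed? a y) R) ≤ length (filter (closedOpen? a y) L)
unpaired-count {a} [] R a∈ max y = ≤-reflexive (cong length (filter-none (openClosed? a y) (All.map (λ x≤a (a<x , _) → <⇒≱ a<x x≤a) max)))
unpaired-count {a} (b ∷ L) R a∈ max y with minAbove b R | minAbove-spec b R
... | nothing | _ = ≤-trans (unpaired-count L R a∈ max y)
      (≤-trans (m≤n+m _ (hit (closedOpen? a y) b)) (≤-reflexive (sym (length-filter-∷ (closedOpen? a y) b L))))
... | just c | least q b<c h
      rewrite length-filter-removeOne (openClosed? a y) q | length-filter-∷ (closedOpen? a y) b L =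
      +-mono-≤ one (unpaired-count L (removeOne c R) a∈ max y)
  where
  a∈R : a ∈ R
  a∈R = All.lookup (removeOne-All {_∈ R} c (All.tabulate id)) (unpaired-⊆ L (removeOne c R) a∈)
  one : hit (openClosed? a y) c ≤ hit (closedOpen? a y) b
  one with openClosed? a y c
  ... | no ¬p = subst (_≤ hit (closedOpen? a y) b) (sym (hit-no (openClosed? a y) ¬p)) z≤n
  ... | yes (a<c , c≤y) = ≤-reflexive (trans (hit-yes (openClosed? a y) (a<c , c≤y)) (sym (hit-yes (closedOpen? a y) (a≤b , <-≤-trans b<c c≤y))))
    where
    a≤b : a ≤ b
    a≤b = ≮⇒≥ λ b<a → <⇒≱ a<c (All.lookup h a∈R b<a)

removeOne-∉ : ∀ {x ys} → Desc ys → x ∉ removeOne x ys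
removeOne-∉ {x} {y ∷ ys} (p ∷ d) q with x ≟ y
... | yes refl rewrite dec-true (y ≟ y) refl = <-irrefl refl (All.lookup p q)
... | no x≢y rewrite dec-false (x ≟ y) x≢y with q
...   | here e   = x≢y e
...   | there q′ = removeOne-∉ d q′

removeOne-⊆ : ∀ x {y} ys → y ∈ removeOne x ys → y ∈ ys
removeOne-⊆ x ys = All.lookup (removeOne-All {_∈ ys} x (All.tabulate id))

-- The predecessor of an unpaired letter would have been paired with it.
unpaired-pred : ∀ {a} L R → Desc R → suc a ∈ unpaired L R → a ∉ L
unpaired-pred {a} (b ∷ L) R desc a∈ (here refl) with minAbove b R | minAbove-spec b R
... | nothing | none h = <⇒≱ ≤-refl (All.lookup h (unpaired-⊆ L R a∈))
... | just c | least q b<c h with in-R ← unpaired-⊆ L (removeOne c R) a∈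
      with refl ← ≤-antisym (All.lookup h (removeOne-⊆ c R in-R) ≤-refl) b<c = removeOne-∉ desc in-R
unpaired-pred {a} (b ∷ L) R desc a∈ (there q) with minAbove b R
... | nothing = unpaired-pred L R desc a∈ q
... | just c  = unpaired-pred L (removeOne c R) (removeOne-Desc c desc) a∈ q

length-removeOne : ∀ {x ys} → x ∈ ys → length ys ≡ suc (length (removeOne x ys))
length-removeOne {x} (here {xs = ys} refl) = cong suc (sym (cong length (removeOne-here x ys)))
length-removeOne {x} {y ∷ ys} (there q) with does (x ≟ y)
... | true  = refl
... | false = cong suc (length-removeOne q)

run-length : ∀ {b} s xs → (∀ j → j < s → b + j ∈ xs) → s ≤ length xs
run-length zero    xs run = z≤n
run-length {b} (suc s) xs run = subst (suc s ≤_) (sym (length-removeOne (run s ≤-refl)))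
  (s≤s (run-length s (removeOne (b + s) xs) λ j j<s → removeOne-∈ (run j (m≤n⇒m≤1+n j<s)) λ e → <-irrefl (sym (+-cancelˡ-≡ b s j e)) j<s))

down-∈ : ∀ a s {j} → j < s → a + j ∈ down a s
down-∈ a (suc s) {j} (s≤s j≤s) with m≤n⇒m<n∨m≡n j≤s
... | inj₁ j<s  = there (down-∈ a s j<s)
... | inj₂ refl = here refl

-- The fuel-free content of `fPair`: a is the letter taken out, and the run a, ..., a+s of R is as
-- long as possible.
record Move (L R L′ R′ : List ℕ) : Set where
  field
    a s    : ℕ
    unp    : a ∈ unpaired L R
    max    : All (_≤ a) (unpaired L R)
    L≡     : L′ ≡ insertDec (a + s) L
    R≡     : R′ ≡ removeOne a R
    runR   : ∀ j → j ≤ s → a + j ∈ R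
    stop   : suc (a + s) ∉ R

fPair-just : ∀ L R {L′ R′} → fPair L R ≡ just (L′ , R′) → Move L R L′ R′
fPair-just L R e with maxOf (unpaired L R) in eq
fPair-just L R refl | just a with unp , max ← maxOf-just (unpaired L R) eq
      with _ , run , end ← shiftS-spec a R (suc (length R)) 0 = record
  { a = a ; s = s ; unp = unp ; max = max ; L≡ = refl ; R≡ = refl ; runR = runR
  ; stop = λ q → stop′ end (subst (_∈ R) (+-comm 1 (a + s)) q) }
  where
  s : ℕ
  s = shiftS a R (suc (length R)) 0
  runR : ∀ j → j ≤ s → a + j ∈ R
  runR zero    _   = subst (_∈ R) (sym (+-identityʳ a)) (unpaired-⊆ L R unp)
  runR (suc j) j<s = subst (_∈ R) (trans (+-assoc a j 1) (cong (a +_) (+-comm j 1))) (run j z≤n j<s)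
  stop′ : a + s + 1 ∉ R ⊎ s ≡ suc (length R) → a + s + 1 ∉ R
  stop′ (inj₁ p) = p
  stop′ (inj₂ p) = ⊥-elim (1+n≰n (≤-trans (≤-reflexive (sym p)) (≤-trans (n≤1+n s) (run-length (suc s) R (λ j j<s → runR j (s≤s⁻¹ j<s))))))

fPair-nothing : ∀ L R → fPair L R ≡ nothing → unpaired L R ≡ []
fPair-nothing L R e with maxOf (unpaired L R) in eq
... | nothing = maxOf-nothing (unpaired L R) eq

fPair-[] : ∀ L R → unpaired L R ≡ [] → fPair L R ≡ nothing
fPair-[] L R e rewrite e = refl

module _ {L R L′ R′} (descL : Desc L) (mv : Move L R L′ R′) where
  open Move mv

  -- As a is the largest unpaired letter, the s letters of R in (a, a+s] need s letters of L in [a,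
  -- a+s), and these fill that interval.
  runL : ∀ j → j < s → a + j ∈ L
  runL j j<s = proj₁ (∈-filter⁻ (closedOpen? a (a + s)) (subst (a + j ∈_) (sym full) (down-∈ a s j<s)))
    where
    F : List ℕ
    F = filter (closedOpen? a (a + s)) L
    inF : All (λ x → a ≤ x × x < a + s) F
    inF = All.all-filter (closedOpen? a (a + s)) L
    many : s ≤ length F
    many = ≤-trans
      (run-length {suc a} s _ λ j j<s → ∈-filter⁺ (openClosed? a (a + s)) (subst (_∈ R) (+-suc a j) (runR (suc j) j<s))
        (s≤s (m≤m+n a j) , subst (_≤ a + s) (+-suc a j) (+-monoʳ-≤ a j<s)))
      (unpaired-count L R unp max (a + s))
    full : F ≡ down a s
    full = desc-full s (AllPairs.filter⁺ (closedOpen? a (a + s)) descL) (All.map proj₁ inF) (All.map proj₂ inF) many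

  -- If a < b, then by unpaired-count B would have more letters in [a, b) than C has in (a, b).
  move-back : ∀ {b L₀ R₀ B C} → L′ ≡ L₀ ++ B → R′ ≡ R₀ ++ C → All (b ≤_) L₀ → All (b ≤_) R₀ →
              All (_< b) C → Pointwise _<_ B C → b ≤ a
  move-back {zero} _ _ _ _ _ _ = z≤n
  move-back {b@(suc y)} {L₀} {R₀} {B} {C} refl refl hL hR lowC pw = ≮⇒≥ impossible
    where
    drop-high : ∀ {P : Pred ℕ 0ℓ} (P? : Decidable P) → (∀ {x} → P x → x < b) → ∀ {xs} ys → All (b ≤_) xs →
                length (filter P? (xs ++ ys)) ≡ length (filter P? ys)
    drop-high P? lt {xs} ys high = cong length (trans (filter-++ P? xs ys)
      (cong (_++ filter P? ys) (filter-none P? (All.map (λ b≤x px → <⇒≱ (lt px) b≤x) high))))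
    impossible : ¬ a < b
    impossible a<b with a + s <? b
    ... | yes q = <-irrefl refl (begin-strict
      length (filter (closedOpen? a y) L)               ≤⟨ length-filter-pointwise (closedOpen? a y) (closedOpen? a b) {L} {L} (Pointwise.refl λ (p , r) → p , m≤n⇒m≤1+n r) ⟩
      length (filter (closedOpen? a b) L)               <⟨ ≤-refl ⟩
      suc (length (filter (closedOpen? a b) L))         ≡⟨ cong (_+ length (filter (closedOpen? a b) L)) (hit-yes (closedOpen? a b) (m≤m+n a s , q)) ⟨
      hit (closedOpen? a b) (a + s) + length (filter (closedOpen? a b) L) ≡⟨ length-filter-insertDec (closedOpen? a b) (a + s) L ⟨
      length (filter (closedOpen? a b) (insertDec (a + s) L)) ≡⟨ cong (length ∘ filter (closedOpen? a b)) L≡ ⟨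
      length (filter (closedOpen? a b) (L₀ ++ B))       ≡⟨ drop-high (closedOpen? a b) proj₂ B hL ⟩
      length (filter (closedOpen? a b) B)               ≤⟨ length-filter-pointwise (closedOpen? a b) (openClosed? a y) (bounded lowC pw) ⟩
      length (filter (openClosed? a y) C)            ≡⟨ drop-high (openClosed? a y) (s≤s ∘ proj₂) C hR ⟨
      length (filter (openClosed? a y) (R₀ ++ C))    ≡⟨ cong (length ∘ filter (openClosed? a y)) R≡ ⟩
      length (filter (openClosed? a y) (removeOne a R)) ≡⟨ cong (_+ length (filter (openClosed? a y) (removeOne a R))) (hit-no (openClosed? a y) (<-irrefl refl ∘ proj₁)) ⟨
      hit (openClosed? a y) a + length (filter (openClosed? a y) (removeOne a R)) ≡⟨ length-filter-removeOne (openClosed? a y) (unpaired-⊆ L R unp) ⟨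
      length (filter (openClosed? a y) R)            ≤⟨ unpaired-count L R unp max y ⟩
      length (filter (closedOpen? a y) L)               ∎)
      where
      open ≤-Reasoning
      bounded : ∀ {B C} → All (_< b) C → Pointwise _<_ B C →
                Pointwise (λ x z → a ≤ x × x < b → a < z × z ≤ y) B C
      bounded [] []             = []
      bounded (l ∷ ls) (p ∷ ps) = (λ (a≤x , _) → ≤-<-trans a≤x p , s≤s⁻¹ l) ∷ bounded ls ps
    -- Here y = b-1 lies in [a, a+s), so it belongs to L by `runL`, survives in L′ and must lie in
    -- B. But an entry of B is below an entry of C, hence below b-1.
    ... | no q with j , a+j≡y ← m≤n⇒∃[o]m+o≡n (s≤s⁻¹ a<b) = below-C (in-B (∈-++⁻ L₀ y∈))
      where
      j<s : j < s
      j<s = +-cancelˡ-< a j s (subst (_< a + s) (sym a+j≡y) (≮⇒≥ q))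
      y∈ : y ∈ L₀ ++ B
      y∈ = subst (y ∈_) (sym L≡) (∈-insertDec (a + s) L (there (subst (_∈ L) a+j≡y (runL j j<s))))
      in-B : y ∈ L₀ ⊎ y ∈ B → y ∈ B
      in-B (inj₁ p) = ⊥-elim (<-irrefl refl (All.lookup hL p))
      in-B (inj₂ p) = p
      below-C : y ∉ B
      below-C p = go pw lowC p
        where
        go : ∀ {B C} → Pointwise _<_ B C → All (_< b) C → y ∉ B
        go (y<c ∷ _) (c<b ∷ _) (here refl) = <⇒≱ y<c (s≤s⁻¹ c<b)
        go (_ ∷ ps) (_ ∷ ls) (there q) = go ps ls q

pointwise-bound : ∀ {b B C} → All (_< b) C → Pointwise _<_ B C → All (_< b) B
pointwise-bound []       []       = []
pointwise-bound (l ∷ ls) (p ∷ ps) = <-trans p l ∷ pointwise-bound ls ps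

-- The effect of a crystal operator on two blocks

insertDec-Desc : ∀ {x xs} → Desc xs → x ∉ xs → Desc (insertDec x xs)
insertDec-Desc [] _ = [] ∷ []
insertDec-Desc {x} {y ∷ ys} (p ∷ d) x∉ with y <? x
... | yes y<x = subst Desc (sym (insertDec-top (y ∷ ys) smaller)) (smaller ∷ p ∷ d)
  where
  smaller : All (_< x) (y ∷ ys)
  smaller = y<x ∷ All.map (λ z<y → <-trans z<y y<x) p
... | no y≮x = subst Desc (sym (insertDec-++ʳ (y ∷ []) ys (x<y ∷ [])))
      (insertDec-All x<y p ∷ insertDec-Desc d (x∉ ∘ there))
  where
  x<y : x < y
  x<y = ≤∧≢⇒< (≮⇒≥ y≮x) (x∉ ∘ here)

length-insertDec : ∀ x xs → length (insertDec x xs) ≡ suc (length xs)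
length-insertDec x []       = refl
length-insertDec x (y ∷ ys) with does (y <? x)
... | true  = refl
... | false = cong suc (length-insertDec x ys)

insertDec-⊆ : ∀ x {y} xs → y ∈ insertDec x xs → y ∈ x ∷ xs
insertDec-⊆ x xs = All.lookup (insertDec-All {_∈ x ∷ xs} (here refl) (All.tabulate there))

Desc-++⁻ʳ : ∀ xs {ys} → Desc (xs ++ ys) → Desc ys
Desc-++⁻ʳ []       d       = d
Desc-++⁻ʳ (x ∷ xs) (_ ∷ d) = Desc-++⁻ʳ xs d

Desc-++⁻ˡ : ∀ xs {ys} → Desc (xs ++ ys) → Desc xs
Desc-++⁻ˡ []       d       = []
Desc-++⁻ˡ (x ∷ xs) (p ∷ d) = All.++⁻ˡ xs p ∷ Desc-++⁻ˡ xs d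

desc-cut : ∀ q {xs} → Desc xs → ∃₂ λ hi lo → xs ≡ hi ++ lo × All (q ≤_) hi × All (_< q) lo
desc-cut q [] = [] , [] , refl , [] , []
desc-cut q {x ∷ xs} (p ∷ d) with q ≤? x
... | no q≰x = [] , x ∷ xs , refl , [] , ≰⇒> q≰x ∷ All.map (λ z<x → <-trans z<x (≰⇒> q≰x)) p
... | yes q≤x with hi , lo , refl , h , l ← desc-cut q d = x ∷ hi , lo , refl , q≤x ∷ h , l

desc-run-top : ∀ {a} s {xs} → Desc xs → All (_< a + s) xs → (∀ j → j < s → a + j ∈ xs) →
               ∃ λ lo → xs ≡ down a s ++ lo × All (_< a) lo
desc-run-top {a} zero {xs} d l run = xs , refl , subst (λ z → All (_< z) xs) (+-identityʳ a) l
desc-run-top {a} (suc s) {[]} d l run with () ← run 0 z<s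
desc-run-top {a} (suc s) {x ∷ xs} (p ∷ d) (l ∷ _) run = proj₁ rest , cong₂ _∷_ x≡ (proj₁ (proj₂ rest)) , proj₂ (proj₂ rest)
  where
  x≡ : x ≡ a + s
  x≡ = ≤-antisym (s≤s⁻¹ (subst (suc x ≤_) (+-suc a s) l)) (All.lookup (desc-last (p ∷ d)) (run s ≤-refl))
  skip : ∀ {j} → j < s → a + j ∈ x ∷ xs → a + j ∈ xs
  skip j<s (here e)  = ⊥-elim (<-irrefl (+-cancelˡ-≡ a _ s (trans e x≡)) j<s)
  skip j<s (there q) = q
  rest : ∃ λ lo → xs ≡ down a s ++ lo × All (_< a) lo
  rest = desc-run-top s d (subst (λ z → All (_< z) xs) x≡ p) (λ j j<s → skip j<s (run j (m≤n⇒m≤1+n j<s)))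

-- The upper part may begin right at a+s. For the left block this is the case in which the inserted
-- letter is already present.
desc-run : ∀ {a} s {xs} → Desc xs → (∀ j → j < s → a + j ∈ xs) →
           ∃₂ λ hi lo → xs ≡ hi ++ down a s ++ lo × All (a + s ≤_) hi × All (_< a) lo
desc-run {a} s {xs} d run = join (desc-cut (a + s) d)
  where
  in-lo : ∀ {hi lo j} → All (a + s ≤_) hi → j < s → a + j ∈ hi ⊎ a + j ∈ lo → a + j ∈ lo
  in-lo h j<s (inj₁ q) = ⊥-elim (<⇒≱ (+-monoʳ-< a j<s) (All.lookup h q))
  in-lo h _   (inj₂ q) = q
  join : (∃₂ λ hi lo → xs ≡ hi ++ lo × All (a + s ≤_) hi × All (_< a + s) lo) →
         ∃₂ λ hi lo → xs ≡ hi ++ down a s ++ lo × All (a + s ≤_) hi × All (_< a) lo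
  join (hi , lo , refl , h , l)
    with lo′ , refl , l′ ← desc-run-top s (Desc-++⁻ʳ hi d) l (λ j j<s → in-lo h j<s (∈-++⁻ hi (run j j<s)))
    = hi , lo′ , refl , h , l′

desc-bottom : ∀ {q xs} → Desc xs → All (q ≤_) xs → All (q <_) xs ⊎ (∃ λ ys → xs ≡ ys ++ q ∷ [])
desc-bottom [] [] = inj₁ []
desc-bottom {q} {x ∷ xs} (p ∷ d) (q≤x ∷ l) with desc-bottom d l
... | inj₂ (ys , refl) = inj₂ (x ∷ ys , refl)
desc-bottom {q} {x ∷ y ∷ xs} ((y<x ∷ _) ∷ d) (q≤x ∷ l) | inj₁ h@(q<y ∷ _) = inj₁ (<-trans q<y y<x ∷ h)
desc-bottom {q} {x ∷ []} (p ∷ d) (q≤x ∷ l) | inj₁ [] with q ≟ x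
... | yes refl = inj₂ ([] , refl)
... | no q≢x   = inj₁ (≤∧≢⇒< q≤x q≢x ∷ [])

desc-above : ∀ {q} xs → Desc (xs ++ q ∷ []) → All (q <_) xs
desc-above []       _       = []
desc-above (x ∷ xs) (p ∷ d) = All.head (All.++⁻ʳ xs p) ∷ desc-above xs d

record Effect (L R L′ R′ : List ℕ) : Set where
  field
    descˡ   : Desc L′
    descʳ   : Desc R′
    same    : L ++ R ≋ L′ ++ R′
    len     : length (L′ ++ R′) ≡ length (L ++ R)
    letters : ∀ {x} → x ∈ L′ ++ R′ → x ∈ L ++ R

-- A certificate that W is not reduced. The letters are tracked so that the shorter word stays in
-- range.
record Shorter (W : List ℕ) : Set where
  field
    word    : List ℕ
    same    : W ≋ word
    fewer   : length word < length W
    letters : ∀ {x} → x ∈ word → x ∈ W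

module _ {L R L′ R′} (descL : Desc L) (descR : Desc R) (posL : All (1 ≤_) L) (posR : All (1 ≤_) R)
         (mv : Move L R L′ R′) where
  open Move mv

  private
    module Core {Lh Ll Rh Rl} (L≡′ : L ≡ Lh ++ down a s ++ Ll) (R≡′ : R ≡ Rh ++ down a (suc s) ++ Rl)
                (Lh≥ : All (a + s ≤_) Lh) (Ll< : All (_< a) Ll) (Rh≥ : All (a + suc s ≤_) Rh) (Rl< : All (_< a) Rl) where

      1≤a : 1 ≤ a
      1≤a = All.lookup posR (unpaired-⊆ L R unp)

      posLl : All (1 ≤_) Ll
      posLl = All.++⁻ʳ (down a s) (All.++⁻ʳ Lh (subst (All (1 ≤_)) L≡′ posL))

      -- The letter a-1 is absent from L, as it would have been paired with a. So these letters
      -- commute with everything from a upwards.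
      Ll-gap : All (λ x → 2 + x ≤ a) Ll
      Ll-gap = All.tabulate gap
        where
        gap : ∀ {x} → x ∈ Ll → 2 + x ≤ a
        gap {x} x∈ = ≤∧≢⇒< (All.lookup Ll< x∈) λ e →
          unpaired-pred L R descR (subst (_∈ unpaired L R) (sym e) unp)
            (subst (x ∈_) (sym L≡′) (∈-++⁺ʳ Lh (∈-++⁺ʳ (down a s) x∈)))

      -- The run in R stops at a+s, so the letters above it commute with everything up to a+s.
      Rh-gap : All (λ x → 2 + (a + s) ≤ x) Rh
      Rh-gap = All.tabulate gap
        where
        gap : ∀ {x} → x ∈ Rh → 2 + (a + s) ≤ x
        gap {x} x∈ = ≤∧≢⇒< (subst (_≤ x) (+-suc a s) (All.lookup Rh≥ x∈)) λ e →
          stop (subst (suc (a + s) ∈_) (sym R≡′) (∈-++⁺ˡ (subst (_∈ Rh) (sym e) x∈)))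

      -- The two gaps allow Rh to pass to the far left and Ll to the right, which brings the runs D
      -- and E together.
      gather : ∀ {D E} → All (λ x → a ≤ x × x ≤ a + s) D → All (a ≤_) E →
               D ++ (Ll ++ (Rh ++ (E ++ Rl))) ≋ Rh ++ ((D ++ E) ++ (Ll ++ Rl))
      gather {D} {E} hD hE = ≋-trans {v = D ++ (Rh ++ (E ++ (Ll ++ Rl)))} (++-congˡ≋ D inner)
        (≋-trans {v = (Rh ++ D) ++ (E ++ (Ll ++ Rl))}
          (≋-trans {v = (D ++ Rh) ++ (E ++ (Ll ++ Rl))} (≡⇒≋ (sym (++-assoc D Rh _)))
            (++-congʳ≋ {D ++ Rh} (E ++ (Ll ++ Rl)) (far-comm-list (All.map (λ (a≤x , x≤) → All.map (λ y≥ → ≤-trans 1≤a a≤x , ≤-trans (s≤s (s≤s x≤)) y≥) Rh-gap) hD))))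
          (≡⇒≋ (trans (++-assoc Rh D _) (cong (Rh ++_) (sym (++-assoc D E _))))))
        where
        inner : Ll ++ (Rh ++ (E ++ Rl)) ≋ Rh ++ (E ++ (Ll ++ Rl))
        inner = ≋-trans {v = (Ll ++ (Rh ++ E)) ++ Rl} (≡⇒≋ (sym (trans (++-assoc Ll (Rh ++ E) Rl) (cong (Ll ++_) (++-assoc Rh E Rl)))))
          (≋-trans {v = ((Rh ++ E) ++ Ll) ++ Rl}
            (++-congʳ≋ {Ll ++ (Rh ++ E)} Rl (far-comm-list (All.zipWith (λ (1≤x , x<) → All.++⁺
              (All.map (λ y≥ → 1≤x , ≤-trans x< (≤-trans (m≤m+n a s) (≤-trans (m≤n+m (a + s) 2) y≥))) Rh-gap)
              (All.map (λ y≥ → 1≤x , ≤-trans x< y≥) hE)) (posLl , Ll-gap))))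
            (≡⇒≋ (trans (++-assoc (Rh ++ E) Ll Rl) (++-assoc Rh E (Ll ++ Rl)))))

      down-range : ∀ t → t ≤ suc s → All (λ x → a ≤ x × x ≤ a + s) (down a t)
      down-range t t≤ = All.zipWith (λ (p , q) → p , s≤s⁻¹ (≤-trans q (subst (a + t ≤_) (+-suc a s) (+-monoʳ-≤ a t≤)))) (down-≥ a t , down-< a t)

      R′≡ : R′ ≡ Rh ++ down (suc a) s ++ Rl
      R′≡ = begin
        R′                                                        ≡⟨ R≡ ⟩
        removeOne a R                                             ≡⟨ cong (removeOne a) R≡′ ⟩
        removeOne a (Rh ++ down a (suc s) ++ Rl)                  ≡⟨ cong (λ z → removeOne a (Rh ++ z ++ Rl)) (down-snoc a s) ⟩
        removeOne a (Rh ++ (down (suc a) s ++ a ∷ []) ++ Rl)      ≡⟨ cong (λ z → removeOne a (Rh ++ z)) (++-assoc (down (suc a) s) (a ∷ []) Rl) ⟩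
        removeOne a (Rh ++ down (suc a) s ++ a ∷ Rl)              ≡⟨ removeOne-++ʳ Rh _ (λ q → <⇒≱ (m≤n⇒m≤1+n (s≤s (m≤m+n a s))) (All.lookup Rh-gap q)) ⟩
        Rh ++ removeOne a (down (suc a) s ++ a ∷ Rl)              ≡⟨ cong (Rh ++_) (removeOne-++ʳ (down (suc a) s) _ (λ q → <-irrefl refl (All.lookup (down-≥ (suc a) s) q))) ⟩
        Rh ++ down (suc a) s ++ removeOne a (a ∷ Rl)              ≡⟨ cong (λ z → Rh ++ down (suc a) s ++ z) (removeOne-here a Rl) ⟩
        Rh ++ down (suc a) s ++ Rl                                ∎
        where open ≡-Reasoning

      regular : All (a + s <_) Lh → Effect L R L′ R′
      regular Lh> = record
        { descˡ = subst Desc (sym L≡) (insertDec-Desc descL q∉L)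
        ; descʳ = subst Desc (sym R≡) (removeOne-Desc a descR)
        ; same = subst₂ _≋_ (sym Weq) (sym W′eq) (++-congˡ≋ Lh middle)
        ; len = trans (length-++ L′) (trans lens (sym (length-++ L)))
        ; letters = λ q → letters′ (∈-++⁻ L′ q)
        }
        where
        q∉L : a + s ∉ L
        q∉L q with ∈-++⁻ Lh (subst (a + s ∈_) L≡′ q)
        ... | inj₁ p = <-irrefl refl (All.lookup Lh> p)
        ... | inj₂ p with ∈-++⁻ (down a s) p
        ...   | inj₁ r = <-irrefl refl (All.lookup (down-< a s) r)
        ...   | inj₂ r = <⇒≱ (All.lookup Ll< r) (m≤m+n a s)
        L′≡ : L′ ≡ Lh ++ down a (suc s) ++ Ll
        L′≡ = begin
          L′                                        ≡⟨ L≡ ⟩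
          insertDec (a + s) L                       ≡⟨ cong (insertDec (a + s)) L≡′ ⟩
          insertDec (a + s) (Lh ++ down a s ++ Ll)  ≡⟨ insertDec-++ʳ Lh _ Lh> ⟩
          Lh ++ insertDec (a + s) (down a s ++ Ll)  ≡⟨ cong (Lh ++_) (insertDec-top _ (All.++⁺ (down-< a s) (All.map (λ x<a → <-≤-trans x<a (m≤m+n a s)) Ll<))) ⟩
          Lh ++ down a (suc s) ++ Ll                ∎
          where open ≡-Reasoning
        assoc : ∀ D E → (Lh ++ D ++ Ll) ++ (Rh ++ E ++ Rl) ≡ Lh ++ (D ++ (Ll ++ (Rh ++ (E ++ Rl))))
        assoc D E = trans (++-assoc Lh (D ++ Ll) _) (cong (Lh ++_) (++-assoc D Ll _))
        Weq : L ++ R ≡ Lh ++ (down a s ++ (Ll ++ (Rh ++ (down a (suc s) ++ Rl))))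
        Weq = trans (cong₂ _++_ L≡′ R≡′) (assoc (down a s) (down a (suc s)))
        W′eq : L′ ++ R′ ≡ Lh ++ (down a (suc s) ++ (Ll ++ (Rh ++ (down (suc a) s ++ Rl))))
        W′eq = trans (cong₂ _++_ L′≡ R′≡) (assoc (down a (suc s)) (down (suc a) s))
        middle : down a s ++ (Ll ++ (Rh ++ (down a (suc s) ++ Rl))) ≋ down a (suc s) ++ (Ll ++ (Rh ++ (down (suc a) s ++ Rl)))
        middle = ≋-trans (gather (down-range s (n≤1+n s)) (down-≥ a (suc s)))
          (≋-trans (++-congˡ≋ Rh (++-congʳ≋ (Ll ++ Rl) (run-exchange s 1≤a)))
            (≋-sym (gather (down-range (suc s) ≤-refl) (All.map (≤-trans (n≤1+n a)) (down-≥ (suc a) s)))))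
        lens : length L′ + length R′ ≡ length L + length R
        lens = begin
          length L′ + length R′                     ≡⟨ cong₂ (λ x y → length x + length y) L≡ R≡ ⟩
          length (insertDec (a + s) L) + length (removeOne a R) ≡⟨ cong (_+ length (removeOne a R)) (length-insertDec (a + s) L) ⟩
          suc (length L) + length (removeOne a R)   ≡⟨ +-suc (length L) _ ⟨
          length L + suc (length (removeOne a R))   ≡⟨ cong (length L +_) (length-removeOne (unpaired-⊆ L R unp)) ⟨
          length L + length R                       ∎
          where open ≡-Reasoning
        letters′ : ∀ {x} → x ∈ L′ ⊎ x ∈ R′ → x ∈ L ++ R
        letters′ (inj₂ q) = ∈-++⁺ʳ L (removeOne-⊆ a R (subst (_ ∈_) R≡ q))
        letters′ (inj₁ q) with insertDec-⊆ (a + s) L (subst (_ ∈_) L≡ q)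
        ... | here refl = ∈-++⁺ʳ L (runR s ≤-refl)
        ... | there p   = ∈-++⁺ˡ p

      -- Both blocks now contain the full run from a to a+s, and `run-square` removes two letters.
      singular : ∀ {Lh′} → Lh ≡ Lh′ ++ a + s ∷ [] → Shorter (L ++ R)
      singular {Lh′} refl = record
        { word = Lh′ ++ (Rh ++ ((down a s ++ down (suc a) s) ++ (Ll ++ Rl)))
        ; same = subst (_≋ _) (sym Weq) (++-congˡ≋ Lh′ middle)
        ; fewer = fewer
        ; letters = letters′
        }
        where
        Weq : L ++ R ≡ Lh′ ++ (down a (suc s) ++ (Ll ++ (Rh ++ (down a (suc s) ++ Rl))))
        Weq = trans (cong₂ _++_ L≡′ R≡′) (trans (++-assoc (Lh′ ++ a + s ∷ []) (down a s ++ Ll) _)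
          (trans (++-assoc Lh′ (a + s ∷ []) _) (cong (λ z → Lh′ ++ a + s ∷ z) (++-assoc (down a s) Ll _))))
        middle : down a (suc s) ++ (Ll ++ (Rh ++ (down a (suc s) ++ Rl))) ≋ Rh ++ ((down a s ++ down (suc a) s) ++ (Ll ++ Rl))
        middle = ≋-trans (gather (down-range (suc s) ≤-refl) (down-≥ a (suc s)))
          (++-congˡ≋ Rh (++-congʳ≋ (Ll ++ Rl) (run-square s 1≤a)))
        fewer : length (Lh′ ++ (Rh ++ ((down a s ++ down (suc a) s) ++ (Ll ++ Rl)))) < length (L ++ R)
        fewer rewrite Weq | length-++ Lh′ {Rh ++ ((down a s ++ down (suc a) s) ++ (Ll ++ Rl))}
               | length-++ Rh {(down a s ++ down (suc a) s) ++ (Ll ++ Rl)}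
               | length-++ (down a s ++ down (suc a) s) {Ll ++ Rl} | length-++ (down a s) {down (suc a) s} | length-++ Ll {Rl}
               | length-++ Lh′ {down a (suc s) ++ (Ll ++ (Rh ++ (down a (suc s) ++ Rl)))}
               | length-++ (down a s) {Ll ++ (Rh ++ (down a (suc s) ++ Rl))}
               | length-++ Ll {Rh ++ (down a (suc s) ++ Rl)}
               | length-++ Rh {down a (suc s) ++ Rl} | length-++ (down a s) {Rl} | length-down a s | length-down (suc a) s
               = ≤-trans (n≤1+n _) (≤-reflexive (count (length Lh′) (length Rh) s (length Ll) (length Rl)))
          where
          count : ∀ h r s l k → 2 + (h + (r + (s + s + (l + k)))) ≡ h + suc (s + (l + (r + suc (s + k))))
          count = ℕ-Solver.solve-∀
        in-R : ∀ {x} → x ∈ R → x ∈ L ++ R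
        in-R = ∈-++⁺ʳ L
        in-L : ∀ {x} → x ∈ (Lh′ ++ a + s ∷ []) ++ down a s ++ Ll → x ∈ L ++ R
        in-L q = ∈-++⁺ˡ (subst (_ ∈_) (sym L≡′) q)
        letters′ : ∀ {x} → x ∈ Lh′ ++ (Rh ++ ((down a s ++ down (suc a) s) ++ (Ll ++ Rl))) → x ∈ L ++ R
        letters′ q with ∈-++⁻ Lh′ q
        ... | inj₁ p = in-L (∈-++⁺ˡ (∈-++⁺ˡ p))
        ... | inj₂ p with ∈-++⁻ Rh p
        ...   | inj₁ t = in-R (subst (_ ∈_) (sym R≡′) (∈-++⁺ˡ t))
        ...   | inj₂ t with ∈-++⁻ (down a s ++ down (suc a) s) t
        ...     | inj₁ u with ∈-++⁻ (down a s) u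
        ...       | inj₁ v = in-L (∈-++⁺ʳ (Lh′ ++ a + s ∷ []) (∈-++⁺ˡ v))
        ...       | inj₂ v = in-R (subst (_ ∈_) (sym R≡′) (∈-++⁺ʳ Rh (∈-++⁺ˡ (subst (_ ∈_) (sym (down-snoc a s)) (∈-++⁺ˡ v)))))
        letters′ q | inj₂ p | inj₂ t | inj₂ u with ∈-++⁻ Ll u
        ...       | inj₁ v = in-L (∈-++⁺ʳ (Lh′ ++ a + s ∷ []) (∈-++⁺ʳ (down a s) v))
        ...       | inj₂ v = in-R (subst (_ ∈_) (sym R≡′) (∈-++⁺ʳ Rh (∈-++⁺ʳ (down a (suc s)) v)))

  -- If the inserted letter were already present, the product of the two blocks would not be reduced.
  move-effect : Shorter (L ++ R) ⊎ Effect L R L′ R′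
  move-effect
    with Lh , Ll , L≡′ , Lh≥ , Ll< ← desc-run s descL (runL descL mv)
       | Rh , Rl , R≡′ , Rh≥ , Rl< ← desc-run (suc s) descR (λ j j<s → runR j (s≤s⁻¹ j<s))
    with desc-bottom (Desc-++⁻ˡ Lh (subst Desc L≡′ descL)) Lh≥
  ... | inj₁ Lh>       = inj₂ (Core.regular L≡′ R≡′ Lh≥ Ll< Rh≥ Rl< Lh>)
  ... | inj₂ (_ , eq)  = inj₁ (Core.singular L≡′ R≡′ Lh≥ Ll< Rh≥ Rl< eq)

-- Demazure crystals

linked⇒desc : ∀ {b} → Linked (λ x y → y < x) b → Desc b
linked⇒desc = Linked⇒AllPairs λ y<x z<y → <-trans z<y y<x

State : Set
State = List (List ℕ × ℕ)

Fit : List ℕ × ℕ → List ℕ → Set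
Fit (B , φ) b = ∃ λ hi → b ≡ hi ++ B × All (φ ≤_) hi

Fits : State → Fact → Set
Fits = Pointwise Fit

Bounded : List ℕ × ℕ → Set
Bounded (B , φ) = All (_< φ) B

Compatible : List ℕ × ℕ → List ℕ × ℕ → Set
Compatible (B , φ) (C , ψ) = φ ≤ ψ × Adjacent B C

record Good (S : State) : Set where
  constructor good
  field
    linked  : Linked Compatible S
    bounded : All Bounded S

good-∷ : ∀ {s t S} → Bounded s → Compatible s t → Good (t ∷ S) → Good (s ∷ t ∷ S)
good-∷ b c (good l bs) = good (c ∷ l) (b ∷ bs)

good-tail : ∀ {s S} → Good (s ∷ S) → Good S
good-tail (good l (_ ∷ bs)) = good (Linked.tail l) bs

bounded-suc : ∀ {B φ} → Bounded (B , φ) → Bounded (B , suc φ)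
bounded-suc = All.map m≤n⇒m≤1+n

bounded-∷ : ∀ {B φ} → Bounded (B , φ) → Bounded (φ ∷ B , suc φ)
bounded-∷ b = ≤-refl ∷ bounded-suc b

-- Cutting a block at φ is unambiguous, so the parts below φ before and after a move can be
-- compared.
cut-unique : ∀ {φ} hi hi′ {lo lo′} → All (φ ≤_) hi → All (φ ≤_) hi′ → All (_< φ) lo → All (_< φ) lo′ →
             hi ++ lo ≡ hi′ ++ lo′ → hi ≡ hi′ × lo ≡ lo′
cut-unique []       []         _        _        _        _        e    = refl , e
cut-unique []       (y ∷ hi′)  _        (p ∷ _)  (l ∷ _)  _        refl = ⊥-elim (<⇒≱ l p)
cut-unique (x ∷ hi) []         (p ∷ _)  _        _        (l ∷ _)  refl = ⊥-elim (<⇒≱ l p)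
cut-unique (x ∷ hi) (y ∷ hi′)  (_ ∷ h)  (_ ∷ h′) l        l′       e
  with refl ← ∷-injectiveˡ e with refl , eq ← cut-unique hi hi′ h h′ l l′ (∷-injectiveʳ e) = refl , eq

module _ (n : ℕ) where

  data Split : State → State → State → Set where
    here  : ∀ {B φ S} → φ < n → Split ((B , φ) ∷ S) ((φ ∷ B , suc φ) ∷ S) ((B , suc φ) ∷ S)
    there : ∀ {s S S₁ S₂} → Split S S₁ S₂ → Split (s ∷ S) (s ∷ S₁) (s ∷ S₂)

  -- Once no letter can be moved any more, the right block does not contain φ.
  data Raise : ℕ → State → State → Set where
    here  : ∀ {B C φ S} → φ < n → Pointwise _<_ B C → Bounded (C , φ) →
            Raise 0 ((B , φ) ∷ (C , φ) ∷ S) ((B , φ) ∷ (C , suc φ) ∷ S)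
    there : ∀ {p s S S′} → Raise p S S′ → Raise (suc p) (s ∷ S) (s ∷ S′)

  -- Every split and every raise lowers it, which bounds the recursion in `generators`.
  weight : State → ℕ
  weight = sum ∘ map (λ s → n ∸ proj₂ s)

  ∸-suc : ∀ {φ} → φ < n → n ∸ suc φ < n ∸ φ
  ∸-suc φ<n = ∸-monoʳ-< ≤-refl φ<n

  split-weight : ∀ {S S₁ S₂} → Split S S₁ S₂ → weight S₁ < weight S × weight S₂ < weight S
  split-weight (here {S = S} φ<n) = +-monoˡ-< (weight S) (∸-suc φ<n) , +-monoˡ-< (weight S) (∸-suc φ<n)
  split-weight (there {s} x) = +-monoʳ-< (n ∸ proj₂ s) (proj₁ (split-weight x)) , +-monoʳ-< (n ∸ proj₂ s) (proj₂ (split-weight x))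

  raise-weight : ∀ {p S S′} → Raise p S S′ → weight S′ < weight S
  raise-weight (here {φ = φ} {S} φ<n _ _) = +-monoʳ-< (n ∸ φ) (+-monoˡ-< (weight S) (∸-suc φ<n))
  raise-weight (there {s = s} x) = +-monoʳ-< (n ∸ proj₂ s) (raise-weight x)

  data Progress (S : State) : Set where
    done  : All ((n ≤_) ∘ proj₂) S → Progress S
    split : ∀ {S₁ S₂} → Split S S₁ S₂ → Good S₁ → Good S₂ → Progress S
    raise : ∀ {p S′} → Raise p S S′ → Good S′ → Progress S

  -- atHead is kept apart because a block further to the left decides whether it is a split or a raise.
  data Search (s : List ℕ × ℕ) (S : State) : Set where
    done  : All ((n ≤_) ∘ proj₂) (s ∷ S) → Search s S
    split : ∀ {S₁ S₂} → Split S S₁ S₂ → Good (s ∷ S₁) → Good (s ∷ S₂) → Search s S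
    raise : ∀ {p S′} → Raise p (s ∷ S) (s ∷ S′) → Good (s ∷ S′) → Search s S
    atHead : proj₂ s < n → Good ((proj₂ s ∷ proj₁ s , suc (proj₂ s)) ∷ S) → Good ((proj₁ s , suc (proj₂ s)) ∷ S) → Search s S

  -- Adding an entry to B only makes it overhang C further, so both alternatives suit the right
  -- neighbour, and the strict inequality leaves room for the larger threshold. The left neighbour
  -- is not consulted here.
  raise-head : ∀ {s t S} → Good (s ∷ t ∷ S) → proj₂ s < proj₂ t → proj₂ s < n → Search s (t ∷ S)
  raise-head g@(good ((_ , a) ∷ _) (b ∷ _)) lt φ<n =
    atHead φ<n (good-∷ (bounded-∷ b) (lt , taller a) (good-tail g)) (good-∷ (bounded-suc b) (lt , a) (good-tail g))

  search : ∀ s S → Good (s ∷ S) → Search s S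
  search (B , φ) [] (good [-] (b ∷ [])) with φ <? n
  ... | yes φ<n = atHead φ<n (good [-] (bounded-∷ b ∷ [])) (good [-] (bounded-suc b ∷ []))
  ... | no φ≮n  = done (≮⇒≥ φ≮n ∷ [])
  search s@(B , φ) (t@(C , ψ) ∷ S) g@(good (c@(φ≤ψ , adj) ∷ l) (b ∷ bs)) with search t S (good-tail g)
  ... | split x g₁ g₂ = split (there x) (good-∷ b c g₁) (good-∷ b c g₂)
  ... | raise x g₁    = raise (there x) (good-∷ b c g₁)
  ... | done (n≤ψ ∷ rest) with φ <? n
  ...   | no φ≮n  = done (≮⇒≥ φ≮n ∷ n≤ψ ∷ rest)
  ...   | yes φ<n = raise-head g (<-≤-trans φ<n n≤ψ) φ<n
  search s@(B , φ) (t@(C , ψ) ∷ S) g@(good (c@(φ≤ψ , adj) ∷ l) (b ∷ bs)) | atHead ψ<n g₁ g₂ with adj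
  -- The overhang of B provides a counterpart for the new entry ψ of C.
  ... | taller {x} adj′ = split (here ψ<n)
          (good-∷ b (m≤n⇒m≤1+n φ≤ψ , adjacent-∷ adj′ (All.map (λ x<φ → <-≤-trans x<φ φ≤ψ) b)) g₁)
          (good-∷ b (m≤n⇒m≤1+n φ≤ψ , adj) g₂)
  ... | level pw with φ ≟ ψ
  ...   | yes refl = raise (here ψ<n pw (All.head bs)) (good-∷ b (n≤1+n φ , level pw) g₂)
  ...   | no φ≢ψ   = raise-head g (≤∧≢⇒< φ≤ψ φ≢ψ) (≤-<-trans φ≤ψ ψ<n)

  progress : ∀ S → Good S → Progress S
  progress []      g = done []
  progress (s ∷ S) g with search s S g
  ... | done x         = done x
  ... | split x g₁ g₂  = split (there x) g₁ g₂
  ... | raise x g₁     = raise x g₁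
  ... | atHead φ<n g₁ g₂ = split (here φ<n) g₁ g₂

  split-fits : ∀ {S S₁ S₂ r} → Split S S₁ S₂ → All Desc r → Fits S r → Fits S₁ r ⊎ Fits S₂ r
  split-fits (here {B} {φ} _) (d ∷ _) ((hi , refl , h) ∷ fs) with desc-bottom (Desc-++⁻ˡ hi d) h
  ... | inj₁ h′ = inj₂ ((hi , refl , h′) ∷ fs)
  ... | inj₂ (ys , refl) = inj₁ ((ys , ++-assoc ys (φ ∷ []) B , desc-above ys (Desc-++⁻ˡ (ys ++ φ ∷ []) d)) ∷ fs)
  split-fits (there x) (_ ∷ ds) (f ∷ fs) with split-fits x ds fs
  ... | inj₁ fs′ = inj₁ (f ∷ fs′)
  ... | inj₂ fs′ = inj₂ (f ∷ fs′)

  split-fits₁ : ∀ {S S₁ S₂ r} → Split S S₁ S₂ → Fits S₁ r → Fits S r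
  split-fits₁ (here {B} {φ} _) ((hi , refl , h) ∷ fs) =
    (hi ++ φ ∷ [] , sym (++-assoc hi (φ ∷ []) B) , All.++⁺ (All.map <⇒≤ h) (≤-refl ∷ [])) ∷ fs
  split-fits₁ (there x) (f ∷ fs) = f ∷ split-fits₁ x fs

  split-fits₂ : ∀ {S S₁ S₂ r} → Split S S₁ S₂ → Fits S₂ r → Fits S r
  split-fits₂ (here _) ((hi , refl , h) ∷ fs) = (hi , refl , All.map <⇒≤ h) ∷ fs
  split-fits₂ (there x) (f ∷ fs) = f ∷ split-fits₂ x fs

  split-disjoint : ∀ {S S₁ S₂ r} → Split S S₁ S₂ → Fits S₁ r → Fits S₂ r → ⊥
  split-disjoint (here {B} {φ} _) ((hi , refl , _) ∷ _) ((hi′ , e , h) ∷ _) = <-irrefl refl (All.lookup h φ∈)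
    where
    φ∈ : φ ∈ hi′
    φ∈ = subst (φ ∈_) (++-cancelʳ B (hi ++ φ ∷ []) hi′ (trans (++-assoc hi (φ ∷ []) B) e)) (∈-++⁺ʳ hi (here refl))
  split-disjoint (there x) (_ ∷ fs) (_ ∷ fs′) = split-disjoint x fs fs′

  raise-fits : ∀ {p S S′ r} → Raise p S S′ → Fits S′ r → Fits S r
  raise-fits (here _ _ _) (f ∷ (hi , refl , h) ∷ fs) = f ∷ (hi , refl , All.map <⇒≤ h) ∷ fs
  raise-fits (there x) (f ∷ fs) = f ∷ raise-fits x fs

  raise-stop : ∀ {p S S′ r} → Raise p S S′ → All Desc r → Fits S r → fAt p r ≡ nothing → Fits S′ r
  raise-stop (here {B} {C} {φ} _ pw bC) (_ ∷ dR ∷ _) ((hL , refl , L≥) ∷ (hR , refl , R≥) ∷ fs) e with fPair (hL ++ B) (hR ++ C) in eq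
  ... | nothing = (hL , refl , L≥) ∷ (hR , refl , All.tabulate λ q → ≤∧≢⇒< (All.lookup R≥ q) λ φ≡x → φ∉ (subst (_∈ hR) (sym φ≡x) q)) ∷ fs
    where
    φ∉ : φ ∉ hR
    φ∉ q with () ← subst (φ ∈_) (trans (sym (unpaired-split L≥ R≥ bC pw (Desc-++⁻ʳ hR dR))) (fPair-nothing (hL ++ B) (hR ++ C) eq))
                     (unpaired-stays L≥ q)
  raise-stop {r = b ∷ rs} (there {p} x) (_ ∷ ds) (f ∷ fs) e with fAt p rs in eq
  ... | nothing = f ∷ raise-stop x ds fs eq

  raise-keep : ∀ {p S S′ r r′} → Raise p S S′ → All Desc r → Fits S r → fAt p r ≡ just r′ → Fits S r′
  raise-keep (here {B} {C} {φ} _ pw bC) (_ ∷ dR ∷ _) ((hL , refl , L≥) ∷ (hR , refl , R≥) ∷ fs) e with fPair (hL ++ B) (hR ++ C) in eq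
  raise-keep (here {B} {C} {φ} _ pw bC) (_ ∷ dR ∷ _) ((hL , refl , L≥) ∷ (hR , refl , R≥) ∷ fs) refl | just (L′ , R′) =
      (insertDec (a + s) hL , trans L≡ (insertDec-++ˡ hL B B<) , insertDec-All (≤-trans φ≤a (m≤m+n a s)) L≥)
    ∷ (removeOne a hR , trans R≡ (removeOne-++ˡ C a∈) , removeOne-All a R≥) ∷ fs
    where
    open Move (fPair-just (hL ++ B) (hR ++ C) eq)
    a∈ : a ∈ hR
    a∈ = unpaired-⊆ hL hR (subst (a ∈_) (unpaired-split L≥ R≥ bC pw (Desc-++⁻ʳ hR dR)) unp)
    φ≤a : φ ≤ a
    φ≤a = All.lookup R≥ a∈
    B< : All (_< a + s) B
    B< = All.map (λ x<φ → <-≤-trans x<φ (≤-trans φ≤a (m≤m+n a s))) (pointwise-bound bC pw)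
  raise-keep {r = b ∷ rs} (there {p} x) (_ ∷ ds) (f ∷ fs) e with fAt p rs in eq
  raise-keep {r = b ∷ rs} (there {p} x) (_ ∷ ds) (f ∷ fs) refl | just rs′ = f ∷ raise-keep x ds fs eq

  -- The low parts of r are not yet known, so φ ≤ a has to come from the shape of the blocks after
  -- the move; `move-back` supplies this. Then nothing below φ was touched, and `cut-unique`
  -- identifies the low parts.
  raise-back : ∀ {p S S′ r r′} → Raise p S S′ → All Desc r → Fits S r′ → fAt p r ≡ just r′ → Fits S r
  raise-back {r = L ∷ R ∷ rs} (here {B} {C} {φ} _ pw bC) (dL ∷ dR ∷ _) fits e with fPair L R in eq
  raise-back {r = L ∷ R ∷ rs} (here {B} {C} {φ} _ pw bC) (dL ∷ dR ∷ _) ((hL , L′≡ , L≥) ∷ (hR , R′≡ , R≥) ∷ fs) refl | just (L′ , R′) =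
    fitL ∷ fitR ∷ fs
    where
    mv : Move L R L′ R′
    mv = fPair-just L R eq
    open Move mv
    φ≤a : φ ≤ a
    φ≤a = move-back dL mv L′≡ R′≡ L≥ R≥ bC pw
    φ≤a+s : φ ≤ a + s
    φ≤a+s = ≤-trans φ≤a (m≤m+n a s)
    fitL : Fit (B , φ) L
    fitL with hi , lo , refl , h , l ← desc-cut φ dL
      with refl ← proj₂ (cut-unique (insertDec (a + s) hi) hL (insertDec-All φ≤a+s h) L≥ l (pointwise-bound bC pw)
             (trans (sym (insertDec-++ˡ hi lo (All.map (λ x<φ → <-≤-trans x<φ φ≤a+s) l))) (trans (sym L≡) L′≡)))
      = hi , refl , h
    in-hi : ∀ {hi lo} → All (_< φ) lo → a ∈ hi ⊎ a ∈ lo → a ∈ hi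
    in-hi l (inj₁ q) = q
    in-hi l (inj₂ q) = ⊥-elim (<⇒≱ (All.lookup l q) φ≤a)
    fitR : Fit (C , φ) R
    fitR with hi , lo , refl , h , l ← desc-cut φ dR
      with refl ← proj₂ (cut-unique (removeOne a hi) hR (removeOne-All a h) R≥ l bC
             (trans (sym (removeOne-++ˡ lo (in-hi l (∈-++⁻ hi (unpaired-⊆ L R unp))))) (trans (sym R≡) R′≡)))
      = hi , refl , h
  raise-back {r = b ∷ rs} (there {p} x) (_ ∷ ds) fits e with fAt p rs in eq
  raise-back {r = b ∷ rs} (there {p} x) (_ ∷ ds) (f ∷ fs) refl | just rs′ = f ∷ raise-back x ds fs eq

-- Crystal operators on whole factorizations

record FactEffect (r r′ : Fact) : Set where
  field
    desc    : All Desc r′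
    blocks  : length r′ ≡ length r
    same    : concat r ≋ concat r′
    len     : length (concat r′) ≡ length (concat r)
    letters : ∀ {x} → x ∈ concat r′ → x ∈ concat r

shorter-++ʳ : ∀ {W} V → Shorter W → Shorter (W ++ V)
shorter-++ʳ {W} V s = record
  { word = word ++ V
  ; same = ++-congʳ≋ V same
  ; fewer = subst₂ _<_ (sym (length-++ word)) (sym (length-++ W)) (+-monoˡ-< (length V) fewer)
  ; letters = λ q → grow (∈-++⁻ word q)
  }
  where
  open Shorter s
  grow : ∀ {x} → x ∈ word ⊎ x ∈ V → x ∈ W ++ V
  grow (inj₁ p) = ∈-++⁺ˡ (letters p)
  grow (inj₂ p) = ∈-++⁺ʳ W p

shorter-++ˡ : ∀ V {W} → Shorter W → Shorter (V ++ W)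
shorter-++ˡ V {W} s = record
  { word = V ++ word
  ; same = ++-congˡ≋ V same
  ; fewer = subst₂ _<_ (sym (length-++ V)) (sym (length-++ V)) (+-monoʳ-< (length V) fewer)
  ; letters = λ q → grow (∈-++⁻ V q)
  }
  where
  open Shorter s
  grow : ∀ {x} → x ∈ V ⊎ x ∈ word → x ∈ V ++ W
  grow (inj₁ p) = ∈-++⁺ˡ p
  grow (inj₂ p) = ∈-++⁺ʳ V (letters p)

fAt-effect : ∀ p {r r′} → All Desc r → All (1 ≤_) (concat r) → fAt p r ≡ just r′ → Shorter (concat r) ⊎ FactEffect r r′
fAt-effect zero {L ∷ R ∷ rs} (dL ∷ dR ∷ ds) pos e with fPair L R in eq
fAt-effect zero {L ∷ R ∷ rs} (dL ∷ dR ∷ ds) pos refl | just (L′ , R′)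
  with move-effect dL dR (All.++⁻ˡ L pos) (All.++⁻ˡ R (All.++⁻ʳ L pos)) (fPair-just L R eq)
... | inj₁ s = inj₁ (subst Shorter (++-assoc L R (concat rs)) (shorter-++ʳ (concat rs) s))
... | inj₂ f = inj₂ record
  { desc = descˡ ∷ descʳ ∷ ds
  ; blocks = refl
  ; same = subst₂ _≋_ (++-assoc L R (concat rs)) (++-assoc L′ R′ (concat rs)) (++-congʳ≋ (concat rs) same)
  ; len = trans (cong length (sym (++-assoc L′ R′ (concat rs)))) (trans (length-++ (L′ ++ R′))
      (trans (cong (_+ length (concat rs)) len) (trans (sym (length-++ (L ++ R))) (cong length (++-assoc L R (concat rs))))))
  ; letters = λ {x} q → subst (x ∈_) (++-assoc L R (concat rs)) (grow (∈-++⁻ (L′ ++ R′) (subst (x ∈_) (sym (++-assoc L′ R′ (concat rs))) q)))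
  }
  where
  open Effect f
  grow : ∀ {x} → x ∈ L′ ++ R′ ⊎ x ∈ concat rs → x ∈ (L ++ R) ++ concat rs
  grow (inj₁ p) = ∈-++⁺ˡ (letters p)
  grow (inj₂ p) = ∈-++⁺ʳ (L ++ R) p
fAt-effect (suc p) {b ∷ rs} (d ∷ ds) pos e with fAt p rs in eq
fAt-effect (suc p) {b ∷ rs} (d ∷ ds) pos refl | just rs′ with fAt-effect p ds (All.++⁻ʳ b pos) eq
... | inj₁ s = inj₁ (shorter-++ˡ b s)
... | inj₂ f = inj₂ record
  { desc = d ∷ desc
  ; blocks = cong suc blocks
  ; same = ++-congˡ≋ b same
  ; len = trans (length-++ b) (trans (cong (length b +_) len) (sym (length-++ b)))
  ; letters = λ q → grow (∈-++⁻ b q)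
  }
  where
  open FactEffect f
  grow : ∀ {x} → x ∈ b ⊎ x ∈ concat rs′ → x ∈ b ++ concat rs
  grow (inj₁ p) = ∈-++⁺ˡ p
  grow (inj₂ p) = ∈-++⁺ʳ b (letters p)

size : ℕ → Fact → ℕ
size p r = length (block r p)

-- The right block of the pair loses a letter, so an operator can be iterated only finitely often.
fAt-size : ∀ p {r r′} → fAt p r ≡ just r′ → size (suc p) r ≡ suc (size (suc p) r′)
fAt-size zero {L ∷ R ∷ rs} e with fPair L R in eq
fAt-size zero {L ∷ R ∷ rs} refl | just (L′ , R′) = trans (length-removeOne (unpaired-⊆ L R unp)) (cong (suc ∘ length) (sym R≡))
  where open Move (fPair-just L R eq)
fAt-size (suc p) {b ∷ rs} e with fAt p rs in eq
fAt-size (suc p) {b ∷ rs} refl | just rs′ = fAt-size p eq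

fAt-lowest : ∀ p {r} → Linked Adjacent r → All Desc r → fAt p r ≡ nothing
fAt-lowest zero    []      _ = refl
fAt-lowest zero    [-]     _ = refl
fAt-lowest zero    {L ∷ R ∷ rs} (a ∷ l) (_ ∷ d ∷ _) with fPair L R | fPair-[] L R (adjacent-paired a d)
... | nothing | _ = refl
fAt-lowest (suc p) []      _ = refl
fAt-lowest (suc p) [-]     _ = lemma p
  where
  lemma : ∀ {b} p → fAt (suc p) (b ∷ []) ≡ nothing
  lemma zero    = refl
  lemma (suc p) = refl
fAt-lowest (suc p) {L ∷ rs} (a ∷ l) (_ ∷ ds) with fAt p rs | fAt-lowest p l ds
... | nothing | _ = refl

-- Inverts the index formula shared by `fOp` and `wt`, both of which number blocks from the right
-- with an offset n-ℓ.
reflect-position : ∀ {p ℓ n} → suc p ≤ ℓ → ℓ ≤ n → ℓ ∸ suc (n ∸ suc p ∸ (n ∸ ℓ)) ≡ p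
reflect-position {p} p<ℓ ℓ≤n with q , refl ← m≤n⇒∃[o]m+o≡n p<ℓ with k , refl ← m≤n⇒∃[o]m+o≡n ℓ≤n = begin
  p + q ∸ (p + q + k ∸ p ∸ (p + q + k ∸ (p + q)))  ≡⟨ cong₂ (λ x y → p + q ∸ (x ∸ y)) (trans (cong (_∸ p) (+-assoc p q k)) (m+n∸m≡n p (q + k))) (m+n∸m≡n (p + q) k) ⟩
  p + q ∸ (q + k ∸ k)                              ≡⟨ cong (p + q ∸_) (m+n∸n≡m q k) ⟩
  p + q ∸ q                                        ≡⟨ m+n∸n≡m p q ⟩
  p                                                ∎
  where open ≡-Reasoning

-- Lowest weight generators of a cell

module Crystal (n : ℕ) (w : Permutation′ n) (ℓ : ℕ) (ℓ≤n : ℓ ≤ n) where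

  RF : Fact → Set
  RF = IsRF n w ℓ

  rf-desc : ∀ {r} → RF r → All Desc r
  rf-desc (_ , d , _) = All.map linked⇒desc d

  rf-range : ∀ {r} → RF r → All (InRange n) (concat r)
  rf-range (_ , _ , p , _) = p

  -- The degenerate outcome of a move would give a word for w with fewer letters than w has
  -- inversions; the regular one keeps product and length.
  rf-fAt : ∀ p {r r′} → RF r → fAt p r ≡ just r′ → RF r′
  rf-fAt p {r} {r′} rf@(len-r , _ , red) e with fAt-effect p (rf-desc rf) (All.map proj₁ (rf-range rf)) e
  ... | inj₁ s = ⊥-elim (<⇒≱ fewer (reduced-shortest (reduced⇒ red) (All.tabulate (All.lookup (rf-range rf) ∘ letters)) same))
    where open Shorter s
  ... | inj₂ f = trans blocks len-r , All.map AllPairs⇒Linked desc ,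
        reduced⇐ (reduced-≋ (reduced⇒ red) (All.tabulate (All.lookup (rf-range rf) ∘ letters)) same len)
    where open FactEffect f

  -- Needed when all thresholds have reached n: the one remaining candidate need not multiply to w.
  rf? : ∀ r → Dec (RF r)
  rf? r = (length r ≟ ℓ) ×-dec All.all? (Linked.linked? (λ x y → y <? x)) r
          ×-dec All.all? (λ x → (1 ≤? x) ×-dec (suc x ≤? n)) (concat r)
          ×-dec (length (concat r) ≟ inv (w ⟨$⟩ʳ_))
          ×-dec Fin.all? (λ k → wordFun (concat r) k Fin.≟ (w ⟨$⟩ʳ k))

  -- The operator acting on blocks p and p+1 (from the left, 0-based) has this index.
  op : ℕ → ℕ
  op p = n ∸ suc p

  fOp-op : ∀ {p} → suc p < ℓ → ∀ r → fOp n ℓ (op p) r ≡ fAt p r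
  fOp-op {p} p<ℓ r
    rewrite dec-true (n ∸ ℓ <? op p) (∸-monoʳ-< p<ℓ ℓ≤n) | dec-true (suc (op p) <? suc n) (s<s (∸-monoʳ-< {n} {suc p} {0} z<s (≤-trans (n≤1+n _) (≤-trans p<ℓ ℓ≤n))))
    = cong (λ z → fAt z r) (reflect-position (<⇒≤ p<ℓ) ℓ≤n)

  -- `fIter` exposes its last application, while the inductions on Demazure membership need the
  -- first.
  fIter-suc : ∀ i m r → fIter n ℓ i (suc m) r ≡ (fOp n ℓ i r >>= fIter n ℓ i m)
  fIter-suc i zero r with fOp n ℓ i r
  ... | nothing = refl
  ... | just _  = refl
  fIter-suc i (suc m) r rewrite fIter-suc i m r with fOp n ℓ i r
  ... | nothing = refl
  ... | just _  = refl

  dem-self : ∀ {u} is → RF u → InDemazure n w ℓ is u u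
  dem-self []       rf = refl
  dem-self (i ∷ is) rf = rf , 0 , _ , refl , dem-self is rf

  -- The second half of the theorem for an arbitrary set X, so that it can be assembled cell by
  -- cell.
  Generators : (Fact → Set) → Set
  Generators X = Σ (List (Fact × List ℕ)) λ U →
    Unique (map proj₁ U)
    × All (λ t → RF (proj₁ t) × IsLowest n ℓ (proj₁ t)) U
    × (∀ r → X r ⇔ Any (λ t → InDemazure n w ℓ (proj₂ t) (proj₁ t) r) U)

  Cell : State → Fact → Set
  Cell S r = RF r × Fits S r

  -- Zero applications of every operator are allowed, so a generator belongs to its own Demazure
  -- set. Hence disjoint cells have distinct generators.
  generator-in : ∀ {X : Fact → Set} (G : Generators X) {u} → u ∈ map proj₁ (proj₁ G) → X u
  generator-in (U , _ , low , iff) u∈ with (u , is) , t∈ , refl ← ∈-map⁻ proj₁ u∈ =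
    Equivalence.from (iff u) (Any.map (λ { refl → dem-self is (proj₁ (All.lookup low t∈)) }) t∈)

  generators-split : ∀ {S S₁ S₂} → Split n S S₁ S₂ → Generators (Cell S₁) → Generators (Cell S₂) → Generators (Cell S)
  generators-split {S} x G₁@(U₁ , uniq₁ , low₁ , iff₁) G₂@(U₂ , uniq₂ , low₂ , iff₂) =
    U₁ ++ U₂
    , subst Unique (sym (map-++ proj₁ U₁ U₂)) (Unique.++⁺ uniq₁ uniq₂ λ (p , q) → split-disjoint n x (proj₂ (generator-in G₁ p)) (proj₂ (generator-in G₂ q)))
    , All.++⁺ low₁ low₂
    , λ r → mk⇔ to (from r)
    where
    to : ∀ {r} → Cell S r → Any _ (U₁ ++ U₂)
    to {r} (rf , fits) with split-fits n x (rf-desc rf) fits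
    ... | inj₁ f = Any.++⁺ˡ (Equivalence.to (iff₁ r) (rf , f))
    ... | inj₂ f = Any.++⁺ʳ U₁ (Equivalence.to (iff₂ r) (rf , f))
    from : ∀ r → Any _ (U₁ ++ U₂) → Cell S r
    from r a with Any.++⁻ U₁ a
    ... | inj₁ b with rf , f ← Equivalence.from (iff₁ r) b = rf , split-fits₁ n x f
    ... | inj₂ b with rf , f ← Equivalence.from (iff₂ r) b = rf , split-fits₂ n x f

  raise-length : ∀ {p S S′ r} → Raise n p S S′ → Fits S r → suc p < length r
  raise-length (here _ _ _) (_ ∷ _ ∷ _) = s<s z<s
  raise-length (there x)    (_ ∷ fs)    = s<s (raise-length x fs)

  -- The lowest elements stay, and each operator word is extended on the left. Iterating the
  -- operator stays in the cell by `raise-keep` and ends in the raised one by `raise-stop`;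
  -- `raise-back` leads from an iterate back to r.
  generators-raise : ∀ {p S S′} → Raise n p S S′ → Generators (Cell S′) → Generators (Cell S)
  generators-raise {p} {S} {S′} x (U , uniq , low , iff) =
    map (λ t → proj₁ t , op p ∷ proj₂ t) U
    , subst Unique (map-∘ U) uniq
    , All.map⁺ low
    , λ r → mk⇔ (λ (rf , f) → Any.map⁺ (to (size (suc p) r) r ≤-refl rf f)) (λ a → from r (Any.map⁻ a))
    where
    p<ℓ : ∀ {r} → RF r → Fits S r → suc p < ℓ
    p<ℓ {r} rf f = subst (suc p <_) (proj₁ rf) (raise-length x f)
    -- Induction on a bound for the size of the right block, which every application lowers.
    to : ∀ k r → size (suc p) r ≤ k → RF r → Fits S r →
         Any (λ t → InDemazure n w ℓ (op p ∷ proj₂ t) (proj₁ t) r) U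
    to k r le rf f with fAt p r in eq
    ... | nothing = Any.map (λ d → rf , 0 , r , refl , d) (Equivalence.to (iff r) (rf , raise-stop n x (rf-desc rf) f eq))
    to zero r le rf f | just r′ = ⊥-elim (n≮0 (subst (_≤ 0) (fAt-size p eq) le))
    to (suc k) r le rf f | just r′ =
      Any.map (λ (_ , m , b , e , d) → rf , suc m , b , trans (fIter-suc (op p) m r) (trans (cong (_>>= fIter n ℓ (op p) m) (trans (fOp-op (p<ℓ rf f) r) eq)) e) , d)
        (to k r′ (s≤s⁻¹ (subst (_≤ suc k) (fAt-size p eq) le)) (rf-fAt p rf eq) (raise-keep n x (rf-desc rf) f eq))
    back : ∀ m r b → suc p < ℓ → RF r → fIter n ℓ (op p) m r ≡ just b → Fits S b → Fits S r
    back zero    r b lt rf refl f = f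
    back (suc m) r b lt rf e    f with fAt p r in eq | trans (sym (fIter-suc (op p) m r)) e
    ... | o | e′ rewrite fOp-op lt r | eq with o
    ...   | just r′ = raise-back n x (rf-desc rf) (back m r′ b lt (rf-fAt p rf eq) e′ f) eq
    from : ∀ r → Any (λ t → InDemazure n w ℓ (op p ∷ proj₂ t) (proj₁ t) r) U → Cell S r
    -- That p is a valid position is read off b, because r is not yet known to fit.
    from r a with t , t∈ , (rf , m , b , e , d) ← find a with rf-b , f ← Equivalence.from (iff b) (lose t∈ d) =
      rf , back m r b (p<ℓ rf-b (raise-fits n x f)) rf e (raise-fits n x f)

  lowest-fOp : ∀ {r} → Linked Adjacent r → All Desc r → IsLowest n ℓ r
  lowest-fOp {r} l d i with does (n ∸ ℓ <? i)
  ... | false = refl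
  ... | true with does (suc i <? suc n)
  ...   | false = refl
  ...   | true  = fAt-lowest (ℓ ∸ suc (i ∸ (n ∸ ℓ))) l d

  done-fits : ∀ {S r} → All ((n ≤_) ∘ proj₂) S → All (_< n) (concat r) → Fits S r → r ≡ map proj₁ S
  done-fits [] _ [] = refl
  done-fits (n≤φ ∷ h) lt (([] , refl , _) ∷ fs) = cong (_ ∷_) (done-fits h (All.++⁻ʳ _ lt) fs)
  done-fits (n≤φ ∷ h) (x<n ∷ _) ((x ∷ hi , refl , φ≤x ∷ _) ∷ fs) = ⊥-elim (<⇒≱ x<n (≤-trans n≤φ φ≤x))

  fits-map : ∀ S → Fits S (map proj₁ S)
  fits-map []      = []
  fits-map (s ∷ S) = ([] , refl , []) ∷ fits-map S

  compatible-adjacent : ∀ {S} → Linked Compatible S → Linked Adjacent (map proj₁ S)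
  compatible-adjacent []            = []
  compatible-adjacent [-]           = [-]
  compatible-adjacent ((_ , a) ∷ l) = a ∷ compatible-adjacent l

  generators-done : ∀ {S} → All ((n ≤_) ∘ proj₂) S → Good S → Generators (Cell S)
  generators-done {S} h g with rf? (map proj₁ S)
  ... | yes rf = (map proj₁ S , []) ∷ [] , [] ∷ [] , (rf , lowest-fOp (compatible-adjacent (Good.linked g)) (rf-desc rf)) ∷ []
        , λ r → mk⇔ (λ (rf′ , f) → here (done-fits h (All.map proj₂ (rf-range rf′)) f)) λ { (here refl) → rf , fits-map S }
  ... | no ¬rf = [] , [] , [] , λ r → mk⇔ (λ (rf′ , f) → ⊥-elim (¬rf (subst RF (done-fits h (All.map proj₂ (rf-range rf′)) f) rf′))) λ ()

  generators : ∀ k S → Good S → weight n S ≤ k → Generators (Cell S)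
  generators k S g le with progress n S g
  ... | done h = generators-done h g
  generators zero S g le | split x g₁ g₂ = ⊥-elim (n≮0 (<-≤-trans (proj₁ (split-weight n x)) le))
  generators zero S g le | raise x g₁    = ⊥-elim (n≮0 (<-≤-trans (raise-weight n x) le))
  generators (suc k) S g le | split x g₁ g₂ = generators-split x
    (generators k _ g₁ (s≤s⁻¹ (<-≤-trans (proj₁ (split-weight n x)) le)))
    (generators k _ g₂ (s≤s⁻¹ (<-≤-trans (proj₂ (split-weight n x)) le)))
  generators (suc k) S g le | raise x g₁ = generators-raise x (generators k _ g₁ (s≤s⁻¹ (<-≤-trans (raise-weight n x) le)))

  cutoffs : ℕ → ℕ → State
  cutoffs i zero    = []
  cutoffs i (suc k) = ([] , i) ∷ cutoffs (suc i) k

  cutoffs-good : ∀ i k → Good (cutoffs i k)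
  cutoffs-good i zero          = good [] []
  cutoffs-good i (suc zero)    = good [-] ([] ∷ [])
  cutoffs-good i (suc (suc k)) = good-∷ [] (n≤1+n i , level []) (cutoffs-good (suc i) (suc k))

  cutoffs-fits : ∀ i {r} k → length r ≡ k → YoungCutoff i r → Fits (cutoffs i k) r
  cutoffs-fits i {[]}     _ refl _       = []
  cutoffs-fits i {b ∷ bs} _ refl (h , c) = (b , sym (++-identityʳ b) , h) ∷ cutoffs-fits (suc i) _ refl c

  fits-cutoffs : ∀ i {r} k → Fits (cutoffs i k) r → YoungCutoff i r
  fits-cutoffs i zero    []                     = _
  fits-cutoffs i (suc k) ((hi , refl , h) ∷ fs) = All.++⁺ h [] , fits-cutoffs (suc i) k fs

  generators-cutoff : Generators (λ r → RF r × YoungCutoff 1 r)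
  generators-cutoff with U , uniq , low , iff ← generators _ (cutoffs 1 ℓ) (cutoffs-good 1 ℓ) ≤-refl =
    U , uniq , low , λ r → mk⇔
      (λ (rf , c) → Equivalence.to (iff r) (rf , cutoffs-fits 1 ℓ (proj₁ rf) c))
      (λ a → let rf , f = Equivalence.from (iff r) a in rf , fits-cutoffs 1 ℓ f)

-- The nilCoxeter algebra

-- A function on one-line notations stands for the element Σ_v F(v) u_v of the nilCoxeter algebra, and
-- u k F is its right multiple by the generator u_{k+1}.
Fun : Set
Fun = List ℕ → ℕ

_⊕_ : Fun → Fun → Fun
(F ⊕ G) V = F V + G V

𝟘 : Fun
𝟘 _ = 0

infix 4 _≐_
_≐_ : Fun → Fun → Set
F ≐ G = ∀ V → F V ≡ G V

if-0 : ∀ b → (if b then 0 else 0) ≡ 0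
if-0 true  = refl
if-0 false = refl

-- Kept folded outside this block, where only the relations and evaluation rules below are used;
-- omitted function arguments can then be read off the goals.
opaque
  u : ℕ → Fun → Fun
  u k F V = if isDesc k V then F (swapL k V) else 0

  u-cong : ∀ k {F G} → F ≐ G → u k F ≐ u k G
  u-cong k h V = cong (λ z → if isDesc k V then z else 0) (h (swapL k V))

  u-⊕ : ∀ k F G → u k (F ⊕ G) ≐ u k F ⊕ u k G
  u-⊕ k F G V with isDesc k V
  ... | true  = refl
  ... | false = refl

  u-𝟘 : ∀ k → u k 𝟘 ≐ 𝟘
  u-𝟘 k V = if-0 (isDesc k V)

  u-square : ∀ k F → u k (u k F) ≐ 𝟘
  u-square zero F []          = refl
  u-square zero F (x ∷ [])    = refl
  u-square zero F (x ∷ y ∷ v) with y <? x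
  ... | no y≮x  rewrite dec-false (y <? x) y≮x = refl
  ... | yes y<x rewrite dec-true (y <? x) y<x | dec-false (x <? y) (<-asym y<x) = refl
  u-square (suc k) F []      = refl
  u-square (suc k) F (x ∷ v) = u-square k (F ∘ (x ∷_)) v

  -- Both sides vanish unless x > y > z, and then both evaluate F with these three entries reversed.
  u-braid : ∀ k F → u k (u (suc k) (u k F)) ≐ u (suc k) (u k (u (suc k) F))
  u-braid zero F []       = refl
  u-braid zero F (x ∷ []) = refl
  u-braid zero F (x ∷ y ∷ []) = if-0 (does (y <? x))
  u-braid zero F (x ∷ y ∷ z ∷ v) with y <? x | z <? x | z <? y
  ... | yes p | yes q | yes r rewrite dec-true (y <? x) p | dec-true (z <? x) q | dec-true (z <? y) r = refl
  ... | yes p | yes q | no r  rewrite dec-true (y <? x) p | dec-true (z <? x) q | dec-false (z <? y) r = refl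
  ... | yes p | no q  | yes r = ⊥-elim (q (<-trans r p))
  ... | yes p | no q  | no r  rewrite dec-true (y <? x) p | dec-false (z <? x) q | dec-false (z <? y) r = refl
  ... | no p  | yes q | yes r rewrite dec-false (y <? x) p | dec-true (z <? x) q | dec-true (z <? y) r = refl
  ... | no p  | yes q | no r  = ⊥-elim (p (≤-<-trans (≮⇒≥ r) q))
  ... | no p  | no q  | yes r rewrite dec-false (y <? x) p | dec-false (z <? x) q | dec-true (z <? y) r = refl
  ... | no p  | no q  | no r  rewrite dec-false (y <? x) p | dec-false (z <? y) r = refl
  u-braid (suc k) F []      = refl
  u-braid (suc k) F (x ∷ v) = u-braid k (F ∘ (x ∷_)) v

  u-far : ∀ k j F → u k (u (2 + (k + j)) F) ≐ u (2 + (k + j)) (u k F)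
  u-far zero j F []       = refl
  u-far zero j F (x ∷ []) = refl
  u-far zero j F (x ∷ y ∷ v) with does (y <? x)
  ... | true  = refl
  ... | false = sym (if-0 (isDesc j v))
  u-far (suc k) j F []      = refl
  u-far (suc k) j F (x ∷ v) = u-far k j (F ∘ (x ∷_)) v

  u-∷ : ∀ k F x V → u (suc k) F (x ∷ V) ≡ u k (F ∘ (x ∷_)) V
  u-∷ k F x V = refl

  u-desc : ∀ k F V → isDesc k V ≡ true → u k F V ≡ F (swapL k V)
  u-desc k F V d rewrite d = refl

  u-nodesc : ∀ k F V → isDesc k V ≡ false → u k F V ≡ 0
  u-nodesc k F V d rewrite d = refl

-- E m i (2 + p) is right multiplication by the sum of all decreasing products of p generators with
-- (0-based) indices in [i, i+m). The offset 2 makes room for vanishing terms of index p-1 and p-2.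
E : ℕ → ℕ → ℕ → Fun → Fun
E zero    i 0                   F = 𝟘
E zero    i 1                   F = 𝟘
E zero    i 2                   F = F
E zero    i (suc (suc (suc _))) F = 𝟘
E (suc m) i zero                F = 𝟘
E (suc m) i (suc p)             F = E m (suc i) (suc p) F ⊕ u i (E m (suc i) p F)

E-cong : ∀ m i p {F G} → F ≐ G → E m i p F ≐ E m i p G
E-cong zero    i 0 h V = refl
E-cong zero    i 1 h V = refl
E-cong zero    i 2 h V = h V
E-cong zero    i (suc (suc (suc _))) h V = refl
E-cong (suc m) i zero    h V = refl
E-cong (suc m) i (suc p) h V = cong₂ _+_ (E-cong m (suc i) (suc p) h V) (u-cong i (E-cong m (suc i) p h) V)

interchange : ∀ a b c d → (a + b) + (c + d) ≡ (a + c) + (b + d)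
interchange = ℕ-Solver.solve-∀

E-⊕ : ∀ m i p F G → E m i p (F ⊕ G) ≐ E m i p F ⊕ E m i p G
E-⊕ zero    i 0 F G V = refl
E-⊕ zero    i 1 F G V = refl
E-⊕ zero    i 2 F G V = refl
E-⊕ zero    i (suc (suc (suc _))) F G V = refl
E-⊕ (suc m) i zero    F G V = refl
E-⊕ (suc m) i (suc p) F G V = trans
  (cong₂ _+_ (E-⊕ m (suc i) (suc p) F G V) (trans (u-cong i (E-⊕ m (suc i) p F G) V) (u-⊕ i _ _ V)))
  (interchange (E m (suc i) (suc p) F V) _ _ _)

E-𝟘 : ∀ m i p → E m i p 𝟘 ≐ 𝟘
E-𝟘 zero    i 0 V = refl
E-𝟘 zero    i 1 V = refl
E-𝟘 zero    i 2 V = refl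
E-𝟘 zero    i (suc (suc (suc _))) V = refl
E-𝟘 (suc m) i zero    V = refl
E-𝟘 (suc m) i (suc p) V = cong₂ _+_ (E-𝟘 m (suc i) (suc p) V) (trans (u-cong i (E-𝟘 m (suc i) p) V) (u-𝟘 i V))

E-zero : ∀ m i F → E m i 0 F ≐ 𝟘
E-zero zero    i F V = refl
E-zero (suc m) i F V = refl

E-one : ∀ m i F → E m i 1 F ≐ 𝟘
E-one zero    i F V = refl
E-one (suc m) i F V = cong₂ _+_ (E-one m (suc i) F V) (trans (u-cong i (E-zero m (suc i) F) V) (u-𝟘 i V))

E-u : ∀ m k j p F → E m (2 + (k + j)) p (u k F) ≐ u k (E m (2 + (k + j)) p F)
E-u zero k j 0 F V = sym (u-𝟘 k V)
E-u zero k j 1 F V = sym (u-𝟘 k V)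
E-u zero k j 2 F V = refl
E-u zero k j (suc (suc (suc _))) F V = sym (u-𝟘 k V)
E-u (suc m) k j zero    F V = sym (u-𝟘 k V)
E-u (suc m) k j (suc p) F V = trans
  (cong₂ _+_ (step (suc p) V) (trans (u-cong (2 + (k + j)) (step p) V) (sym (u-far k j _ V))))
  (sym (u-⊕ k _ _ V))
  where
  step : ∀ p → E m (3 + (k + j)) p (u k F) ≐ u k (E m (3 + (k + j)) p F)
  step p = subst (λ z → E m (2 + z) p (u k F) ≐ u k (E m (2 + z) p F)) (+-suc k j) (E-u m k (suc j) p F)

-- The commutation relation between u i and the operators E m (i+1) behind the Fomin–Stanley lemma,
-- with all terms moved to the side where they are positive.
record Exchange (m i : ℕ) : Set where
  field
    δ δ′   : Fun → Fun
    δ-cong : ∀ {F G} → F ≐ G → δ F ≐ δ G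
    δ′-cong : ∀ {F G} → F ≐ G → δ′ F ≐ δ′ G
    law    : ∀ q X V →
      (E m (suc i) (2 + q) (u i X) V + u i (E m (suc i) (1 + q) (u i X)) V) + δ (E m (suc i) (1 + q) X) V
      ≡ u i (E m (suc i) (2 + q) X) V + δ′ (E m (suc i) (1 + q) X) V

E-u′ : ∀ m i q X → E m (2 + i) q (u i X) ≐ u i (E m (2 + i) q X)
E-u′ m i q X = subst (λ z → E m (2 + z) q (u i X) ≐ u i (E m (2 + z) q X)) (+-identityʳ i) (E-u m i 0 q X)

-- Let a and b be the generators i and i+1. Splitting off b leaves `E′`, which commutes with a; the
-- rest follows from a² = b² = 0 and aba = bab. The corrections `δ` and `δ′` are the two products of
-- a and b, and are zero when m = 0, where b does not occur.
exchange : ∀ m i → Exchange m i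
exchange zero i = record
  { δ = λ _ → 𝟘 ; δ′ = λ _ → 𝟘 ; δ-cong = λ _ _ → refl ; δ′-cong = λ _ _ → refl ; law = law }
  where
  law : ∀ q X V → (E zero (suc i) (2 + q) (u i X) V + u i (E zero (suc i) (1 + q) (u i X)) V) + 0
                  ≡ u i (E zero (suc i) (2 + q) X) V + 0
  law zero          X V = cong (_+ 0) (trans (cong (u i X V +_) (u-𝟘 i V)) (+-identityʳ _))
  law (suc zero)    X V = cong (_+ 0) (trans (u-square i X V) (sym (u-𝟘 i V)))
  law (suc (suc q)) X V = refl
exchange (suc m) i = record
  { δ = u i ∘ u (suc i) ; δ′ = u (suc i) ∘ u i
  ; δ-cong = λ h → u-cong i (u-cong (suc i) h) ; δ′-cong = λ h → u-cong (suc i) (u-cong i h) ; law = law }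
  where
  a b : Fun → Fun
  a = u i
  b = u (suc i)
  A E′ : ℕ → Fun → Fun
  A  = E (suc m) (suc i)
  E′ = E m (2 + i)
  law : ∀ q X V → (A (2 + q) (a X) V + a (A (1 + q) (a X)) V) + a (b (A (1 + q) X)) V
                  ≡ a (A (2 + q) X) V + b (a (A (1 + q) X)) V
  law q X V = begin
    (A (2 + q) (a X) V + a (A (1 + q) (a X)) V) + a (b (A (1 + q) X)) V
      ≡⟨ cong₂ _+_ (cong₂ _+_ first second) third ⟩
    ((a (E′ (2 + q) X) V + b (a (E′ (1 + q) X)) V) + b (a (b (E′ q X))) V) + a (b (E′ (1 + q) X)) V
      ≡⟨ rearrange (a (E′ (2 + q) X) V) _ _ _ ⟩
    (a (E′ (2 + q) X) V + a (b (E′ (1 + q) X)) V) + (b (a (E′ (1 + q) X)) V + b (a (b (E′ q X))) V)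
      ≡⟨ cong₂ _+_ (u-⊕ i _ _ V) (trans (u-cong (suc i) (u-⊕ i _ _) V) (u-⊕ (suc i) _ _ V)) ⟨
    a (A (2 + q) X) V + b (a (A (1 + q) X)) V ∎
    where
    open ≡-Reasoning
    rearrange : ∀ x y z t → ((x + y) + z) + t ≡ (x + t) + (y + z)
    rearrange = ℕ-Solver.solve-∀
    first : A (2 + q) (a X) V ≡ a (E′ (2 + q) X) V + b (a (E′ (1 + q) X)) V
    first = cong₂ _+_ (E-u′ m i (2 + q) X V) (u-cong (suc i) (E-u′ m i (1 + q) X) V)
    second : a (A (1 + q) (a X)) V ≡ b (a (b (E′ q X))) V
    second = begin
      a (A (1 + q) (a X)) V                                  ≡⟨ u-⊕ i _ _ V ⟩
      a (E′ (1 + q) (a X)) V + a (b (E′ q (a X))) V          ≡⟨ cong₂ _+_ (u-cong i (E-u′ m i (1 + q) X) V) (u-cong i (u-cong (suc i) (E-u′ m i q X)) V) ⟩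
      a (a (E′ (1 + q) X)) V + a (b (a (E′ q X))) V          ≡⟨ cong₂ _+_ (u-square i _ V) (u-braid i _ V) ⟩
      b (a (b (E′ q X))) V                                   ∎
    third : a (b (A (1 + q) X)) V ≡ a (b (E′ (1 + q) X)) V
    third = begin
      a (b (A (1 + q) X)) V                                  ≡⟨ u-cong i (u-⊕ (suc i) _ _) V ⟩
      a (b (E′ (1 + q) X) ⊕ b (b (E′ q X))) V                ≡⟨ u-cong i (λ v → trans (cong (b (E′ (1 + q) X) v +_) (u-square (suc i) _ v)) (+-identityʳ _)) V ⟩
      a (b (E′ (1 + q) X)) V                                 ∎

-- Induction on m. In the expansion only the terms with a factor `u i` inside the outer operator are
-- not of a symmetric shape. `law` rewrites them at the cost of D, which is itself symmetric by
-- induction and can be cancelled.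
E-comm : ∀ m i p q F → E m i q (E m i p F) ≐ E m i p (E m i q F)
E-comm m i zero q F V = trans (trans (E-cong m i q (E-zero m i F) V) (E-𝟘 m i q V)) (sym (E-zero m i _ V))
E-comm m i (suc zero) q F V = trans (trans (E-cong m i q (E-one m i F) V) (E-𝟘 m i q V)) (sym (E-one m i _ V))
E-comm m i p@(suc (suc _)) zero F V = trans (E-zero m i _ V) (sym (trans (E-cong m i p (E-zero m i F) V) (E-𝟘 m i p V)))
E-comm m i p@(suc (suc _)) (suc zero) F V = trans (E-one m i _ V) (sym (trans (E-cong m i p (E-one m i F) V) (E-𝟘 m i p V)))
E-comm zero i 2 2 F V = refl
E-comm zero i 2 (suc (suc (suc q))) F V = refl
E-comm zero i (suc (suc (suc p))) 2 F V = refl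
E-comm zero i (suc (suc (suc p))) (suc (suc (suc q))) F V = refl
E-comm (suc m) i (suc (suc p)) (suc (suc q)) F V = +-cancelʳ-≡ D _ _ (begin
  E (suc m) i (2 + q) (E (suc m) i (2 + p) F) V + D  ≡⟨ expand p q ⟩
  S p q                                              ≡⟨ symmetric ⟩
  S q p                                              ≡⟨ expand q p ⟨
  E (suc m) i (2 + p) (E (suc m) i (2 + q) F) V + δ (A (1 + p) (A (1 + q) F)) V
                                                     ≡⟨ cong (E (suc m) i (2 + p) (E (suc m) i (2 + q) F) V +_) (δ-cong (E-comm m (suc i) (1 + q) (1 + p) F) V) ⟩
  E (suc m) i (2 + p) (E (suc m) i (2 + q) F) V + D  ∎)
  where
  open ≡-Reasoning
  open Exchange (exchange m i)
  a : Fun → Fun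
  a = u i
  A : ℕ → Fun → Fun
  A = E m (suc i)
  D : ℕ
  D = δ (A (1 + q) (A (1 + p) F)) V
  S : ℕ → ℕ → ℕ
  S p q = (A (2 + q) (A (2 + p) F) V + (a (A (2 + q) (A (1 + p) F)) V + a (A (1 + q) (A (2 + p) F)) V))
          + δ′ (A (1 + q) (A (1 + p) F)) V
  symmetric : S p q ≡ S q p
  symmetric = cong₂ _+_
    (cong₂ _+_ (E-comm m (suc i) (2 + p) (2 + q) F V)
      (trans (+-comm (a (A (2 + q) (A (1 + p) F)) V) _)
        (cong₂ _+_ (u-cong i (E-comm m (suc i) (2 + p) (1 + q) F) V) (u-cong i (E-comm m (suc i) (1 + p) (2 + q) F) V))))
    (δ′-cong (E-comm m (suc i) (1 + p) (1 + q) F) V)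
  regroup : ∀ x y z t d → ((x + y) + (z + t)) + d ≡ (x + z) + ((y + t) + d)
  regroup = ℕ-Solver.solve-∀
  regroup′ : ∀ x y z d → (x + y) + (z + d) ≡ (x + (z + y)) + d
  regroup′ = ℕ-Solver.solve-∀
  expand : ∀ p q → E (suc m) i (2 + q) (E (suc m) i (2 + p) F) V + δ (A (1 + q) (A (1 + p) F)) V ≡ S p q
  expand p q = begin
    (A (2 + q) (A (2 + p) F ⊕ a X) V + a (A (1 + q) (A (2 + p) F ⊕ a X)) V) + δ (A (1 + q) X) V
      ≡⟨ cong (_+ δ (A (1 + q) X) V) (cong₂ _+_ (E-⊕ m (suc i) (2 + q) _ _ V) (trans (u-cong i (E-⊕ m (suc i) (1 + q) _ _) V) (u-⊕ i _ _ V))) ⟩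
    ((A (2 + q) (A (2 + p) F) V + A (2 + q) (a X) V) + (a (A (1 + q) (A (2 + p) F)) V + a (A (1 + q) (a X)) V)) + δ (A (1 + q) X) V
      ≡⟨ regroup (A (2 + q) (A (2 + p) F) V) _ _ _ _ ⟩
    (A (2 + q) (A (2 + p) F) V + a (A (1 + q) (A (2 + p) F)) V) + ((A (2 + q) (a X) V + a (A (1 + q) (a X)) V) + δ (A (1 + q) X) V)
      ≡⟨ cong ((A (2 + q) (A (2 + p) F) V + a (A (1 + q) (A (2 + p) F)) V) +_) (law q X V) ⟩
    (A (2 + q) (A (2 + p) F) V + a (A (1 + q) (A (2 + p) F)) V) + (a (A (2 + q) X) V + δ′ (A (1 + q) X) V)
      ≡⟨ regroup′ (A (2 + q) (A (2 + p) F) V) _ _ _ ⟩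
    S p q ∎
    where
    X : Fun
    X = A (1 + p) F

-- A coefficient of the product A_i(x)A_{i+1}(y) of two neighbouring factors.
H : ℕ → ℕ → ℕ → ℕ → Fun → Fun
H m i p q F = E m (suc i) q (E (suc m) i p F)

-- The symmetry of A_i(x)A_i(y), with its second factor unfolded as A_{i+1}(y)(1 + y u_i).
H-exchange : ∀ m i p q F → H m i (suc p) (suc q) F ⊕ u i (H m i (suc p) q F) ≐ H m i (suc q) (suc p) F ⊕ u i (H m i (suc q) p F)
H-exchange m i p q F = E-comm (suc m) i (suc p) (suc q) F

-- Multiplying `H-exchange` by `u i` once more kills the terms that already end in it.
u-H-comm : ∀ m i p q F → u i (H m i p q F) ≐ u i (H m i q p F)
u-H-comm m i zero zero F V = refl
u-H-comm m i zero (suc q) F V = u-cong i (λ v → trans (E-𝟘 m (suc i) (suc q) v) (sym (E-zero m (suc i) _ v))) V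
u-H-comm m i (suc p) zero F V = u-cong i (λ v → trans (E-zero m (suc i) _ v) (sym (E-𝟘 m (suc i) (suc p) v))) V
u-H-comm m i (suc p) (suc q) F V = trans (sym (absorb p q)) (trans (u-cong i (H-exchange m i p q F) V) (absorb q p))
  where
  absorb : ∀ p q → u i (H m i (suc p) (suc q) F ⊕ u i (H m i (suc p) q F)) V ≡ u i (H m i (suc p) (suc q) F) V
  absorb p q = trans (u-⊕ i _ _ V) (trans (cong (u i (H m i (suc p) (suc q) F) V +_) (u-square i _ V)) (+-identityʳ _))

-- Generating all factorizations

-- Factorizations into blocks i, …, i+m-1 of sizes e, block j having letters with 0-based index ≥ j.
B : ∀ m → ℕ → Vec ℕ m → Fun → Fun
B zero    i []      F = F
B (suc m) i (p ∷ e) F = B m (suc i) e (E m i (2 + p) F)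

B-cong : ∀ m i e {F G} → F ≐ G → B m i e F ≐ B m i e G
B-cong zero    i []      h = h
B-cong (suc m) i (p ∷ e) h = B-cong m (suc i) e (E-cong m i (2 + p) h)

B-⊕ : ∀ m i e F G → B m i e (F ⊕ G) ≐ B m i e F ⊕ B m i e G
B-⊕ zero    i []      F G V = refl
B-⊕ (suc m) i (p ∷ e) F G V = trans (B-cong m (suc i) e (E-⊕ m i (2 + p) F G) V) (B-⊕ m (suc i) e _ _ V)

B-𝟘 : ∀ m i e → B m i e 𝟘 ≐ 𝟘
B-𝟘 zero    i []      V = refl
B-𝟘 (suc m) i (p ∷ e) V = trans (B-cong m (suc i) e (E-𝟘 m i (2 + p)) V) (B-𝟘 m (suc i) e V)

B-u : ∀ m k j e F → B m (2 + (k + j)) e (u k F) ≐ u k (B m (2 + (k + j)) e F)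
B-u zero    k j []      F V = refl
B-u (suc m) k j (p ∷ e) F V = trans (B-cong m (3 + (k + j)) e (E-u m k j (2 + p) F) V)
  (subst (λ z → ∀ G → B m (2 + z) e (u k G) ≐ u k (B m (2 + z) e G)) (+-suc k j) (B-u m k (suc j) e) _ V)

B-u′ : ∀ m i e F → B m (2 + i) e (u i F) ≐ u i (B m (2 + i) e F)
B-u′ m i e F = subst (λ z → B m (2 + z) e (u i F) ≐ u i (B m (2 + z) e F)) (+-identityʳ i) (B-u m i 0 e F)

-- Division of a monomial by a variable; `nothing` stands for a coefficient that is zero.
lowerE : ∀ {m} → ℕ → Vec ℕ m → Maybe (Vec ℕ m)
lowerE j       []          = nothing
lowerE zero    (zero ∷ e)  = nothing
lowerE zero    (suc p ∷ e) = just (p ∷ e)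
lowerE (suc j) (p ∷ e)     = Maybe.map (p ∷_) (lowerE j e)

swapE : ∀ {m} → ℕ → Vec ℕ m → Vec ℕ m
swapE zero    (p ∷ q ∷ e) = q ∷ p ∷ e
swapE zero    e           = e
swapE (suc j) []          = []
swapE (suc j) (p ∷ e)     = p ∷ swapE j e

BM : ∀ m → ℕ → Maybe (Vec ℕ m) → Fun → Fun
BM m i (just e) F = B m i e F
BM m i nothing  F = 𝟘

BM-∷ : ∀ m i p x F → BM (suc m) i (Maybe.map (p ∷_) x) F ≐ BM m (suc i) x (E m i (2 + p) F)
BM-∷ m i p (just e) F V = refl
BM-∷ m i p nothing  F V = refl

-- The divided difference relation, with both negative terms moved to the other side.
B-exchange : ∀ m i j e F → suc j < m →
  B m i e F ⊕ u (i + j) (BM m i (lowerE (suc j) e) F) ≐ B m i (swapE j e) F ⊕ u (i + j) (BM m i (lowerE j e) F)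
B-exchange (suc m) i (suc j) (p ∷ e) F (s≤s lt) V = begin
  B m (suc i) e G V + u (i + suc j) (BM (suc m) i (Maybe.map (p ∷_) (lowerE (suc j) e)) F) V
    ≡⟨ cong (B m (suc i) e G V +_) (shift (lowerE (suc j) e)) ⟩
  B m (suc i) e G V + u (suc i + j) (BM m (suc i) (lowerE (suc j) e) G) V
    ≡⟨ B-exchange m (suc i) j e G lt V ⟩
  B m (suc i) (swapE j e) G V + u (suc i + j) (BM m (suc i) (lowerE j e) G) V
    ≡⟨ cong (B m (suc i) (swapE j e) G V +_) (shift (lowerE j e)) ⟨
  B m (suc i) (swapE j e) G V + u (i + suc j) (BM (suc m) i (Maybe.map (p ∷_) (lowerE j e)) F) V ∎
  where
  open ≡-Reasoning
  G : Fun
  G = E m i (2 + p) F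
  shift : ∀ x → u (i + suc j) (BM (suc m) i (Maybe.map (p ∷_) x) F) V ≡ u (suc i + j) (BM m (suc i) x G) V
  shift x = trans (u-cong (i + suc j) (BM-∷ m i p x F) V) (cong (λ z → u z (BM m (suc i) x G) V) (+-suc i j))
B-exchange (suc zero) i zero e F (s≤s ())
B-exchange (suc (suc m)) i zero (p ∷ q ∷ e) F lt V = begin
  K (H m i (2 + p) (2 + q) F) V + u (i + 0) (BM (2 + m) i (lowerE 1 (p ∷ q ∷ e)) F) V
    ≡⟨ cong (K (H m i (2 + p) (2 + q) F) V +_) (trans (cong (λ z → u z (BM (2 + m) i (lowerE 1 (p ∷ q ∷ e)) F) V) (+-identityʳ i)) (second q)) ⟩
  K (H m i (2 + p) (2 + q) F) V + K (u i (H m i (2 + p) (1 + q) F)) V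
    ≡⟨ B-⊕ m (2 + i) e _ _ V ⟨
  K (H m i (2 + p) (2 + q) F ⊕ u i (H m i (2 + p) (1 + q) F)) V
    -- `H-exchange` leaves the last term with q on block i and the lowered p on block i+1;
    -- `u-H-comm` exchanges them.
    ≡⟨ B-cong m (2 + i) e (λ v → trans (H-exchange m i (1 + p) (1 + q) F v) (cong (H m i (2 + q) (2 + p) F v +_) (u-H-comm m i (2 + q) (1 + p) F v))) V ⟩
  K (H m i (2 + q) (2 + p) F ⊕ u i (H m i (1 + p) (2 + q) F)) V
    ≡⟨ B-⊕ m (2 + i) e _ _ V ⟩
  K (H m i (2 + q) (2 + p) F) V + K (u i (H m i (1 + p) (2 + q) F)) V
    ≡⟨ cong (K (H m i (2 + q) (2 + p) F) V +_) (trans (cong (λ z → u z (BM (2 + m) i (lowerE 0 (p ∷ q ∷ e)) F) V) (+-identityʳ i)) (first p)) ⟨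
  K (H m i (2 + q) (2 + p) F) V + u (i + 0) (BM (2 + m) i (lowerE 0 (p ∷ q ∷ e)) F) V ∎
  where
  open ≡-Reasoning
  K : Fun → Fun
  K = B m (2 + i) e
  -- Exponent zero: `lowerE` gives `nothing`, in agreement with the vanishing of `E` at index 1.
  vanish : ∀ G → G ≐ 𝟘 → u i 𝟘 V ≡ K (u i G) V
  vanish G h = trans (u-𝟘 i V) (sym (trans (B-cong m (2 + i) e (λ v → trans (u-cong i h v) (u-𝟘 i v)) V) (B-𝟘 m (2 + i) e V)))
  second : ∀ q → u i (BM (2 + m) i (lowerE 1 (p ∷ q ∷ e)) F) V ≡ K (u i (H m i (2 + p) (1 + q) F)) V
  second zero    = vanish _ (E-one m (suc i) _)
  second (suc q) = sym (B-u′ m i e _ V)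
  first : ∀ p → u i (BM (2 + m) i (lowerE 0 (p ∷ q ∷ e)) F) V ≡ K (u i (H m i (1 + p) (2 + q) F)) V
  first zero    = vanish _ λ v → trans (E-cong m (suc i) (2 + q) (E-one (suc m) i F) v) (E-𝟘 m (suc i) (2 + q) v)
  first (suc p) = sym (B-u′ m i e _ V)

E-∷ : ∀ m i p F x V → E m (suc i) p F (x ∷ V) ≡ E m i p (F ∘ (x ∷_)) V
E-∷ zero    i 0 F x V = refl
E-∷ zero    i 1 F x V = refl
E-∷ zero    i 2 F x V = refl
E-∷ zero    i (suc (suc (suc _))) F x V = refl
E-∷ (suc m) i zero    F x V = refl
E-∷ (suc m) i (suc p) F x V = cong₂ _+_ (E-∷ m (suc i) (suc p) F x V)
  (trans (u-∷ i _ x V) (u-cong i (E-∷ m (suc i) p F x) V))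

B-∷ : ∀ m i e F x V → B m (suc i) e F (x ∷ V) ≡ B m i e (F ∘ (x ∷_)) V
B-∷ zero    i []      F x V = refl
B-∷ (suc m) i (p ∷ e) F x V = trans (B-∷ m (suc i) e _ x V) (B-cong m (suc i) e (E-∷ m i (2 + p) F x) V)

E-large : ∀ m i p F → m < p → E m i (2 + p) F ≐ 𝟘
E-large zero    i (suc p) F lt V = refl
E-large (suc m) i (suc p) F (s≤s lt) V = cong₂ _+_ (E-large m (suc i) (suc p) F (m≤n⇒m≤1+n lt) V)
  (trans (u-cong i (E-large m (suc i) p F lt) V) (u-𝟘 i V))

-- Only the product of all the generators has that many factors, and it carries x past every entry;
-- each step is a descent because x is the maximum.
E-full : ∀ x Y F → All (_< x) Y → E (length Y) 0 (2 + length Y) F (x ∷ Y) ≡ F (Y ++ x ∷ [])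
E-full x []      F []      = refl
E-full x (y ∷ Y) F (p ∷ ps) = begin
  E m 1 (3 + m) F (x ∷ y ∷ Y) + u 0 (E m 1 (2 + m) F) (x ∷ y ∷ Y)
    ≡⟨ cong₂ _+_ (E-large m 1 (suc m) F ≤-refl (x ∷ y ∷ Y)) (u-desc 0 _ (x ∷ y ∷ Y) (dec-true (y <? x) p)) ⟩
  E m 1 (2 + m) F (y ∷ x ∷ Y)            ≡⟨ E-∷ m 0 (2 + m) F y (x ∷ Y) ⟩
  E m 0 (2 + m) (F ∘ (y ∷_)) (x ∷ Y)     ≡⟨ E-full x Y (F ∘ (y ∷_)) ps ⟩
  F (y ∷ Y ++ x ∷ [])                    ∎
  where
  open ≡-Reasoning
  m : ℕ
  m = length Y

stairs : ∀ m → Vec ℕ m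
stairs zero    = []
stairs (suc m) = m ∷ stairs m

-- The later blocks reverse the tail, and the first block, which is full, carries the maximum to the
-- end.
B-stairs : ∀ V F → Desc V → B (length V) 0 (stairs (length V)) F V ≡ F (reverse V)
B-stairs []      F []      = refl
B-stairs (x ∷ V) F (p ∷ d) = begin
  B m 1 (stairs m) (E m 0 (2 + m) F) (x ∷ V)            ≡⟨ B-∷ m 0 (stairs m) _ x V ⟩
  B m 0 (stairs m) (E m 0 (2 + m) F ∘ (x ∷_)) V         ≡⟨ B-stairs V _ d ⟩
  E m 0 (2 + m) F (x ∷ reverse V)                       ≡⟨ cong (λ z → E z 0 (2 + z) F (x ∷ reverse V)) (length-reverse V) ⟨
  E (length (reverse V)) 0 (2 + length (reverse V)) F (x ∷ reverse V) ≡⟨ E-full x (reverse V) F (All-resp-↭ (↭-sym (↭-reverse V)) p) ⟩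
  F (reverse V ++ x ∷ [])                               ≡⟨ cong F (unfold-reverse x V) ⟨
  F (reverse (x ∷ V))                                   ∎
  where
  open ≡-Reasoning
  m : ℕ
  m = length V

-- Homogeneity of degree k in the length grading of the nilCoxeter algebra.
SupportedOn : ℕ → Fun → Set
SupportedOn k F = ∀ V → invL V ≢ k → F V ≡ 0

u-supported : ∀ {k} i {F} → SupportedOn k F → SupportedOn (suc k) (u i F)
u-supported i {F} s V ne with isDesc i V in d
... | true  = trans (u-desc i F V d) (s (swapL i V) λ e → ne (trans (invL-desc i V d) (cong suc e)))
... | false = u-nodesc i F V d

E-supported : ∀ {k} m i p {F} → SupportedOn k F → SupportedOn (p + k) (E m i (2 + p) F)
E-supported zero    i zero    s = s
E-supported zero    i (suc p) s V ne = refl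
E-supported (suc m) i zero {F} s V ne = cong₂ _+_ (E-supported m (suc i) zero s V ne) (trans (u-cong i (E-one m (suc i) F) V) (u-𝟘 i V))
E-supported (suc m) i (suc p) s V ne = cong₂ _+_ (E-supported m (suc i) (suc p) s V ne) (u-supported i (E-supported m (suc i) p s) V ne)

B-supported : ∀ {k} m i e {F} → SupportedOn k F → SupportedOn (Vec.sum e + k) (B m i e F)
B-supported zero    i []      s = s
B-supported {k} (suc m) i (p ∷ e) {F} s = subst (λ z → SupportedOn z (B (suc m) i (p ∷ e) F))
  (trans (sym (+-assoc (Vec.sum e) p k)) (cong (_+ k) (+-comm (Vec.sum e) p)))
  (B-supported m (suc i) e (E-supported m i p s))

-- A nonzero term needs every block to fit into its stair. With a total at least that of the
-- staircase, this forces equality everywhere.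
B-vanish : ∀ m i e F → Vec.sum (stairs m) ≤ Vec.sum e → e ≢ stairs m → B m i e F ≐ 𝟘
B-vanish zero    i []      F le ne V = ⊥-elim (ne refl)
B-vanish (suc m) i (p ∷ e) F le ne V with p ≤? m
... | no p≰m = trans (B-cong m (suc i) e (E-large m i p F (≰⇒> p≰m)) V) (B-𝟘 m (suc i) e V)
... | yes p≤m with Vec.≡-dec _≟_ e (stairs m)
...   | no e≢   = B-vanish m (suc i) e _ (+-cancelˡ-≤ p _ _ (≤-trans (+-monoˡ-≤ (Vec.sum (stairs m)) p≤m) le)) e≢ V
...   | yes refl = ⊥-elim (ne (cong (_∷ stairs m) (≤-antisym p≤m (+-cancelʳ-≤ (Vec.sum (stairs m)) m p le))))

invL-desc-list : ∀ {V} → Desc V → invL V ≡ Vec.sum (stairs (length V))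
invL-desc-list []      = refl
invL-desc-list {x ∷ V} (p ∷ d) = cong₂ _+_ (cong length (filter-all (_<? x) p)) (invL-desc-list d)

identity : ℕ → Fun
identity n V = if does (List.≡-dec _≟_ V (upTo n)) then 1 else 0

identity-supported : ∀ n → SupportedOn 0 (identity n)
identity-supported n V ne = cong (if_then 1 else 0)
  (dec-false (List.≡-dec _≟_ V (upTo n)) λ e → ne (trans (cong invL e) (invL-upTo n)))

-- The number of reduced factorizations with cutoff and block sizes e of the permutation V.
N : ∀ n → Vec ℕ n → Fun
N n e = B n 0 e (identity n)

N-exchange : ∀ {n} j e V → suc j < n → isDesc j V ≡ true →
  N n e V + maybe′ (λ f → N n f (swapL j V)) 0 (lowerE (suc j) e)
  ≡ N n (swapE j e) V + maybe′ (λ f → N n f (swapL j V)) 0 (lowerE j e)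
N-exchange {n} j e V lt d = begin
  N n e V + maybe′ (λ f → N n f (swapL j V)) 0 (lowerE (suc j) e)  ≡⟨ cong (N n e V +_) (apply (lowerE (suc j) e)) ⟨
  N n e V + u j (BM n 0 (lowerE (suc j) e) (identity n)) V         ≡⟨ B-exchange n 0 j e (identity n) lt V ⟩
  N n (swapE j e) V + u j (BM n 0 (lowerE j e) (identity n)) V     ≡⟨ cong (N n (swapE j e) V +_) (apply (lowerE j e)) ⟩
  N n (swapE j e) V + maybe′ (λ f → N n f (swapL j V)) 0 (lowerE j e) ∎
  where
  open ≡-Reasoning
  apply : ∀ x → u j (BM n 0 x (identity n)) V ≡ maybe′ (λ f → N n f (swapL j V)) 0 x
  apply (just f) = u-desc j _ V d
  apply nothing  = u-𝟘 j V

-- The length grading fixes the total of e, and `B-vanish` then leaves the staircase alone.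
N-longest : ∀ {n} e V → Desc V → reverse V ≡ upTo n → N n e V ≡ (if does (Vec.≡-dec _≟_ (stairs n) e) then 1 else 0)
N-longest {n} e V d r with refl ← trans (sym (length-upTo n)) (trans (cong length (sym r)) (length-reverse V)) with Vec.≡-dec _≟_ (stairs (length V)) e
... | yes refl = trans (B-stairs V (identity (length V)) d) (cong (if_then 1 else 0) (dec-true (List.≡-dec _≟_ (reverse V) (upTo (length V))) r))
... | no e≢ with Vec.sum e ≟ invL V
...   | no ne  = B-supported (length V) 0 e (identity-supported (length V)) V λ eq → ne (sym (trans eq (+-identityʳ _)))
...   | yes eq = B-vanish (length V) 0 e (identity (length V)) (≤-reflexive (sym (trans eq (invL-desc-list d)))) (e≢ ∘ sym) V

-- Counting reduced factorizations

-- Letters are 1-based and indices of `u` are 0-based, whence `pred`. The first letter acts first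
-- because `u` multiplies on the right.
uw : List ℕ → Fun → Fun
uw []      F = F
uw (a ∷ W) F = uw W (u (pred a) F)

uw-++ : ∀ W W′ F → uw (W ++ W′) F ≡ uw W′ (uw W F)
uw-++ []      W′ F = refl
uw-++ (a ∷ W) W′ F = uw-++ W W′ (u (pred a) F)

uw-cong : ∀ W {F G} → F ≐ G → uw W F ≐ uw W G
uw-cong []      h = h
uw-cong (a ∷ W) h = uw-cong W (u-cong (pred a) h)

uw-𝟘 : ∀ W → uw W 𝟘 ≐ 𝟘
uw-𝟘 []      V = refl
uw-𝟘 (a ∷ W) V = trans (uw-cong W (u-𝟘 (pred a)) V) (uw-𝟘 W V)

uw-⊕ : ∀ W F G → uw W (F ⊕ G) ≐ uw W F ⊕ uw W G
uw-⊕ []      F G V = refl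
uw-⊕ (a ∷ W) F G V = trans (uw-cong W (u-⊕ (pred a) F G) V) (uw-⊕ W _ _ V)

uw-sum : ∀ {A : Set} W (G : A → Fun) xs → uw W (λ V → sum (map (λ x → G x V) xs)) ≐ λ V → sum (map (λ x → uw W (G x) V) xs)
uw-sum W G []       V = uw-𝟘 W V
uw-sum W G (x ∷ xs) V = trans (uw-⊕ W (G x) _ V) (cong (uw W (G x) V +_) (uw-sum W G xs V))

u-sum : ∀ {A : Set} k (G : A → Fun) xs → u k (λ V → sum (map (λ x → G x V) xs)) ≐ λ V → sum (map (λ x → u k (G x) V) xs)
u-sum k G = uw-sum (suc k ∷ []) G

-- `blocks` and `facts` copy the recursions of `E` and `B`, so that the operators expand term by
-- term.
blocks : ℕ → ℕ → ℕ → List (List ℕ)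
blocks zero    i zero    = [] ∷ []
blocks zero    i (suc p) = []
blocks (suc m) i zero    = blocks m (suc i) zero
blocks (suc m) i (suc p) = blocks m (suc i) (suc p) ++ map (_∷ʳ suc i) (blocks m (suc i) p)

facts : ∀ m → ℕ → Vec ℕ m → List Fact
facts zero    i []      = [] ∷ []
facts (suc m) i (p ∷ e) = cartesianProductWith (λ r b → b ∷ r) (facts m (suc i) e) (blocks m i p)

E-expand : ∀ m i p F V → E m i (2 + p) F V ≡ sum (map (λ b → uw b F V) (blocks m i p))
E-expand zero    i zero    F V = sym (+-identityʳ (F V))
E-expand zero    i (suc p) F V = refl
E-expand (suc m) i zero    F V = trans (cong (E m (suc i) 2 F V +_) (trans (u-cong i (E-one m (suc i) F) V) (u-𝟘 i V)))
  (trans (+-identityʳ _) (E-expand m (suc i) zero F V))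
E-expand (suc m) i (suc p) F V = begin
  E m (suc i) (3 + p) F V + u i (E m (suc i) (2 + p) F) V
    ≡⟨ cong₂ _+_ (E-expand m (suc i) (suc p) F V) (trans (u-cong i (E-expand m (suc i) p F) V) (u-sum i (λ b → uw b F) (blocks m (suc i) p) V)) ⟩
  sum (map (λ b → uw b F V) X) + sum (map (λ b → u i (uw b F) V) Y)
    ≡⟨ cong (λ z → sum (map (λ b → uw b F V) X) + sum z) (trans (map-cong (λ b → cong (λ G → G V) (sym (uw-++ b (suc i ∷ []) F))) Y) (map-∘ Y)) ⟩
  sum (map (λ b → uw b F V) X) + sum (map (λ b → uw b F V) (map (_∷ʳ suc i) Y))
    ≡⟨ sum-++ (map (λ b → uw b F V) X) _ ⟨
  sum (map (λ b → uw b F V) X ++ map (λ b → uw b F V) (map (_∷ʳ suc i) Y))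
    ≡⟨ cong sum (map-++ (λ b → uw b F V) X _) ⟨
  sum (map (λ b → uw b F V) (X ++ map (_∷ʳ suc i) Y)) ∎
  where
  open ≡-Reasoning
  X = blocks m (suc i) (suc p)
  Y = blocks m (suc i) p

sum-product : ∀ {A B C : Set} (f : C → ℕ) (g : A → B → C) xs ys →
  sum (map f (cartesianProductWith g xs ys)) ≡ sum (map (λ x → sum (map (λ y → f (g x y)) ys)) xs)
sum-product f g []       ys = refl
sum-product f g (x ∷ xs) ys = trans (cong sum (map-++ f (map (g x) ys) _)) (trans (sum-++ (map f (map (g x) ys)) _)
  (cong₂ _+_ (cong sum (sym (map-∘ ys))) (sum-product f g xs ys)))

B-expand : ∀ m i e F V → B m i e F V ≡ sum (map (λ r → uw (concat r) F V) (facts m i e))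
B-expand zero    i []      F V = sym (+-identityʳ (F V))
B-expand (suc m) i (p ∷ e) F V = begin
  B m (suc i) e (E m i (2 + p) F) V
    ≡⟨ B-expand m (suc i) e _ V ⟩
  sum (map (λ r → uw (concat r) (E m i (2 + p) F) V) (facts m (suc i) e))
    ≡⟨ cong sum (map-cong (λ r → trans (uw-cong (concat r) (E-expand m i p F) V) (trans (uw-sum (concat r) (λ b → uw b F) (blocks m i p) V)
         (cong sum (map-cong (λ b → cong (λ G → G V) (sym (uw-++ b (concat r) F))) (blocks m i p))))) (facts m (suc i) e)) ⟩
  sum (map (λ r → sum (map (λ b → uw (b ++ concat r) F V) (blocks m i p))) (facts m (suc i) e))
    ≡⟨ sum-product (λ r → uw (concat r) F V) (λ r b → b ∷ r) (facts m (suc i) e) (blocks m i p) ⟨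
  sum (map (λ r → uw (concat r) F V) (facts (suc m) i (p ∷ e))) ∎
  where open ≡-Reasoning

reduced? : ∀ n V W → Dec (Reduced n V W)
reduced? n V W = All.all? (λ x → (1 ≤? x) ×-dec (suc x ≤? n)) W ×-dec (length W ≟ invL V) ×-dec List.≡-dec _≟_ (applyUpTo (act W) n) V

act-snoc : ∀ {n} W k → suc k < n → applyUpTo (act (W ∷ʳ suc k)) n ≡ swapL k (applyUpTo (act W) n)
act-snoc {n} W k lt = trans (applyUpTo-cong n (λ m _ → act-++ W (suc k ∷ []) m)) (swapL-applyUpTo (act W) k n lt)

length-∷ʳ : ∀ W (x : ℕ) → length (W ∷ʳ x) ≡ suc (length W)
length-∷ʳ W x = trans (length-++ W) (+-comm (length W) 1)

-- Were k not a descent, W would be shorter than the number of inversions of its own product.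
reduced-snoc⁻ : ∀ {n V} W k → Reduced n V (W ∷ʳ suc k) → isDesc k V ≡ true × Reduced n (swapL k V) W
reduced-snoc⁻ {n} {V} W k (range , len , e) = cases (isDesc k V) refl
  where
  r : All (InRange n) W
  r = All.++⁻ˡ W range
  lt : suc k < n
  lt = proj₂ (All.head (All.++⁻ʳ W range))
  Y≡ : applyUpTo (act W) n ≡ swapL k V
  Y≡ = trans (sym (swapL-invol k _)) (cong (swapL k) (trans (sym (act-snoc W k lt)) e))
  cases : ∀ d → isDesc k V ≡ d → isDesc k V ≡ true × Reduced n (swapL k V) W
  cases true  d = d , r , suc-injective (trans (sym (length-∷ʳ W (suc k))) (trans len (invL-desc k V d))) , Y≡
  cases false d = ⊥-elim (<-irrefl refl (begin-strict
    invL V                          ≤⟨ invL-nodesc k V d ⟩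
    invL (swapL k V)                ≡⟨ cong invL Y≡ ⟨
    invL (applyUpTo (act W) n)      ≤⟨ invL-word W r ⟩
    length W                        <⟨ ≤-refl ⟩
    suc (length W)                  ≡⟨ trans (sym (length-∷ʳ W (suc k))) len ⟩
    invL V                          ∎))
    where open ≤-Reasoning

reduced-snoc⁺ : ∀ {n V} W k → suc k < n → isDesc k V ≡ true → Reduced n (swapL k V) W → Reduced n V (W ∷ʳ suc k)
reduced-snoc⁺ {n} {V} W k lt d (range , len , e) =
    All.++⁺ range ((s≤s z≤n , lt) ∷ [])
  , trans (length-∷ʳ W (suc k)) (trans (cong suc len) (sym (invL-desc k V d)))
  , trans (act-snoc W k lt) (trans (cong (swapL k) e) (swapL-invol k V))

-- Induction on the last letter, which `u` evaluates first: at a non-descent both sides vanish, at a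
-- descent the letter is stripped from word and list together.
uw-reduced : ∀ {n W} → Reverse W → All (InRange n) W → ∀ V → uw W (identity n) V ≡ (if does (reduced? n V W) then 1 else 0)
uw-reduced {n} [] [] V with List.≡-dec _≟_ V (upTo n)
... | yes V≡ = sym (cong (if_then 1 else 0) (dec-true (reduced? n V []) ([] , sym (trans (cong invL V≡) (invL-upTo n)) , sym V≡)))
... | no V≢  = sym (cong (if_then 1 else 0) (dec-false (reduced? n V []) λ (_ , _ , e) → V≢ (sym e)))
uw-reduced {n} (W ∶ rev ∶ʳ a) range V with All.++⁻ʳ W range
uw-reduced {n} (W ∶ rev ∶ʳ suc k) range V | (_ , lt) ∷ [] = trans (cong (λ G → G V) (uw-++ W (suc k ∷ []) (identity n))) (cases (isDesc k V) refl)
  where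
  step : u k (uw W (identity n)) V ≡ u k (λ V → if does (reduced? n V W) then 1 else 0) V
  step = u-cong k (uw-reduced rev (All.++⁻ˡ W range)) V
  cases : ∀ d → isDesc k V ≡ d → u k (uw W (identity n)) V ≡ (if does (reduced? n V (W ∷ʳ suc k)) then 1 else 0)
  cases false d = trans (u-nodesc k _ V d) (sym (cong (if_then 1 else 0) (dec-false (reduced? n V (W ∷ʳ suc k)) λ red → contra (proj₁ (reduced-snoc⁻ W k red)))))
    where
    contra : isDesc k V ≢ true
    contra d′ with () ← trans (sym d) d′
  cases true d with reduced? n (swapL k V) W in eq
  ... | yes red = trans step (trans (u-desc k _ V d) (trans (cong (λ z → if does z then 1 else 0) eq)
          (sym (cong (if_then 1 else 0) (dec-true (reduced? n V (W ∷ʳ suc k)) (reduced-snoc⁺ W k lt d red))))))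
  ... | no ¬red = trans step (trans (u-desc k _ V d) (trans (cong (λ z → if does z then 1 else 0) eq)
          (sym (cong (if_then 1 else 0) (dec-false (reduced? n V (W ∷ʳ suc k)) (¬red ∘ proj₂ ∘ reduced-snoc⁻ W k))))))

∈-blocks⁻ : ∀ m i p {b} → b ∈ blocks m i p → Desc b × All (λ x → i < x × x ≤ i + m) b × length b ≡ p
∈-blocks⁻ zero    i zero    (here refl) = [] , [] , refl
∈-blocks⁻ (suc m) i zero    b∈ with d , r , l ← ∈-blocks⁻ m (suc i) zero b∈ =
  d , All.map (λ {x} (p , q) → <-trans ≤-refl p , subst (x ≤_) (sym (+-suc i m)) q) r , l
∈-blocks⁻ (suc m) i (suc p) {b} b∈ with ∈-++⁻ (blocks m (suc i) (suc p)) b∈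
... | inj₁ q with d , r , l ← ∈-blocks⁻ m (suc i) (suc p) q =
  d , All.map (λ {x} (p , q) → <-trans ≤-refl p , subst (x ≤_) (sym (+-suc i m)) q) r , l
... | inj₂ q with c , c∈ , refl ← ∈-map⁻ (_∷ʳ suc i) q with d , r , l ← ∈-blocks⁻ m (suc i) p c∈ =
    AllPairs.++⁺ d ([] ∷ []) (All.map (λ (p , _) → p ∷ []) r)
  , All.++⁺ (All.map (λ {x} (p , q) → <-trans ≤-refl p , subst (x ≤_) (sym (+-suc i m)) q) r) ((≤-refl , subst (suc i ≤_) (sym (+-suc i m)) (s≤s (m≤m+n i m))) ∷ [])
  , trans (length-∷ʳ c (suc i)) (cong suc l)

∈-blocks⁺ : ∀ m i {b} → Desc b → All (λ x → i < x × x ≤ i + m) b → b ∈ blocks m i (length b)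
∈-blocks⁺ zero    i [] [] = here refl
∈-blocks⁺ zero    i (_ ∷ _) ((p , q) ∷ _) = ⊥-elim (<⇒≱ p (subst (_ ≤_) (+-identityʳ i) q))
∈-blocks⁺ (suc m) i {b} d r with desc-bottom d (All.map proj₁ r)
... | inj₁ above = grow (length b) (∈-blocks⁺ m (suc i) d (All.zipWith (λ {x} (p , _ , q) → p , subst (x ≤_) (+-suc i m) q) (above , r)))
  where
  grow : ∀ p → b ∈ blocks m (suc i) p → b ∈ blocks (suc m) i p
  grow zero    q = q
  grow (suc p) q = ∈-++⁺ˡ q
... | inj₂ (c , refl) = subst (λ z → c ∷ʳ suc i ∈ blocks (suc m) i z) (sym (length-∷ʳ c (suc i)))
      (∈-++⁺ʳ (blocks m (suc i) (suc (length c))) (∈-map⁺ (_∷ʳ suc i)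
        (∈-blocks⁺ m (suc i) (Desc-++⁻ˡ c d) (All.zipWith (λ {x} (p , _ , q) → p , subst (x ≤_) (+-suc i m) q) (desc-above c d , All.++⁻ˡ c r)))))

blocks-unique : ∀ m i p → Unique (blocks m i p)
blocks-unique zero    i zero    = [] ∷ []
blocks-unique zero    i (suc p) = []
blocks-unique (suc m) i zero    = blocks-unique m (suc i) zero
blocks-unique (suc m) i (suc p) = Unique.++⁺ (blocks-unique m (suc i) (suc p))
  (Unique.map⁺ (λ {x} {y} e → proj₁ (∷ʳ-injective x y e)) (blocks-unique m (suc i) p)) disjoint
  where
  disjoint : ∀ {b} → ¬ (b ∈ blocks m (suc i) (suc p) × b ∈ map (_∷ʳ suc i) (blocks m (suc i) p))
  disjoint (b∈ , b∈′) with c , _ , refl ← ∈-map⁻ (_∷ʳ suc i) b∈′ =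
    <-irrefl refl (proj₁ (All.head (All.++⁻ʳ c (proj₁ (proj₂ (∈-blocks⁻ m (suc i) (suc p) b∈))))))

facts-unique : ∀ m i e → Unique (facts m i e)
facts-unique zero    i []      = [] ∷ []
facts-unique (suc m) i (p ∷ e) = Unique.cartesianProductWith⁺ (λ r b → b ∷ r)
  (λ e → ∷-injectiveʳ e , ∷-injectiveˡ e) (facts-unique m (suc i) e) (blocks-unique m i p)

sizes : ∀ m → Fact → Vec ℕ m
sizes m r = Vec.tabulate (λ k → length (block r (toℕ k)))

-- The letters are 1-based, so block j (0-based) has cutoff j+1.
data Cutoff : ℕ → ℕ → Fact → Set where
  []  : ∀ {i} → Cutoff zero i []
  _∷_ : ∀ {m i b r} → Desc b × All (λ x → i < x × x ≤ i + m) b → Cutoff m (suc i) r → Cutoff (suc m) i (b ∷ r)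

∈-facts⁺ : ∀ {m i r} → Cutoff m i r → r ∈ facts m i (sizes m r)
∈-facts⁺ [] = here refl
∈-facts⁺ {suc m} {i} ((d , a) ∷ c) = ∈-cartesianProductWith⁺ (λ r b → b ∷ r) (∈-facts⁺ c) (∈-blocks⁺ m i d a)

∈-facts⁻ : ∀ {m i e r} → r ∈ facts m i e → Cutoff m i r × sizes m r ≡ e
∈-facts⁻ {zero} {e = []} (here refl) = [] , refl
∈-facts⁻ {suc m} {i} {p ∷ e} r∈
  with r , b , r∈′ , b∈ , refl ← ∈-cartesianProductWith⁻ (λ r b → b ∷ r) (facts m (suc i) e) (blocks m i p) r∈
  with c , s ← ∈-facts⁻ r∈′ | d , a , l ← ∈-blocks⁻ m i p b∈ = (d , a) ∷ c , cong₂ _∷_ l s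

cutoff-range : ∀ {m i r} → Cutoff m i r → All (λ x → i < x × x < i + m) (concat r)
cutoff-range [] = []
cutoff-range {suc m} {i} ((_ , a) ∷ c) = All.++⁺
  (All.map (λ {x} (p , q) → p , subst (x <_) (sym (+-suc i m)) (s≤s q)) a)
  (All.map (λ {x} (p , q) → <-trans ≤-refl p , subst (x <_) (sym (+-suc i m)) q) (cutoff-range c))

N-count : ∀ n e V → N n e V ≡ length (filter (λ r → reduced? n V (concat r)) (facts n 0 e))
N-count n e V = trans (B-expand n 0 e (identity n) V) (trans
  (cong sum (map-cong-local (All.tabulate λ {r} r∈ → uw-reduced (reverseView (concat r)) (cutoff-range (proj₁ (∈-facts⁻ {n} r∈))) V)))
  (sum-indicator (facts n 0 e)))
  where
  sum-indicator : ∀ xs → sum (map (λ r → if does (reduced? n V (concat r)) then 1 else 0) xs) ≡ length (filter (λ r → reduced? n V (concat r)) xs)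
  sum-indicator [] = refl
  sum-indicator (r ∷ xs) with does (reduced? n V (concat r))
  ... | true  = cong suc (sum-indicator xs)
  ... | false = sum-indicator xs

-- Reaching the longest element

-- Acts on places, so that the line of v becomes the line of v times W.
applyW : List ℕ → List ℕ → List ℕ
applyW V []      = V
applyW V (a ∷ W) = applyW (swapL (pred a) V) W

applyW-++ : ∀ V W W′ → applyW V (W ++ W′) ≡ applyW (applyW V W) W′
applyW-++ V []      W′ = refl
applyW-++ V (a ∷ W) W′ = applyW-++ (swapL (pred a) V) W W′

applyW-applyUpTo : ∀ {n} f W → All (InRange n) W → applyW (applyUpTo f n) W ≡ applyUpTo (f ∘ act W) n
applyW-applyUpTo f [] [] = refl
applyW-applyUpTo {n} f (suc k ∷ W) ((_ , lt) ∷ r) =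
  trans (cong (λ z → applyW z W) (sym (swapL-applyUpTo f k n lt))) (applyW-applyUpTo (f ∘ swapℕ (suc k)) W r)

invL-applyW : ∀ V W → invL (applyW V W) ≤ length W + invL V
invL-applyW V []      = ≤-refl
invL-applyW V (a ∷ W) = ≤-trans (invL-applyW (swapL (pred a) V) W)
  (≤-trans (+-monoʳ-≤ (length W) (invL-swapL (pred a) V)) (≤-reflexive (+-suc (length W) (invL V))))

swapL-All : ∀ {P : Pred ℕ 0ℓ} k {V} → All P V → All P (swapL k V)
swapL-All zero    []           = []
swapL-All zero    (p ∷ [])     = p ∷ []
swapL-All zero    (p ∷ q ∷ ps) = q ∷ p ∷ ps
swapL-All (suc k) []           = []
swapL-All (suc k) (p ∷ ps)     = p ∷ swapL-All k ps

applyW-All : ∀ {P : Pred ℕ 0ℓ} W {V} → All P V → All P (applyW V W)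
applyW-All []      p = p
applyW-All (a ∷ W) p = applyW-All W (swapL-All (pred a) p)

length-swapL : ∀ k V → length (swapL k V) ≡ length V
length-swapL zero    []          = refl
length-swapL zero    (x ∷ [])    = refl
length-swapL zero    (x ∷ y ∷ V) = refl
length-swapL (suc k) []          = refl
length-swapL (suc k) (x ∷ V)     = cong suc (length-swapL k V)

length-applyW : ∀ V W → length (applyW V W) ≡ length V
length-applyW V []      = refl
length-applyW V (a ∷ W) = trans (length-applyW (swapL (pred a) V) W) (length-swapL (pred a) V)

below-applyW : ∀ z V W → below z (applyW V W) ≡ below z V
below-applyW z V []      = refl
below-applyW z V (a ∷ W) = trans (below-applyW z (swapL (pred a) V) W) (below-swapL z (pred a) V)

applyW-shift : ∀ {n} x V W → All (InRange n) W → applyW (x ∷ V) (map suc W) ≡ x ∷ applyW V W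
applyW-shift x V []          []       = refl
applyW-shift x V (suc k ∷ W) (_ ∷ rs) = applyW-shift x (swapL k V) W rs

shift-range : ∀ {n W} → All (InRange n) W → All (InRange (suc n)) (map suc W)
shift-range r = All.map⁺ (All.map (λ (p , q) → s≤s z≤n , s≤s q) r)

-- Since a swap adds at most one inversion, `rise` means that every letter of the word adds one.
record Rising (V V′ : List ℕ) : Set where
  field
    word  : List ℕ
    range : All (InRange (length V)) word
    reach : applyW V word ≡ V′
    rise  : length word + invL V ≡ invL V′

rising-∷ : ∀ {V V′} x → Rising V V′ → Rising (x ∷ V) (x ∷ V′)
rising-∷ {V} {V′} x ρ = record
  { word  = map suc word
  ; range = shift-range range
  ; reach = trans (applyW-shift x V word range) (cong (x ∷_) reach)
  ; rise  = begin
      length (map suc word) + (below x V + invL V)  ≡⟨ cong (_+ (below x V + invL V)) (length-map suc word) ⟩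
      length word + (below x V + invL V)            ≡⟨ +-swap (length word) (below x V) (invL V) ⟩
      below x V + (length word + invL V)            ≡⟨ cong₂ _+_ (trans (sym (below-applyW x V word)) (cong (below x) reach)) rise ⟩
      below x V′ + invL V′                          ∎
  }
  where
  open Rising ρ
  open ≡-Reasoning

rising-trans : ∀ {V V′ V″} → length V′ ≡ length V → Rising V V′ → Rising V′ V″ → Rising V V″
rising-trans {V} {V′} {V″} len ρ σ = record
  { word  = ρ.word ++ σ.word
  ; range = All.++⁺ ρ.range (subst (λ z → All (InRange z) σ.word) len σ.range)
  ; reach = trans (applyW-++ V ρ.word σ.word) (trans (cong (λ z → applyW z σ.word) ρ.reach) σ.reach)
  ; rise  = begin
      length (ρ.word ++ σ.word) + invL V             ≡⟨ cong (_+ invL V) (trans (length-++ ρ.word) (+-comm (length ρ.word) (length σ.word))) ⟩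
      length σ.word + length ρ.word + invL V         ≡⟨ +-assoc (length σ.word) (length ρ.word) (invL V) ⟩
      length σ.word + (length ρ.word + invL V)       ≡⟨ cong (length σ.word +_) ρ.rise ⟩
      length σ.word + invL V′                        ≡⟨ σ.rise ⟩
      invL V″                                        ∎
  }
  where
  module ρ = Rising ρ
  module σ = Rising σ
  open ≡-Reasoning

rising-refl : ∀ {V} → Rising V V
rising-refl = record { word = [] ; range = [] ; reach = refl ; rise = refl }

rising-insert : ∀ x {ys} → Desc ys → x ∉ ys → Rising (x ∷ ys) (insertDec x ys)
rising-insert x {[]} _ _ = rising-refl
rising-insert x {y ∷ ys} (p ∷ d) x∉ with y <? x
... | yes y<x = subst (Rising (x ∷ y ∷ ys)) (sym (insertDec-top (y ∷ ys) (y<x ∷ All.map (λ z<y → <-trans z<y y<x) p))) rising-refl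
... | no y≮x  = subst (Rising (x ∷ y ∷ ys)) (sym (insertDec-++ʳ (y ∷ []) ys (x<y ∷ [])))
      (rising-trans refl swap (rising-∷ y (rising-insert x d (x∉ ∘ there))))
  where
  x<y : x < y
  x<y = ≤∧≢⇒< (≮⇒≥ y≮x) (x∉ ∘ here)
  swap : Rising (x ∷ y ∷ ys) (y ∷ x ∷ ys)
  swap = record { word = 1 ∷ [] ; range = (≤-refl , s≤s (s≤s z≤n)) ∷ [] ; reach = refl
                ; rise = sym (invL-desc 0 (y ∷ x ∷ ys) (dec-true (x <? y) x<y)) }

-- Insertion sort into decreasing order by adjacent swaps, each of which creates an inversion.
sorting : ∀ {V} → Unique V → ∃ λ V′ → Desc V′ × Rising V V′
sorting []      = [] , [] , rising-refl
sorting {x ∷ V} (p ∷ uniq) with V′ , d , ρ ← sorting uniq =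
  insertDec x V′ , insertDec-Desc d x∉ , rising-trans (cong suc len) (rising-∷ x ρ) (rising-insert x d x∉)
  where
  open Rising ρ
  len : length V′ ≡ length V
  len = trans (cong length (sym reach)) (length-applyW V word)
  x∉ : x ∉ V′
  x∉ q = All.lookup (subst (All (x ≢_)) reach (applyW-All word p)) q refl

applyUpTo-down : ∀ n → applyUpTo (λ m → n ∸ suc m) n ≡ down 0 n
applyUpTo-down zero    = refl
applyUpTo-down (suc n) = cong (n ∷_) (applyUpTo-down n)

reverse-down : ∀ n → reverse (down 0 n) ≡ upTo n
reverse-down zero    = refl
reverse-down (suc n) = trans (unfold-reverse n (down 0 n)) (trans (cong (_∷ʳ n) (reverse-down n)) (applyUpTo-∷ʳ id n))

down-Desc : ∀ a n → Desc (down a n)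
down-Desc a zero    = []
down-Desc a (suc n) = down-< a n ∷ down-Desc a n

module _ {n : ℕ} (v : Permutation′ n) where

  private
    V : List ℕ
    V = line (v ⟨$⟩ʳ_)

  line-< : All (_< n) V
  line-< = All.applyUpTo⁺₁ (val (v ⟨$⟩ʳ_)) n λ {m} m<n → subst (_< n)
    (trans (sym (val-toℕ (v ⟨$⟩ʳ_) (fromℕ< m<n))) (cong (val (v ⟨$⟩ʳ_)) (toℕ-fromℕ< m<n))) (toℕ<n (v ⟨$⟩ʳ fromℕ< m<n))

  val-injective : ∀ {i j} → i < n → j < n → val (v ⟨$⟩ʳ_) i ≡ val (v ⟨$⟩ʳ_) j → i ≡ j
  val-injective {i} {j} i<n j<n e = begin
    i                                              ≡⟨ toℕ-fromℕ< i<n ⟨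
    toℕ (fromℕ< i<n)                               ≡⟨ cong toℕ (inverseˡ v) ⟨
    toℕ (v ⟨$⟩ˡ (v ⟨$⟩ʳ fromℕ< i<n))               ≡⟨ cong (λ k → toℕ (v ⟨$⟩ˡ k)) (toℕ-injective same) ⟩
    toℕ (v ⟨$⟩ˡ (v ⟨$⟩ʳ fromℕ< j<n))               ≡⟨ cong toℕ (inverseˡ v) ⟩
    toℕ (fromℕ< j<n)                               ≡⟨ toℕ-fromℕ< j<n ⟩
    j                                              ∎
    where
    open ≡-Reasoning
    value : ∀ {m} (m<n : m < n) → toℕ (v ⟨$⟩ʳ fromℕ< m<n) ≡ val (v ⟨$⟩ʳ_) m
    value m<n = trans (sym (val-toℕ (v ⟨$⟩ʳ_) (fromℕ< m<n))) (cong (val (v ⟨$⟩ʳ_)) (toℕ-fromℕ< m<n))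
    same : toℕ (v ⟨$⟩ʳ fromℕ< i<n) ≡ toℕ (v ⟨$⟩ʳ fromℕ< j<n)
    same = trans (value i<n) (trans e (sym (value j<n)))

  line-unique : Unique V
  line-unique = Unique.applyUpTo⁺₁ (val (v ⟨$⟩ʳ_)) n λ i<j j<n e →
    <-irrefl (val-injective (<-trans i<j j<n) j<n e) i<j

  private
    factor : Fin n → Fin n
    factor k = v ⟨$⟩ˡ opposite k

  reach-longest : ∀ {W} → IsReducedWord n factor W → applyW V W ≡ down 0 n
  reach-longest {W} (range , _ , e) = trans (applyW-applyUpTo (val (v ⟨$⟩ʳ_)) W range)
    (trans (applyUpTo-cong n step) (applyUpTo-down n))
    where
    step : ∀ m → m < n → val (v ⟨$⟩ʳ_) (act W m) ≡ n ∸ suc m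
    step m m<n = begin
      val (v ⟨$⟩ʳ_) (act W m)                    ≡⟨ cong (val (v ⟨$⟩ʳ_) ∘ act W) (toℕ-fromℕ< m<n) ⟨
      val (v ⟨$⟩ʳ_) (act W (toℕ k))              ≡⟨ cong (val (v ⟨$⟩ʳ_)) (toℕ-wordFun W k range) ⟨
      val (v ⟨$⟩ʳ_) (toℕ (wordFun W k))          ≡⟨ val-toℕ (v ⟨$⟩ʳ_) (wordFun W k) ⟩
      toℕ (v ⟨$⟩ʳ wordFun W k)                   ≡⟨ cong (λ j → toℕ (v ⟨$⟩ʳ j)) (e k) ⟩
      toℕ (v ⟨$⟩ʳ (v ⟨$⟩ˡ opposite k))           ≡⟨ cong toℕ (inverseʳ v) ⟩
      toℕ (opposite k)                           ≡⟨ opposite-prop k ⟩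
      n ∸ suc (toℕ k)                            ≡⟨ cong (λ z → n ∸ suc z) (toℕ-fromℕ< m<n) ⟩
      n ∸ suc m                                  ∎
      where
      open ≡-Reasoning
      k : Fin n
      k = fromℕ< m<n

  -- A sorting word of v is also a word of v⁻¹w₀, so it is at least as long as the reduced word W.
  reach-length : ∀ {W} → IsReducedWord n factor W → length W + invL V ≤ invL (down 0 n)
  reach-length {W} red@(range , len , _) with V′ , d , ρ ← sorting line-unique = begin
    length W + invL V                            ≡⟨ cong (_+ invL V) (trans len (inv-line factor)) ⟩
    invL (line factor) + invL V                  ≡⟨ cong (λ z → invL z + invL V) (applyUpTo-cong n same) ⟨
    invL (applyUpTo (act word) n) + invL V       ≤⟨ +-monoˡ-≤ (invL V) (invL-word word range′) ⟩
    length word + invL V                         ≡⟨ rise ⟩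
    invL V′                                      ≡⟨ cong invL V′≡ ⟩
    invL (down 0 n)                              ∎
    where
    open ≤-Reasoning
    open Rising ρ using (word; reach; rise)
    range′ : All (InRange n) word
    range′ = subst (λ z → All (InRange z) word) (length-applyUpTo (val (v ⟨$⟩ʳ_)) n) (Rising.range ρ)
    V′≡ : V′ ≡ down 0 n
    V′≡ = desc-full n d (All.tabulate λ _ → z≤n) (subst (All (_< n)) reach (applyW-All word line-<))
      (≤-reflexive (sym (trans (cong length (sym reach)) (trans (length-applyW V word) (length-applyUpTo (val (v ⟨$⟩ʳ_)) n)))))
    act-< : ∀ W {m} → All (InRange n) W → m < n → act W m < n
    act-< []          []             lt = lt
    act-< (suc k ∷ W) ((_ , p) ∷ ps) lt = swapℕ-< k (act W _) p (act-< W ps lt)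
    same : ∀ m → m < n → act word m ≡ val factor m
    -- The two positions are compared after applying v, which sends both to n-1-m.
    same m m<n = val-injective (act-< word range′ m<n) (subst (_< n) value (toℕ<n (factor (fromℕ< m<n)))) (begin-equality
      val (v ⟨$⟩ʳ_) (act word m)                 ≡⟨ applyUpTo-inj n (trans (sym (applyW-applyUpTo (val (v ⟨$⟩ʳ_)) word range′)) (trans reach (trans V′≡ (sym (applyUpTo-down n))))) m m<n ⟩
      n ∸ suc m                                  ≡⟨ cong (λ z → n ∸ suc z) (toℕ-fromℕ< m<n) ⟨
      n ∸ suc (toℕ k)                            ≡⟨ opposite-prop k ⟨
      toℕ (opposite k)                           ≡⟨ cong toℕ (inverseʳ v) ⟨
      toℕ (v ⟨$⟩ʳ factor k)                      ≡⟨ val-toℕ (v ⟨$⟩ʳ_) (factor k) ⟨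
      val (v ⟨$⟩ʳ_) (toℕ (factor k))             ≡⟨ cong (val (v ⟨$⟩ʳ_)) value ⟩
      val (v ⟨$⟩ʳ_) (val factor m)               ∎)
      where
      k : Fin n
      k = fromℕ< m<n
      value : toℕ (factor k) ≡ val factor m
      value = trans (sym (val-toℕ factor k)) (cong (val factor) (toℕ-fromℕ< m<n))

-- Coefficients of polynomials

_≟V_ : ∀ {n} (e f : Vec ℕ n) → Dec (e ≡ f)
_≟V_ = Vec.≡-dec _≟_

term : ∀ {n} → ℤ → Vec ℕ n → Vec ℕ n → ℤ
term c f e = if ⌊ f ≟V e ⌋ then c else 0ℤ

term-cong : ∀ {m n} c {f e : Vec ℕ m} {f′ e′ : Vec ℕ n} → (f ≡ e → f′ ≡ e′) → (f′ ≡ e′ → f ≡ e) → term c f e ≡ term c f′ e′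
term-cong c {f} {e} {f′} {e′} to from with f ≟V e | f′ ≟V e′
... | yes _ | yes _ = refl
... | no _  | no _  = refl
... | yes p | no q  = ⊥-elim (q (to p))
... | no p  | yes q = ⊥-elim (p (from q))

term-no : ∀ {n} c {f e : Vec ℕ n} → f ≢ e → term c f e ≡ 0ℤ
term-no c {f} {e} f≢e with f ≟V e
... | yes f≡e = ⊥-elim (f≢e f≡e)
... | no _    = refl

coeff-++ : ∀ {n} (p q : Poly n) e → coeff (p ++ q) e ≡ coeff p e ℤ.+ coeff q e
coeff-++ []            q e = sym (ℤ.+-identityˡ _)
coeff-++ ((c , f) ∷ p) q e = trans (cong (ℤ._+_ (term c f e)) (coeff-++ p q e)) (sym (ℤ.+-assoc (term c f e) (coeff p e) (coeff q e)))

coeff-neg : ∀ {n} (p : Poly n) e → coeff (map (λ t → ℤ.- proj₁ t , proj₂ t) p) e ≡ ℤ.- coeff p e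
coeff-neg []            e = refl
coeff-neg ((c , f) ∷ p) e = trans (cong₂ ℤ._+_ (neg ⌊ f ≟V e ⌋) (coeff-neg p e)) (sym (ℤ.neg-distrib-+ (term c f e) (coeff p e)))
  where
  neg : ∀ b → (if b then ℤ.- c else 0ℤ) ≡ ℤ.- (if b then c else 0ℤ)
  neg true  = refl
  neg false = refl

unit : ∀ {n} → ℕ → Vec ℕ n
unit i = Vec.tabulate (λ k → if does (suc (toℕ k) ≟ i) then 1 else 0)

zipWith-zeros : ∀ {n} (v : Vec ℕ n) → Vec.zipWith _+_ (Vec.tabulate (λ _ → 0)) v ≡ v
zipWith-zeros []      = refl
zipWith-zeros (p ∷ v) = cong (p ∷_) (zipWith-zeros v)

lowerE-sound : ∀ {n} j (v e : Vec ℕ n) → j < n → Vec.zipWith _+_ (unit (suc j)) v ≡ e → lowerE j e ≡ just v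
lowerE-sound zero    (p ∷ v) _ _ refl = cong (λ z → just (p ∷ z)) (zipWith-zeros v)
lowerE-sound (suc j) (p ∷ v) _ (s≤s lt) refl = cong (Maybe.map (p ∷_)) (lowerE-sound j v _ lt refl)

lowerE-complete : ∀ {n} j (v e : Vec ℕ n) → lowerE j e ≡ just v → Vec.zipWith _+_ (unit (suc j)) v ≡ e
lowerE-complete zero    _ (suc p ∷ e) refl = cong (suc p ∷_) (zipWith-zeros e)
lowerE-complete (suc j) v (p ∷ e) eq with lowerE j e in eq′
lowerE-complete (suc j) _ (p ∷ e) refl | just f = cong (p ∷_) (lowerE-complete j f e eq′)

-- The coefficients of x_{j+1} times the polynomial with coefficients G.
lowered : ∀ {n} → ℕ → (Vec ℕ n → ℤ) → Vec ℕ n → ℤ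
lowered j G e = maybe′ G 0ℤ (lowerE j e)

coeff-monomial : ∀ {n} j c (g : Poly n) e → j < n →
  coeff (map (λ s → c ℤ.* proj₁ s , Vec.zipWith _+_ (unit (suc j)) (proj₂ s)) g) e ≡ c ℤ.* lowered j (coeff g) e
coeff-monomial j c [] e lt with lowerE j e
... | just _  = sym (ℤ.*-zeroʳ c)
... | nothing = sym (ℤ.*-zeroʳ c)
coeff-monomial {n} j c ((d , v) ∷ g) e lt = trans (cong (ℤ._+_ (term (c ℤ.* d) (Vec.zipWith _+_ (unit (suc j)) v) e)) (coeff-monomial j c g e lt)) (cases (lowerE j e) refl)
  where
  cases : ∀ x → lowerE j e ≡ x → term (c ℤ.* d) (Vec.zipWith _+_ (unit (suc j)) v) e ℤ.+ c ℤ.* maybe′ (coeff g) 0ℤ x ≡ c ℤ.* maybe′ (coeff ((d , v) ∷ g)) 0ℤ x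
  cases nothing eq = trans (cong₂ ℤ._+_ (term-no (c ℤ.* d) {Vec.zipWith _+_ (unit (suc j)) v} {e} λ p → clash (trans (sym eq) (lowerE-sound j v e lt p))) (ℤ.*-zeroʳ c)) (sym (ℤ.*-zeroʳ c))
    where
    clash : ¬ (nothing ≡ just v)
    clash ()
  cases (just f) eq = trans (cong (ℤ._+ (c ℤ.* coeff g f)) (trans
      (term-cong (c ℤ.* d) {Vec.zipWith _+_ (unit (suc j)) v} {e} {v} {f} (λ p → sym (just-inj (trans (sym eq) (lowerE-sound j v e lt p)))) (λ { refl → lowerE-complete j f e eq }))
      (scale ⌊ v ≟V f ⌋))) (sym (ℤ.*-distribˡ-+ c (term d v f) (coeff g f)))
    where
    just-inj : ∀ {x y : Vec ℕ n} → just x ≡ just y → x ≡ y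
    just-inj refl = refl
    scale : ∀ b → (if b then c ℤ.* d else 0ℤ) ≡ c ℤ.* (if b then d else 0ℤ)
    scale true  = refl
    scale false = sym (ℤ.*-zeroʳ c)

coeff-divisor : ∀ {n} j (g : Poly n) e → suc j < n →
  coeff ((var (suc j) -P var (suc (suc j))) *P g) e ≡ lowered j (coeff g) e ℤ.- lowered (suc j) (coeff g) e
coeff-divisor {n} j g e lt = begin
  coeff (X ++ (Y ++ [])) e                    ≡⟨ cong (λ z → coeff (X ++ z) e) (++-identityʳ Y) ⟩
  coeff (X ++ Y) e                            ≡⟨ coeff-++ X Y e ⟩
  coeff X e ℤ.+ coeff Y e                     ≡⟨ cong₂ ℤ._+_ (coeff-monomial j 1ℤ g e (<⇒≤ lt)) (coeff-monomial (suc j) (ℤ.- 1ℤ) g e lt) ⟩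
  1ℤ ℤ.* lowered j (coeff g) e ℤ.+ (ℤ.- 1ℤ) ℤ.* lowered (suc j) (coeff g) e
                                              ≡⟨ cong₂ ℤ._+_ (ℤ.*-identityˡ (lowered j (coeff g) e)) (ℤ.-1*i≡-i (lowered (suc j) (coeff g) e)) ⟩
  lowered j (coeff g) e ℤ.- lowered (suc j) (coeff g) e ∎
  where
  open ≡-Reasoning
  X Y : Poly n
  X = map (λ s → 1ℤ ℤ.* proj₁ s , Vec.zipWith _+_ (unit (suc j)) (proj₂ s)) g
  Y = map (λ s → (ℤ.- 1ℤ) ℤ.* proj₁ s , Vec.zipWith _+_ (unit (suc (suc j))) (proj₂ s)) g

swapE-invol : ∀ {n} j (e : Vec ℕ n) → swapE j (swapE j e) ≡ e
swapE-invol zero    []          = refl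
swapE-invol zero    (p ∷ [])    = refl
swapE-invol zero    (p ∷ q ∷ e) = refl
swapE-invol (suc j) []          = refl
swapE-invol (suc j) (p ∷ e)     = cong (p ∷_) (swapE-invol j e)

lookup-swapE : ∀ {n} j (v : Vec ℕ n) (k l : Fin n) → suc j < n → toℕ l ≡ swapℕ (suc j) (toℕ k) → Vec.lookup (swapE j v) k ≡ Vec.lookup v l
lookup-swapE zero    (p ∷ q ∷ v) zero          (suc zero)    _ _ = refl
lookup-swapE zero    (p ∷ q ∷ v) (suc zero)    zero          _ _ = refl
lookup-swapE zero    (p ∷ q ∷ v) (suc (suc k)) (suc (suc l)) _ e with refl ← toℕ-injective (suc-injective (suc-injective e)) = refl
lookup-swapE zero    (p ∷ []) _ _ (s≤s ()) _
lookup-swapE (suc j) (p ∷ v) zero    zero    _ _ = refl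
lookup-swapE (suc j) (p ∷ v) zero    (suc l) _ ()
lookup-swapE (suc j) (p ∷ v) (suc k) l (s≤s lt) e rewrite swapℕ-suc j (toℕ k) with l
... | suc l′ = lookup-swapE j v k l′ lt (suc-injective e)

tabulate-swap : ∀ {n} j (v : Vec ℕ n) → suc j < n → Vec.tabulate (λ k → Vec.lookup v (sw (suc j) k)) ≡ swapE j v
tabulate-swap j v lt = trans
  (Vec.tabulate-cong (λ k → sym (lookup-swapE j v k (sw (suc j) k) lt (toℕ-sw (suc j) k (s≤s z≤n , lt)))))
  (Vec.tabulate∘lookup (swapE j v))

coeff-swapVars : ∀ {n} j (p : Poly n) e → suc j < n → coeff (swapVars (suc j) p) e ≡ coeff p (swapE j e)
coeff-swapVars j []            e lt = refl
coeff-swapVars j ((c , v) ∷ p) e lt = cong₂ ℤ._+_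
  (term-cong c {Vec.tabulate (λ k → Vec.lookup v (sw (suc j) k))} {e} {v} {swapE j e}
    (λ eq → trans (sym (swapE-invol j v)) (cong (swapE j) (trans (sym (tabulate-swap j v lt)) eq)))
    (λ eq → trans (tabulate-swap j v lt) (trans (cong (swapE j) eq) (swapE-invol j e))))
  (coeff-swapVars j p e lt)

coeff-difference : ∀ {n} j (f : Poly n) e → suc j < n → coeff (f -P swapVars (suc j) f) e ≡ coeff f e ℤ.- coeff f (swapE j e)
coeff-difference j f e lt = trans (coeff-++ f _ e) (cong (ℤ._+_ (coeff f e)) (trans (coeff-neg (swapVars (suc j) f) e) (cong ℤ.-_ (coeff-swapVars j f e lt))))

-- Multiplication by x_{j+1} - x_{j+2} is injective: the coefficient at (p, q) is determined by the one at
-- (p+1, q-1), down to q = 0.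
divisor-injective : ∀ {n} j (G K : Vec ℕ n → ℤ) → suc j < n →
  (∀ e → lowered j G e ℤ.+ lowered (suc j) K e ≡ lowered j K e ℤ.+ lowered (suc j) G e) → ∀ e → G e ≡ K e
divisor-injective {suc (suc n)} zero G K lt h (p ∷ q ∷ e) = slide q p
  where
  slide : ∀ q p → G (p ∷ q ∷ e) ≡ K (p ∷ q ∷ e)
  slide zero    p = ∙-cancelʳ 0ℤ _ _ (h (suc p ∷ 0 ∷ e))
  slide (suc q) p = ∙-cancelʳ (K (suc p ∷ q ∷ e)) _ _ (trans (h (suc p ∷ suc q ∷ e)) (cong (ℤ._+_ (K (p ∷ suc q ∷ e))) (slide q (suc p))))
divisor-injective (suc j) G K (s≤s lt) h (p ∷ e) = divisor-injective j (G ∘ (p ∷_)) (K ∘ (p ∷_)) lt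
  (λ f → trans (sym (cong₂ ℤ._+_ (rest j G f) (rest (suc j) K f))) (trans (h (p ∷ f)) (cong₂ ℤ._+_ (rest j K f) (rest (suc j) G f)))) e
  where
  rest : ∀ i (G : _ → ℤ) f → lowered (suc i) G (p ∷ f) ≡ lowered i (G ∘ (p ∷_)) f
  rest i G f with lowerE i f
  ... | just _  = refl
  ... | nothing = refl
divisor-injective {suc zero} zero G K (s≤s ()) h e

-- The two parts of the theorem

≤-maximum : ∀ {x xs} → x ∈ xs → x ≤ foldr _⊔_ 0 xs
≤-maximum {x} (here {xs = xs} refl) = m≤m⊔n x (foldr _⊔_ 0 xs)
≤-maximum {xs = y ∷ ys} (there q) = ≤-trans (≤-maximum q) (m≤n⊔m y (foldr _⊔_ 0 ys))

maximum-≤ : ∀ {b xs} → All (_≤ b) xs → foldr _⊔_ 0 xs ≤ b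
maximum-≤ []       = z≤n
maximum-≤ (p ∷ ps) = ⊔-lub p (maximum-≤ ps)

isDesc-applyUpTo : ∀ f k n → isDesc k (applyUpTo f n) ≡ true → suc k < n × f (suc k) < f k
isDesc-applyUpTo f zero    (suc (suc n)) d = s<s z<s , <ᵇ⇒< (f 1) (f 0) (subst T (sym d) _)
isDesc-applyUpTo f (suc k) (suc n) d with p , q ← isDesc-applyUpTo (f ∘ suc) k n d = s<s p , q

descent-bound : ∀ {n} (u : Fin n → Fin n) k → isDesc k (line u) ≡ true → suc k ≤ rightmostDescent u
descent-bound {zero}  u k d with () ← proj₁ (isDesc-applyUpTo (val u) k zero d)
descent-bound {suc n} u k d with s≤s lt , desc ← isDesc-applyUpTo (val u) k (suc n) d =
  ≤-maximum (∈-map⁺ suc (∈-filter⁺ (λ m → val u (suc m) <? val u m) (∈-upTo⁺ lt) desc))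

rightmostDescent-≤ : ∀ {n} (u : Fin n → Fin n) → rightmostDescent u ≤ n
rightmostDescent-≤ {n} u = maximum-≤ (All.map⁺ (All.filter⁺ (λ m → val u (suc m) <? val u m)
  (All.applyUpTo⁺₁ id (n ∸ 1) λ lt → ≤-trans lt (m∸n≤m n 1))))

-- Fills the ℓ blocks of a factorization up to the n factors of the nilCoxeter product.
pad : ℕ → Fact → Fact
pad k r = r ++ replicate k []

concat-pad : ∀ k r → concat (pad k r) ≡ concat r
concat-pad zero    []      = refl
concat-pad (suc k) []      = concat-pad k []
concat-pad k       (b ∷ r) = cong (b ++_) (concat-pad k r)

block-pad : ∀ k r j → block (pad k r) j ≡ block r j
block-pad zero    []      j       = refl
block-pad (suc k) []      zero    = refl
block-pad (suc k) []      (suc j) = block-pad k [] j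
block-pad k       (b ∷ r) zero    = refl
block-pad k       (b ∷ r) (suc j) = block-pad k r j

block-beyond : ∀ r j → length r ≤ j → block r j ≡ []
block-beyond []      j       _        = refl
block-beyond (b ∷ r) (suc j) (s≤s le) = block-beyond r j le

pad-cutoff : ∀ {k} i r → All Desc r → YoungCutoff (suc i) r → All (_< i + (length r + k)) (concat r) → Cutoff (length r + k) i (pad k r)
pad-cutoff {zero}  i []      _        _       _  = []
pad-cutoff {suc k} i []      _        _       _  = ([] , []) ∷ pad-cutoff {k} (suc i) [] [] _ []
pad-cutoff {k}     i (b ∷ r) (d ∷ ds) (c , cs) lt =
  (d , All.zipWith (λ {x} (p , q) → p , s≤s⁻¹ (subst (x <_) (+-suc i (length r + k)) q)) (c , All.++⁻ˡ b lt))
  ∷ pad-cutoff (suc i) r ds cs (All.map (λ {x} → subst (x <_) (+-suc i (length r + k))) (All.++⁻ʳ b lt))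

cutoff-take : ∀ ℓ {k i r} → Cutoff (ℓ + k) i r → ∃₂ λ r₁ r₂ → r ≡ r₁ ++ r₂ × length r₁ ≡ ℓ × All Desc r₁ × YoungCutoff (suc i) r₁ × Cutoff k (ℓ + i) r₂
cutoff-take zero c = [] , _ , refl , refl , [] , _ , c
cutoff-take (suc ℓ) {k} {i} ((d , a) ∷ c) with r₁ , r₂ , refl , l , ds , y , c′ ← cutoff-take ℓ c =
  _ ∷ r₁ , r₂ , refl , cong suc l , d ∷ ds , (All.map proj₁ a , y) , subst (λ z → Cutoff k z r₂) (+-suc ℓ i) c′

cutoff-empty : ∀ {m i r} → Cutoff m i r → concat r ≡ [] → r ≡ replicate m []
cutoff-empty []                  _ = refl
cutoff-empty (_∷_ {b = []} _ c)  e = cong ([] ∷_) (cutoff-empty c e)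

-- The last letter of a reduced word is a descent, so it cannot exceed the rightmost one. Hence all
-- blocks after the first ℓ are empty.
reduced-tail : ∀ {n} (u : Fin n → Fin n) W₁ {W₂} → Reverse W₂ → Reduced n (line u) (W₁ ++ W₂) → All (rightmostDescent u <_) W₂ → W₂ ≡ []
reduced-tail u W₁ [] _ _ = refl
reduced-tail {n} u W₁ (W ∶ _ ∶ʳ zero) (r , _) _ with () ← proj₁ (All.lookup r (∈-++⁺ʳ W₁ (∈-++⁺ʳ W (here refl))))
reduced-tail {n} u W₁ (W ∶ _ ∶ʳ suc k) red high = ⊥-elim (<⇒≱ (All.lookup high (∈-++⁺ʳ W (here refl)))
  (descent-bound u k (proj₁ (reduced-snoc⁻ (W₁ ++ W) k (subst (Reduced n (line u)) (sym (++-assoc W₁ W (suc k ∷ []))) red)))))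

tab : (ℕ → ℕ) → ∀ n → Vec ℕ n
tab g n = Vec.tabulate (g ∘ toℕ)

tab-∷ʳ : ∀ g n → tab g (suc n) ≡ tab g n Vec.∷ʳ g n
tab-∷ʳ g zero    = refl
tab-∷ʳ g (suc n) = cong (g 0 ∷_) (tab-∷ʳ (g ∘ suc) n)

tab-cong : ∀ {g h} n → (∀ j → j < n → g j ≡ h j) → tab g n ≡ tab h n
tab-cong n p = Vec.tabulate-cong (λ k → p (toℕ k) (toℕ<n k))

reverse-tab : ∀ h n → Vec.reverse (tab h n) ≡ tab (λ j → h (n ∸ suc j)) n
reverse-tab h zero    = refl
reverse-tab h (suc n) = begin
  Vec.reverse (h 0 ∷ tab (h ∘ suc) n)                 ≡⟨ Vec.reverse-∷ (h 0) (tab (h ∘ suc) n) ⟩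
  Vec.reverse (tab (h ∘ suc) n) Vec.∷ʳ h 0            ≡⟨ cong (Vec._∷ʳ h 0) (reverse-tab (h ∘ suc) n) ⟩
  tab (λ j → h (suc (n ∸ suc j))) n Vec.∷ʳ h 0        ≡⟨ cong₂ Vec._∷ʳ_ (tab-cong n λ j lt → cong h (sym (+-∸-assoc 1 lt))) (cong h (sym (n∸n≡0 n))) ⟩
  tab (λ j → h (n ∸ j)) n Vec.∷ʳ h (n ∸ n)            ≡⟨ tab-∷ʳ (λ j → h (n ∸ j)) n ⟨
  tab (λ j → h (suc n ∸ suc j)) (suc n)               ∎
  where open ≡-Reasoning

-- `wt` lists the blocks from the right, after n-ℓ zeros. The reversal of the variables restores the
-- order of the blocks, and the zeros become the sizes of the padding.
reverse-wt : ∀ {n ℓ} r → length r ≡ ℓ → ℓ ≤ n → Vec.reverse (wt n ℓ r) ≡ sizes n r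
reverse-wt {n} {ℓ} r len ℓ≤n = trans (reverse-tab h n) (tab-cong n entry)
  where
  h : ℕ → ℕ
  h m = if does (m <? n ∸ ℓ) then 0 else length (block r (ℓ ∸ suc (m ∸ (n ∸ ℓ))))
  entry : ∀ j → j < n → h (n ∸ suc j) ≡ length (block r j)
  entry j j<n with suc j ≤? ℓ
  ... | yes j<ℓ = trans (cong (if_then 0 else length (block r (ℓ ∸ suc (n ∸ suc j ∸ (n ∸ ℓ))))) (dec-false (n ∸ suc j <? n ∸ ℓ) (≤⇒≯ (∸-monoʳ-≤ n j<ℓ))))
        (cong (length ∘ block r) (reflect-position j<ℓ ℓ≤n))
  ... | no j≮ℓ = trans (cong (if_then 0 else length (block r (ℓ ∸ suc (n ∸ suc j ∸ (n ∸ ℓ))))) (dec-true (n ∸ suc j <? n ∸ ℓ) (∸-monoʳ-< (≰⇒> j≮ℓ) j<n)))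
        (sym (cong length (block-beyond r j (subst (_≤ j) (sym len) (s≤s⁻¹ (≰⇒> j≮ℓ))))))

module _ {n : ℕ} (v : Permutation′ n) where

  private
    ℓ : ℕ
    ℓ = ℓOf v
    V : List ℕ
    V = line (v ⟨$⟩ʳ_)
    ℓ≤n : ℓ ≤ n
    ℓ≤n = rightmostDescent-≤ (v ⟨$⟩ʳ_)

  padded : Fact → Fact
  padded = pad (n ∸ ℓ)

  rfyc⇒ : ∀ {r} → IsRFYC n v r → padded r ∈ facts n 0 (sizes n r) × Reduced n V (concat (padded r))
  rfyc⇒ {r} ((len , linked , red) , cut) =
      subst (λ e → padded r ∈ facts n 0 e) (Vec.tabulate-cong λ k → cong length (block-pad (n ∸ ℓ) r (toℕ k))) (∈-facts⁺ c)
    , subst (Reduced n V) (sym (concat-pad (n ∸ ℓ) r)) (reduced⇒ red)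
    where
    n≡ : length r + (n ∸ ℓ) ≡ n
    n≡ = trans (cong (_+ (n ∸ ℓ)) len) (m+[n∸m]≡n ℓ≤n)
    c : Cutoff n 0 (padded r)
    c = subst (λ m → Cutoff m 0 (padded r)) n≡ (pad-cutoff 0 r (All.map linked⇒desc linked) cut
      (subst (λ m → All (_< m) (concat r)) (sym n≡) (All.map proj₂ (proj₁ red))))

  rfyc⇐ : ∀ {e r} → r ∈ facts n 0 e → Reduced n V (concat r) → ∃ λ r₁ → r ≡ padded r₁ × IsRFYC n v r₁ × sizes n r₁ ≡ e
  rfyc⇐ {e} {r} r∈ red with c , s ← ∈-facts⁻ {n} r∈
    with r₁ , r₂ , refl , len , ds , y , c₂ ← cutoff-take ℓ (subst (λ m → Cutoff m 0 r) (sym (m+[n∸m]≡n ℓ≤n)) c)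
    with refl ← cutoff-empty c₂ (reduced-tail (v ⟨$⟩ʳ_) (concat r₁) (reverseView (concat r₂))
      (subst (Reduced n V) (sym (concat-++ r₁ r₂)) red) (All.map (λ {x} (p , _) → subst (_< x) (+-identityʳ ℓ) p) (cutoff-range c₂)))
    = r₁ , refl , ((len , All.map AllPairs⇒Linked ds , reduced⇐ (subst (Reduced n V) (concat-pad (n ∸ ℓ) r₁) red)) , y)
    , trans (Vec.tabulate-cong λ k → cong length (sym (block-pad (n ∸ ℓ) r₁ (toℕ k)))) s

  module _ {L : List Fact} (uniq : Unique L) (iff : ∀ r → r ∈ L ⇔ IsRFYC n v r) where

    -- Padding is injective and neither list has repetitions, so equality as sets gives equal
    -- lengths.
    weight-count : ∀ e → length (filter (λ r → sizes n r ≟V e) L) ≡ N n e V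
    weight-count e = begin
      length X                        ≡⟨ length-map padded X ⟨
      length (map padded X)           ≡⟨ ↭-length (∼bag⇒↭ (unique∧set⇒bag
                                           (Unique.map⁺ (λ {x} {y} → ++-cancelʳ (replicate (n ∸ ℓ) []) x y) (Unique.filter⁺ (λ r → sizes n r ≟V e) uniq))
                                           (Unique.filter⁺ (λ r → reduced? n V (concat r)) (facts-unique n 0 e))
                                           (mk⇔ to from))) ⟩
      length Y                        ≡⟨ N-count n e V ⟨
      N n e V                         ∎
      where
      open ≡-Reasoning
      X Y : List Fact
      X = filter (λ r → sizes n r ≟V e) L
      Y = filter (λ r → reduced? n V (concat r)) (facts n 0 e)
      to : ∀ {x} → x ∈ map padded X → x ∈ Y
      to x∈ with r , r∈ , refl ← ∈-map⁻ padded x∈ with r∈L , refl ← ∈-filter⁻ (λ r → sizes n r ≟V e) {xs = L} r∈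
        with p , q ← rfyc⇒ (Equivalence.to (iff r) r∈L) = ∈-filter⁺ (λ r → reduced? n V (concat r)) p q
      from : ∀ {x} → x ∈ Y → x ∈ map padded X
      from x∈ with p , q ← ∈-filter⁻ (λ r → reduced? n V (concat r)) {xs = facts n 0 e} x∈
        with r , refl , yc , s ← rfyc⇐ p q = ∈-map⁺ padded (∈-filter⁺ (λ r → sizes n r ≟V e) (Equivalence.from (iff r) yc) s)

    coeff-sumWt : ∀ e → coeff (reverseVars (sumWt n ℓ L)) e ≡ ℤ.+ N n e V
    coeff-sumWt e = trans (go L λ {r} r∈ → proj₁ (proj₁ (Equivalence.to (iff r) r∈))) (cong ℤ.+_ (weight-count e))
      where
      go : ∀ M → (∀ {r} → r ∈ M → length r ≡ ℓ) → coeff (reverseVars (sumWt n ℓ M)) e ≡ ℤ.+ length (filter (λ r → sizes n r ≟V e) M)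
      go []      h = refl
      go (r ∷ M) h rewrite go M (h ∘ there) | reverse-wt {n} r (h (here refl)) ℓ≤n with sizes n r ≟V e
      ... | yes _ = refl
      ... | no _  = refl

-- Induction along the divided differences

tabulate-stairs : ∀ n → Vec.tabulate {n = n} (λ k → n ∸ suc (toℕ k)) ≡ stairs n
tabulate-stairs zero    = refl
tabulate-stairs (suc n) = cong (n ∷_) (tabulate-stairs n)

lowered-N : ∀ {n} j V e → ℤ.+ maybe′ (λ f → N n f V) 0 (lowerE j e) ≡ lowered j (λ f → ℤ.+ N n f V) e
lowered-N j V e with lowerE j e
... | just _  = refl
... | nothing = refl

balance : ∀ a b c d x y → a ℤ.- b ≡ x ℤ.- y → x ℤ.+ d ≡ y ℤ.+ c → a ℤ.+ d ≡ c ℤ.+ b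
balance a b c d x y p q = begin
  a ℤ.+ d                            ≡⟨ l₁ a b d ⟩
  (a ℤ.- b) ℤ.+ (b ℤ.+ d)            ≡⟨ cong (ℤ._+ (b ℤ.+ d)) p ⟩
  (x ℤ.- y) ℤ.+ (b ℤ.+ d)            ≡⟨ l₂ x y b d ⟩
  (x ℤ.+ d) ℤ.+ (b ℤ.- y)            ≡⟨ cong (ℤ._+ (b ℤ.- y)) q ⟩
  (y ℤ.+ c) ℤ.+ (b ℤ.- y)            ≡⟨ l₃ y c b ⟩
  c ℤ.+ b                            ∎
  where
  open ≡-Reasoning
  l₁ : ∀ a b d → a ℤ.+ d ≡ (a ℤ.- b) ℤ.+ (b ℤ.+ d)
  l₁ = ℤ-Solver.solve-∀
  l₂ : ∀ x y b d → (x ℤ.- y) ℤ.+ (b ℤ.+ d) ≡ (x ℤ.+ d) ℤ.+ (b ℤ.- y)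
  l₂ = ℤ-Solver.solve-∀
  l₃ : ∀ y c b → (y ℤ.+ c) ℤ.+ (b ℤ.- y) ≡ c ℤ.+ b
  l₃ = ℤ-Solver.solve-∀

-- The inner chain computes the counts at the swapped list V′; then g and the counts at V solve the
-- same division problem, whose solution is unique. The length hypothesis makes each letter an
-- ascent of the current list, as `N-exchange` requires.
divided-difference : ∀ {n} V W g → All (InRange n) W → applyW V W ≡ down 0 n → length W + invL V ≤ invL (down 0 n) →
  IsDivDiffWord W (staircase n) g → ∀ e → coeff g e ≡ ℤ.+ N n e V
divided-difference {n} V [] g _ refl _ eq e = begin
  coeff g e                                         ≡⟨ eq e ⟨
  coeff (staircase n) e                             ≡⟨ ℤ.+-identityʳ _ ⟩
  term 1ℤ (Vec.tabulate (λ k → n ∸ suc (toℕ k))) e  ≡⟨ cong (λ s → term 1ℤ s e) (tabulate-stairs n) ⟩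
  term 1ℤ (stairs n) e                              ≡⟨ indicator ⟩
  ℤ.+ (if does (stairs n ≟V e) then 1 else 0)       ≡⟨ cong ℤ.+_ (N-longest e (down 0 n) (down-Desc 0 n) (reverse-down n)) ⟨
  ℤ.+ N n e (down 0 n)                              ∎
  where
  open ≡-Reasoning
  indicator : term 1ℤ (stairs n) e ≡ ℤ.+ (if does (stairs n ≟V e) then 1 else 0)
  indicator with stairs n ≟V e
  ... | yes _ = refl
  ... | no _  = refl
divided-difference {n} V (suc k ∷ W) g ((_ , lt) ∷ range) reach short (h , dd , div) =
  divisor-injective k (coeff g) (λ e → ℤ.+ N n e V) lt λ e → balance
    (lowered k (coeff g) e) (lowered (suc k) (coeff g) e) (lowered k (λ f → ℤ.+ N n f V) e) (lowered (suc k) (λ f → ℤ.+ N n f V) e)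
    (ℤ.+ N n e V′) (ℤ.+ N n (swapE k e) V′) (coeff-relation e) (N-relation e)
  where
  V′ : List ℕ
  V′ = swapL k V
  rises : suc (invL V) ≤ invL V′
  -- The remaining word is too short to reach the longest element unless the first letter adds an
  -- inversion.
  rises = +-cancelˡ-≤ (length W) _ _ (begin
    length W + suc (invL V)   ≡⟨ +-suc (length W) (invL V) ⟩
    suc (length W + invL V)   ≤⟨ short ⟩
    invL (down 0 n)           ≡⟨ cong invL reach ⟨
    invL (applyW V′ W)        ≤⟨ invL-applyW V′ W ⟩
    length W + invL V′        ∎)
    where open ≤-Reasoning
  desc : isDesc k V′ ≡ true
  desc with isDesc k V′ in d
  ... | true  = refl
  ... | false = ⊥-elim (<⇒≱ rises (subst (invL V′ ≤_) (cong invL (swapL-invol k V)) (invL-nodesc k V′ d)))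
  short′ : length W + invL V′ ≤ invL (down 0 n)
  short′ = ≤-trans (+-monoʳ-≤ (length W) (invL-swapL k V)) (≤-trans (≤-reflexive (+-suc (length W) (invL V))) short)
  coeff-h : ∀ e → coeff h e ≡ ℤ.+ N n e V′
  coeff-h = divided-difference V′ W h range reach short′ dd
  coeff-relation : ∀ e → lowered k (coeff g) e ℤ.- lowered (suc k) (coeff g) e ≡ ℤ.+ N n e V′ ℤ.- ℤ.+ N n (swapE k e) V′
  coeff-relation e = begin
    lowered k (coeff g) e ℤ.- lowered (suc k) (coeff g) e    ≡⟨ coeff-divisor k g e lt ⟨
    coeff ((var (suc k) -P var (suc (suc k))) *P g) e        ≡⟨ div e ⟩
    coeff (h -P swapVars (suc k) h) e                        ≡⟨ coeff-difference k h e lt ⟩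
    coeff h e ℤ.- coeff h (swapE k e)                        ≡⟨ cong₂ ℤ._-_ (coeff-h e) (coeff-h (swapE k e)) ⟩
    ℤ.+ N n e V′ ℤ.- ℤ.+ N n (swapE k e) V′                  ∎
    where open ≡-Reasoning
  N-relation : ∀ e → ℤ.+ N n e V′ ℤ.+ lowered (suc k) (λ f → ℤ.+ N n f V) e ≡ ℤ.+ N n (swapE k e) V′ ℤ.+ lowered k (λ f → ℤ.+ N n f V) e
  N-relation e = begin
    ℤ.+ N n e V′ ℤ.+ lowered (suc k) (λ f → ℤ.+ N n f V) e  ≡⟨ cong (ℤ._+_ (ℤ.+ N n e V′)) (low (suc k)) ⟨
    ℤ.+ (N n e V′ + maybe′ (λ f → N n f (swapL k V′)) 0 (lowerE (suc k) e)) ≡⟨ cong ℤ.+_ (N-exchange k e V′ lt desc) ⟩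
    ℤ.+ (N n (swapE k e) V′ + maybe′ (λ f → N n f (swapL k V′)) 0 (lowerE k e)) ≡⟨ cong (ℤ._+_ (ℤ.+ N n (swapE k e) V′)) (low k) ⟩
    ℤ.+ N n (swapE k e) V′ ℤ.+ lowered k (λ f → ℤ.+ N n f V) e ∎
    where
    open ≡-Reasoning
    low : ∀ j → ℤ.+ maybe′ (λ f → N n f (swapL k V′)) 0 (lowerE j e) ≡ lowered j (λ f → ℤ.+ N n f V) e
    low j = trans (lowered-N j (swapL k V′) e) (cong (λ z → lowered j (λ f → ℤ.+ N n f z) e) (swapL-invol k V))

schubert-rfyc : ∀ {n} (v : Permutation′ n) L → Unique L → (∀ r → r ∈ L ⇔ IsRFYC n v r) → SchubertIs n v (reverseVars (sumWt n (ℓOf v) L))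
schubert-rfyc v L uniq iff W red g dd e = trans
  (divided-difference (line (v ⟨$⟩ʳ_)) W g (proj₁ red) (reach-longest v red) (reach-length v red) dd e)
  (sym (coeff-sumWt v uniq iff e))

mainTheorem17 : (n : ℕ) → (w : Permutation′ n) →
    ((L : List Fact) → Unique L → ((r : Fact) → (r ∈ L) ⇔ IsRFYC n (revP w) r) →
    YoungSchubertIs n w (sumWt n (ℓOf (revP w)) L))
    × Σ (List (Fact × List ℕ)) (λ U →
    Unique (map proj₁ U)
    × All (λ t → IsRF n w (ℓOf w) (proj₁ t) × IsLowest n (ℓOf w) (proj₁ t)) U
    × ((r : Fact) → IsRFYC n w r ⇔
    Any (λ t → InDemazure n w (ℓOf w) (proj₂ t) (proj₁ t) r) U))
-- `YoungSchubertIs` unfolds to the Schubert statement for the reversed permutation with reversed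
-- variables.
mainTheorem17 n w = schubert-rfyc (revP w) , Crystal.generators-cutoff n w (ℓOf w) (rightmostDescent-≤ (w ⟨$⟩ʳ_))
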